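{- Let $d,m\ge 2$ be integers, let $H$ be a prime field, and let $\mathbb{F}$ be an extension of $H$ of degree $[\mathbb{F}:H]=m$ with $|\mathbb{F}|\ge 2md$. Let $\delta=1-d/|\mathbb{F}|$ and let $\tau\le\delta/2$ and $\rho\le\delta/8$. Consider the $m$-step $H$-plane-line random walk (described in the context) run on input $f\colon\mathbb{F}^m\to\mathbb{F}$ and $x\in\mathbb{F}^m$. Then: (1) (perfect completeness) if $f\in\mathrm{RM}_{\mathbb{F}}(m,d)$, then for every $x$ and every outcome of the walk, each restriction $f|_{P_i}$, $0\le i\le m$, lies in $\mathrm{RM}_{\mathbb{F}}(2,d)$; (2) (robust soundness) if $\mathrm{dist}(f,Q^*)\le\tau$ for some $Q^*\in\mathrm{RM}_{\mathbb{F}}(m,d)$ but $f(x)\ne Q^*(x)$, then \[ \Pr\Big[\mathrm{dist}_{\{(0,0)\}}\big(f|_{P_0},\mathrm{RM}_{\mathbb{F}}(2,d)\big)\ge\rho\ \ \vee\ \ \exists i\in[m]:\ \mathrm{dist}_{L}\big(f|_{P_i},\mathrm{RM}_{\mathbb{F}}(2,d)\big)\ge\rho\Big]\ \ge\ \Big(1-\frac{4}{|\mathbb{F}|}\Big)^m-\frac{\tau+\frac{2}{|H|}}{\delta-2\rho}, \] where $L=\{(t,0):t\in\mathbb{F}\}\subseteq\mathbb{F}^2$.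
   Context: $\mathrm{RM}_{\mathbb{F}}(m,d)$ is the set of evaluation tables $\mathbb{F}^m\to\mathbb{F}$ of polynomials in $m$ variables of total degree at most $d$ over $\mathbb{F}$. $\mathrm{dist}$ is relative Hamming distance. Weighted distance: for $N$-length strings $u,v$ indexed by a set $I$ with $|I|=N$ and $\emptyset\ne A\subseteq I$, $\mathrm{dist}_A(u,v)=\frac{|\{i\in A:u_i\ne v_i\}|}{2|A|}+\frac{|\{i\in I:u_i\ne v_i\}|}{2N}$, and $\mathrm{dist}_A(u,S)=\min_{v\in S}\mathrm{dist}_A(u,v)$. For $a\in\mathbb{F}^m$ and $h,h'\in\mathbb{F}^m$, the plane $P=(a,h,h')$ is $\{a+th+sh':t,s\in\mathbb{F}\}$ and $f|_P\colon\mathbb{F}^2\to\mathbb{F}$ is $(t,s)\mapsto f(a+th+sh')$ (so $(0,0)$ corresponds to $a$ and $L=\{(t,0)\}$ corresponds to the line $\{a+th:t\in\mathbb{F}\}$). The $m$-step $H$-plane-line random walk from $x$: set $x_0=x$, choose $h_0,h_0'\in H^m$ uniformly, and let $P_0=(x_0,h_0,h_0')$. For $i=1,\dots,m$: choose $s_{i-1},s'_{i-1},t_{i-1},t'_{i-1}\in\mathbb{F}$ uniformly, set $x_i=x_{i-1}+s_{i-1}h_{i-1}+s'_{i-1}h'_{i-1}$, $h_i=t_{i-1}h_{i-1}+t'_{i-1}h'_{i-1}$, the line $\ell_i=\{x_i+th_i:t\in\mathbb{F}\}$, choose $h'_i\in H^m$ uniformly, and set $P_i=(x_i,h_i,h'_i)$.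 All random choices are independent.
   Formalization: The parameters τ and ρ are taken to be rational numbers instead of real numbers. -}

module Defs where

open import Algebra.Bundles using (CommutativeRing)
open import Algebra.Bundles.Raw using (RawRing)
open import Algebra.Structures using (IsCommutativeRing)
open import Algebra.Morphism.Structures using (IsRingHomomorphism)
import Algebra.Definitions.RawSemiring as RawSemiringDefs
open import Data.Fin.Base using (Fin; zero; suc)
open import Data.Fin.Properties using (any?)
open import Data.Integer.Base using (+_; +<+)
import Data.Integer.Base as ℤ
import Data.Integer.Properties as ℤₚ
open import Data.List.Base as List using (List; []; _∷_; length; filter; cartesianProduct; cartesianProductWith; upTo)
open import Data.List.Membership.Propositional using (_∈_)
open import Data.List.Membership.Propositional.Properties
  using (∈-cartesianProduct⁺; ∈-cartesianProductWith⁺; ∈-filter⁺)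
open import Data.List.Relation.Unary.Any using (here; there)
open import Data.List.Relation.Unary.All using ([])
open import Data.List.Relation.Unary.AllPairs using ([]; _∷_)
open import Data.List.Relation.Unary.Unique.Propositional using (Unique)
import Data.List.Relation.Unary.Unique.Propositional.Properties as Unique
open import Data.Nat.Base as ℕ using (ℕ; zero; suc; z≤n; s≤s)
import Data.Nat.Properties as ℕₚ
open import Data.Product.Base using (_×_; _,_; ∃)
open import Data.Rational.Base as ℚ using (ℚ; 0ℚ; 1ℚ; _/_)
import Data.Rational.Properties as ℚₚ
open import Data.Rational.Unnormalised.Base as ℚᵘ using (mkℚᵘ; *<*)
import Data.Rational.Unnormalised.Properties as ℚᵘₚ
open import Relation.Binary.Bundles using (DecTotalOrder)
open import Data.List.Extrema (DecTotalOrder.totalOrder ℚₚ.≤-decTotalOrder) using (min)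
open import Data.Sum.Base using (_⊎_)
open import Data.Vec.Base as Vec using (Vec; []; _∷_; lookup; replicate; zipWith; toList)
open import Data.Vec.Properties using (∷-injective; ≡-dec)
open import Level using (0ℓ)
open import Relation.Binary.Definitions using (DecidableEquality)
open import Relation.Binary.PropositionalEquality
  using (_≡_; _≢_; refl; sym; subst; subst₂)
open import Relation.Nullary.Decidable using (_×-dec_; _⊎-dec_; ¬?)
open import Relation.Unary using (Pred; Decidable)

private
  variable
    A B : Set
    n   : ℕ

record Finite (A : Set) : Set where
  field
    elements : List A
    unique   : Unique elements
    complete : ∀ x → x ∈ elements
    witness  : A

∈⇒nonZero : {x : A} {xs : List A} → x ∈ xs → ℕ.NonZero (length xs)
∈⇒nonZero (here _)  = _
∈⇒nonZero (there _) = _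

module _ (fin : Finite A) where
  open Finite fin

  count : {P : Pred A 0ℓ} → Decidable P → ℕ
  count P? = length (filter P? elements)

  count-nonZero : {P : Pred A 0ℓ} (P? : Decidable P) → ∃ P → ℕ.NonZero (count P?)
  count-nonZero P? (x , px) = ∈⇒nonZero (∈-filter⁺ P? (complete x) px)

  card : ℕ
  card = length elements

  card-nonZero : ℕ.NonZero card
  card-nonZero = ∈⇒nonZero (complete witness)

  Pr : {P : Pred A 0ℓ} → Decidable P → ℚ
  Pr P? = (+ count P? / card) {{card-nonZero}}

  -- The seed g witness is itself one of the values in the list.
  minimum : (A → ℚ) → ℚ
  minimum g = min (g witness) (List.map g elements)

×-finite : Finite A → Finite B → Finite (A × B)
×-finite finA finB = record
  { elements = cartesianProduct A.elements B.elements
  ; unique   = Unique.cartesianProduct⁺ A.unique B.unique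
  ; complete = λ (x , y) → ∈-cartesianProduct⁺ (A.complete x) (B.complete y)
  ; witness  = A.witness , B.witness
  }
  where
  module A = Finite finA
  module B = Finite finB

vectors : List A → (n : ℕ) → List (Vec A n)
vectors xs zero    = [] ∷ []
vectors xs (suc n) = cartesianProductWith _∷_ xs (vectors xs n)

Vec-finite : Finite A → (n : ℕ) → Finite (Vec A n)
Vec-finite {A} finA n = record
  { elements = vectors elements n
  ; unique   = vectors-unique n
  ; complete = vectors-complete
  ; witness  = replicate n witness
  }
  where
  open Finite finA

  vectors-unique : ∀ n → Unique (vectors elements n)
  vectors-unique zero    = [] ∷ []
  vectors-unique (suc n) =
    Unique.cartesianProductWith⁺ _∷_ ∷-injective unique (vectors-unique n)

  vectors-complete : ∀ {k} (xs : Vec A k) → xs ∈ vectors elements k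
  vectors-complete []       = here refl
  vectors-complete (x ∷ xs) = ∈-cartesianProductWith⁺ _∷_ (complete x) (vectors-complete xs)

module Hamming {I V : Set} (fin : Finite I) (_≟_ : DecidableEquality V) where

  differ? : (u v : I → V) → Decidable (λ i → u i ≢ v i)
  differ? u v i = ¬? (u i ≟ v i)

  dist : (u v : I → V) → ℚ
  dist u v = (+ count fin (differ? u v) / card fin) {{card-nonZero fin}}

  distOn : {A : Pred I 0ℓ} (A? : Decidable A) → ∃ A → (u v : I → V) → ℚ
  distOn A? A≢∅ u v =
    (+ count fin (λ i → A? i ×-dec differ? u v i) / (2 ℕ.* count fin A?))
      {{ℕₚ.m*n≢0 2 _ {{_}} {{count-nonZero fin A? A≢∅}}}}
    ℚ.+
    (+ count fin (differ? u v) / (2 ℕ.* card fin))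
      {{ℕₚ.m*n≢0 2 _ {{_}} {{card-nonZero fin}}}}

record FiniteField : Set₁ where
  infix  8 -_
  infixl 7 _*_
  infixl 6 _+_
  field
    Carrier           : Set
    _≟_               : DecidableEquality Carrier
    _+_ _*_           : Carrier → Carrier → Carrier
    -_                : Carrier → Carrier
    0# 1#             : Carrier
    isCommutativeRing : IsCommutativeRing _≡_ _+_ _*_ -_ 0# 1#
    1≢0               : 1# ≢ 0#
    inverse           : ∀ x → x ≢ 0# → ∃ λ y → x * y ≡ 1#
    finite            : Finite Carrier

  commutativeRing : CommutativeRing 0ℓ 0ℓ
  commutativeRing = record { isCommutativeRing = isCommutativeRing }

  open CommutativeRing commutativeRing public using (rawRing)
  open RawSemiringDefs (RawRing.rawSemiring rawRing) public using (_^_)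

  order : ℕ
  order = card finite

  points : (m : ℕ) → Finite (Vec Carrier m)
  points = Vec-finite finite

  sum : List Carrier → Carrier
  sum = List.foldr _+_ 0#

module _ (K : FiniteField) where
  open FiniteField K

  record IsSubfield (S : Pred Carrier 0ℓ) : Set where
    field
      0∈ : S 0#
      1∈ : S 1#
      +∈ : ∀ {x y} → S x → S y → S (x + y)
      -∈ : ∀ {x} → S x → S (- x)
      *∈ : ∀ {x y} → S x → S y → S (x * y)
      ⁻¹∈ : ∀ {x y} → S x → x * y ≡ 1# → S y

  -- No proper subfields; as K is finite, this says that K is some 𝔽_p.
  IsPrimeField : Set₁
  IsPrimeField = (S : Pred Carrier 0ℓ) → IsSubfield S → ∀ x → S x

record Extension (H F : FiniteField) : Set where
  private
    module H = FiniteField H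
    module F = FiniteField F
  field
    embed        : H.Carrier → F.Carrier
    homomorphism : IsRingHomomorphism H.rawRing F.rawRing embed

  combination : Vec H.Carrier n → Vec F.Carrier n → F.Carrier
  combination c b = F.sum (toList (zipWith (λ a x → embed a F.* x) c b))

  record IsBasis (b : Vec F.Carrier n) : Set where
    field
      independent : (c : Vec H.Carrier n) → combination c b ≡ F.0# → c ≡ replicate n H.0#
      spanning    : (x : F.Carrier) → ∃ λ (c : Vec H.Carrier n) → combination c b ≡ x

  HasDegree : ℕ → Set
  HasDegree n = ∃ λ (b : Vec F.Carrier n) → IsBasis b

-- Exponent vectors of the monomials in m variables of total degree at most d.
monomials : (m d : ℕ) → List (Vec ℕ m)
monomials m d = filter (λ e → Vec.sum e ℕₚ.≤? d) (vectors (upTo (suc d)) m)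

module ReedMuller (F : FiniteField) where
  open FiniteField F

  -- A polynomial of total degree at most d, as its vector of coefficients.
  Poly : (m d : ℕ) → Set
  Poly m d = Vec Carrier (length (monomials m d))

  evalMonomial : Vec ℕ n → Vec Carrier n → Carrier
  evalMonomial e x = Vec.foldr _ _*_ 1# (zipWith _^_ x e)

  eval : (m d : ℕ) → Poly m d → Vec Carrier m → Carrier
  eval m d p x =
    sum (List.zipWith (λ c e → c * evalMonomial e x) (toList p) (monomials m d))

  RM : (m d : ℕ) → Pred (Vec Carrier m → Carrier) 0ℓ
  RM m d f = ∃ λ (p : Poly m d) → ∀ x → f x ≡ eval m d p x

  polys : (m d : ℕ) → Finite (Poly m d)
  polys m d = points (length (monomials m d))

  dist : (m : ℕ) → (u v : Vec Carrier m → Carrier) → ℚ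
  dist m = Hamming.dist (points m) _≟_

  -- dist_A (u , RM m d), the minimum running over all polynomials and hence
  -- over all codewords.
  distOnRM : (m d : ℕ) {A : Pred (Vec Carrier m) 0ℓ} (A? : Decidable A) → ∃ A →
             (Vec Carrier m → Carrier) → ℚ
  distOnRM m d A? A≢∅ u =
    minimum (polys m d) (λ p → Hamming.distOn (points m) _≟_ A? A≢∅ u (eval m d p))

  origin : Vec Carrier 2
  origin = 0# ∷ 0# ∷ []

  L : Pred (Vec Carrier 2) 0ℓ
  L (t ∷ s ∷ []) = s ≡ 0#

  L? : Decidable L
  L? (t ∷ s ∷ []) = s ≟ 0#

  distOriginRM : (d : ℕ) → (Vec Carrier 2 → Carrier) → ℚ
  distOriginRM d = distOnRM 2 d {A = _≡ origin} (λ v → ≡-dec _≟_ v origin) (origin , refl)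

  distLineRM : (d : ℕ) → (Vec Carrier 2 → Carrier) → ℚ
  distLineRM d = distOnRM 2 d L? (origin , refl)

module Walk {H F : FiniteField} (E : Extension H F) (m : ℕ) where
  open FiniteField F
  open Extension E using (embed)
  open ReedMuller F
  private module H = FiniteField H

  infixl 6 _+ᵛ_
  infixl 7 _·ᵛ_

  _+ᵛ_ : (u v : Vec Carrier m) → Vec Carrier m
  _+ᵛ_ = zipWith _+_

  _·ᵛ_ : Carrier → Vec Carrier m → Vec Carrier m
  t ·ᵛ v = Vec.map (t *_) v

  -- The plane (a , h , h′), with its parametrisation (t , s) ↦ a + t h + s h′.
  Plane : Set
  Plane = Vec Carrier m × Vec Carrier m × Vec Carrier m

  point : Plane → Vec Carrier 2 → Vec Carrier m
  point (a , h , h′) (t ∷ s ∷ []) = a +ᵛ t ·ᵛ h +ᵛ s ·ᵛ h′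

  infix 5 _∣ₚ_
  _∣ₚ_ : (Vec Carrier m → Carrier) → Plane → Vec Carrier 2 → Carrier
  (f ∣ₚ P) v = f (point P v)

  -- The random choices (s , s′ , t , t′ , h′) of a single step.
  Round : Set
  Round = Carrier × Carrier × Carrier × Carrier × Vec H.Carrier m

  -- The choice of (h₀ , h₀′), followed by those of the m steps.
  Outcome : Set
  Outcome = (Vec H.Carrier m × Vec H.Carrier m) × Vec Round m

  outcomes : Finite Outcome
  outcomes = ×-finite (×-finite (H.points m) (H.points m)) (Vec-finite rounds m)
    where
    rounds : Finite Round
    rounds = ×-finite finite (×-finite finite (×-finite finite (×-finite finite (H.points m))))

  step : Plane → Round → Plane
  step (x , h , h′) (s , s′ , t , t′ , k) =
    (x +ᵛ s ·ᵛ h +ᵛ s′ ·ᵛ h′) , (t ·ᵛ h +ᵛ t′ ·ᵛ h′) , Vec.map embed k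

  planesFrom : Plane → Vec Round n → Vec Plane (suc n)
  planesFrom P []       = P ∷ []
  planesFrom P (r ∷ rs) = P ∷ planesFrom (step P r) rs

  plane : Vec Carrier m → Outcome → Fin (suc m) → Plane
  plane x ((h₀ , h₀′) , rs) =
    lookup (planesFrom (x , Vec.map embed h₀ , Vec.map embed h₀′) rs)

  module _ (d : ℕ) (ρ : ℚ) (f : Vec Carrier m → Carrier) (x : Vec Carrier m) where

    Rejects : Pred Outcome 0ℓ
    Rejects ω =
      ρ ℚ.≤ distOriginRM d (f ∣ₚ plane x ω zero)
      ⊎ ∃ λ (i : Fin m) → ρ ℚ.≤ distLineRM d (f ∣ₚ plane x ω (suc i))

    Rejects? : Decidable Rejects
    Rejects? ω =
      (ρ ℚₚ.≤? distOriginRM d (f ∣ₚ plane x ω zero))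
      ⊎-dec any? (λ i → ρ ℚₚ.≤? distLineRM d (f ∣ₚ plane x ω (suc i)))

infix 7 _/ᶠ_
_/ᶠ_ : ℕ → FiniteField → ℚ
k /ᶠ F = (+ k / FiniteField.order F) {{card-nonZero (FiniteField.finite F)}}

δ[_,_] : FiniteField → ℕ → ℚ
δ[ F , d ] = 1ℚ ℚ.- d /ᶠ F

open RawSemiringDefs ℚ.+-*-rawSemiring public using () renaming (_^_ to _^ℚ_)

twice : ℚ → ℚ
twice ρ = (+ 2 / 1) ℚ.* ρ

/<1 : ∀ k c .{{_ : ℕ.NonZero c}} → k ℕ.< c → + k / c ℚ.< 1ℚ
/<1 k (suc c) k<c = ℚₚ.toℚᵘ-cancel-<
  (ℚᵘₚ.<-respˡ-≃ (ℚᵘₚ.≃-sym (ℚₚ.toℚᵘ-fromℚᵘ (mkℚᵘ (+ k) c)))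
    (*<* (subst₂ ℤ._<_ (sym (ℤₚ.*-identityʳ (+ k))) (sym (ℤₚ.*-identityˡ (+ suc c))) (+<+ k<c))))

module _ (F : FiniteField) (d m : ℕ) (2≤d : 2 ℕ.≤ d) (2≤m : 2 ℕ.≤ m)
         (2md≤∣F∣ : 2 ℕ.* m ℕ.* d ℕ.≤ FiniteField.order F) where

  d<order : d ℕ.< FiniteField.order F
  d<order = ℕₚ.<-≤-trans (subst (d ℕ.<_) (ℕₚ.*-comm d (2 ℕ.* m)) d<d*2m) 2md≤∣F∣
    where
    d<d*2m : d ℕ.< d ℕ.* (2 ℕ.* m)
    d<d*2m = ℕₚ.m<m*n d (2 ℕ.* m) {{ℕ.>-nonZero (ℕₚ.<-≤-trans (s≤s z≤n) 2≤d)}}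
                      (ℕₚ.≤-trans 2≤m (ℕₚ.m≤m+n m _))

  δ>0 : 0ℚ ℚ.< δ[ F , d ]
  δ>0 = subst (ℚ._< δ[ F , d ]) (ℚₚ.+-inverseʳ (d /ᶠ F))
    (ℚₚ.+-monoˡ-< (ℚ.- (d /ᶠ F))
      (/<1 d _ {{card-nonZero (FiniteField.finite F)}} d<order))

  δ-2ρ-nonZero : (ρ : ℚ) → ρ ℚ.≤ δ[ F , d ] ℚ.* (+ 1 / 8) →
                 ℚ.NonZero (δ[ F , d ] ℚ.- twice ρ)
  δ-2ρ-nonZero ρ ρ≤δ/8 = ℚ.>-nonZero
    (subst (ℚ._< δ ℚ.- twice ρ) (ℚₚ.+-inverseʳ (twice ρ))
      (ℚₚ.+-monoˡ-< (ℚ.- twice ρ) 2ρ<δ))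
    where
    δ = δ[ F , d ]
    open ℚₚ.≤-Reasoning
    2ρ<δ : twice ρ ℚ.< δ
    2ρ<δ = begin-strict
      (+ 2 / 1) ℚ.* ρ                     ≤⟨ ℚₚ.*-monoˡ-≤-nonNeg (+ 2 / 1) ρ≤δ/8 ⟩
      (+ 2 / 1) ℚ.* (δ ℚ.* (+ 1 / 8))     ≡⟨ ℚₚ.*-comm (+ 2 / 1) (δ ℚ.* (+ 1 / 8)) ⟩
      δ ℚ.* (+ 1 / 8) ℚ.* (+ 2 / 1)       ≡⟨ ℚₚ.*-assoc δ (+ 1 / 8) (+ 2 / 1) ⟩
      δ ℚ.* (+ 1 / 4)                     <⟨ ℚₚ.*-monoʳ-<-pos δ {{ℚ.positive δ>0}} (/<1 1 4 (s≤s (s≤s z≤n))) ⟩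
      δ ℚ.* 1ℚ                            ≡⟨ ℚₚ.*-identityʳ δ ⟩
      δ                                   ∎

module Submission where

-- If no test rejects, f restricted to P₀ is close to a bivariate codeword that agrees with f at
-- x, hence differs from Q there, so by Schwartz–Zippel f and Q disagree on a fraction at least
-- δ − 2ρ ≥ 1/2 of P₀.  The points of the line ℓᵢ are pairwise independent uniform points of
-- Pᵢ₋₁, so by Chebyshev's inequality f and Q disagree on a quarter of ℓᵢ except with
-- probability 4/|F|; then the codeword close to f on Pᵢ is again not Q, and the fraction of
-- disagreement on Pᵢ is again at least δ − 2ρ.  On the other hand, a uniform point of Pₘ is
-- x + Σ cⱼ kⱼ with m + 2 independent uniform coefficients cⱼ ∈ F and directions kⱼ ∈ Hᵐ.  It is
-- exactly uniform in Fᵐ whenever a ↦ Σ cⱼ aⱼ maps H^(m+2) onto F, and averaging the size of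
-- the kernel of this map over c shows that it fails to be onto with probability at most
-- 1/|H|².  Hence the mean disagreement on Pₘ is at most τ + 1/|H|², and Markov's inequality
-- bounds the probability that it reaches δ − 2ρ.

open import Defs
open import Algebra.Bundles using (CommutativeRing)
open import Algebra.Morphism.Structures using (IsRingHomomorphism)
import Algebra.Properties.Ring as RingProperties
import Algebra.Solver.Ring.NaturalCoefficients.Default as SemiringSolver
open import Data.Fin.Base using (Fin; zero; suc)
open import Data.List.Base as List using (List; []; _∷_; _++_; length; filter; cartesianProductWith)
open import Data.List.Membership.Propositional using (_∈_; lose)
open import Data.List.Membership.Propositional.Properties using (∈-cartesianProductWith⁺; ∈-filter⁺; ∈-map⁺; ∈-upTo⁺)
open import Data.List.Membership.Propositional.Properties.WithK using (unique∧set⇒bag)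
open import Data.List.Properties using (map-++; map-∘; map-cong)
open import Data.List.Relation.Binary.BagAndSetEquality using (∼bag⇒↭)
open import Data.List.Relation.Binary.Permutation.Propositional.Properties using (map⁺)
open import Data.List.Relation.Unary.All as All using (All; []; _∷_)
import Data.List.Relation.Unary.All.Properties as All
open import Data.List.Relation.Unary.AllPairs using ([]; _∷_)
open import Data.List.Relation.Unary.Any as Any using (here; there)
open import Data.List.Relation.Unary.Unique.Propositional using (Unique)
import Data.List.Relation.Unary.Unique.Propositional.Properties as Unique
open import Data.Nat.Base as ℕ using (ℕ; zero; suc; z≤n; s≤s)
import Data.Nat.ListAction as ListAction
open import Data.Nat.ListAction.Properties using (sum-++; sum-↭)
import Data.Nat.Properties as ℕₚ
import Data.Nat.Tactic.RingSolver as ℕSolver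
open import Data.Product.Base using (_×_; _,_; ∃; proj₁; proj₂)
open import Data.Sum.Base using (_⊎_; inj₁; inj₂)
open import Data.Unit.Base using (⊤; tt)
open import Data.Vec.Base as Vec using (Vec; []; _∷_; head; lookup; replicate; tail; toList; updateAt; zipWith)
open import Data.Vec.Properties using (lookup-map; lookup-zipWith; ≡-dec)
open import Function.Base using (_∘_)
open import Function.Bundles using (mk⇔)
open import Level using (0ℓ)
open import Relation.Binary.Bundles using (DecTotalOrder)
open import Relation.Binary.Definitions using (DecidableEquality)
open import Relation.Binary.PropositionalEquality
open import Relation.Nullary.Decidable using (Dec; yes; no; _×-dec_; _→-dec_; ¬?; decidable-stable; toWitness)
open import Relation.Nullary.Negation using (¬_; contradiction)
open import Relation.Unary using (Decidable; Pred)

-- Finite sums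

-- The induction along the walk alternates two implications. A plane on which f and Q differ in at
-- least half of the points gives, for most rounds, a line on which they differ in a quarter; an
-- accepted test turns such a line into a heavy plane again. The second needs 4 · 2ρ ≤ 1: a codeword
-- within weighted distance ρ of f differs from f on less than 2ρ of the line, so it is not Q. The
-- first needs δ - 2ρ ≥ 1/2: from m ≥ 2 and 2md ≤ |F| follow d/|F| ≤ 1/4 and δ ≥ 3/4, hence δ - 2ρ ≥
-- 3δ/4 ≥ 9/16. Sampling and tests depend on each other through f. A good step is therefore an
-- implication, vacuous on planes with few disagreements: from every plane it fails with probability
-- at most 4/|F|, whatever happened before, and the factors multiply to (1 - 4/|F|)^m. A walk of
-- good steps is rejected or ends in a heavy plane, so the last plane can be averaged over all
-- outcomes without conditioning. The exponent in 1/|H|² comes from the m + 2 directions: m of them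
-- pay for |F| ≤ |H|^m, and two remain. Probabilities are kept as natural-number counts with cleared
-- denominators until the final comparison.

private
  variable
    I I′ I″ : Set
    Φ Φ′ : Set

𝟙 : Dec Φ → ℕ
𝟙 (yes _) = 1
𝟙 (no _)  = 0

𝟙-true : Φ → (p : Dec Φ) → 𝟙 p ≡ 1
𝟙-true x (yes _) = refl
𝟙-true x (no ¬x) = contradiction x ¬x

𝟙-false : ¬ Φ → (p : Dec Φ) → 𝟙 p ≡ 0
𝟙-false ¬x (yes x) = contradiction x ¬x
𝟙-false ¬x (no _)  = refl

𝟙-mono : (Φ → Φ′) → (p : Dec Φ) (r : Dec Φ′) → 𝟙 p ℕ.≤ 𝟙 r
𝟙-mono f (yes x) r = ℕₚ.≤-reflexive (sym (𝟙-true (f x) r))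
𝟙-mono f (no _)  r = z≤n

𝟙-cong : (Φ → Φ′) → (Φ′ → Φ) → (p : Dec Φ) (r : Dec Φ′) → 𝟙 p ≡ 𝟙 r
𝟙-cong f g p r = ℕₚ.≤-antisym (𝟙-mono f p r) (𝟙-mono g r p)

𝟙≤1 : (p : Dec Φ) → 𝟙 p ℕ.≤ 1
𝟙≤1 (yes _) = s≤s z≤n
𝟙≤1 (no _)  = z≤n

𝟙-×-dec : (p : Dec Φ) (r : Dec Φ′) → 𝟙 (p ×-dec r) ≡ 𝟙 p ℕ.* 𝟙 r
𝟙-×-dec (yes _) (yes _) = refl
𝟙-×-dec (yes _) (no _)  = refl
𝟙-×-dec (no _)  r       = refl

𝟙-¬? : (p : Dec Φ) → 𝟙 p ℕ.+ 𝟙 (¬? p) ≡ 1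
𝟙-¬? (yes _) = refl
𝟙-¬? (no _)  = refl

private
  ∑ₗ : List I → (I → ℕ) → ℕ
  ∑ₗ xs g = ListAction.sum (List.map g xs)

  ∑ₗ-cong : ∀ (xs : List I) {g h : I → ℕ} → (∀ x → g x ≡ h x) → ∑ₗ xs g ≡ ∑ₗ xs h
  ∑ₗ-cong xs eq = cong ListAction.sum (map-cong eq xs)

  ∑ₗ-mono : ∀ (xs : List I) {g h : I → ℕ} → (∀ x → g x ℕ.≤ h x) → ∑ₗ xs g ℕ.≤ ∑ₗ xs h
  ∑ₗ-mono []       le = z≤n
  ∑ₗ-mono (x ∷ xs) le = ℕₚ.+-mono-≤ (le x) (∑ₗ-mono xs le)

  ∑ₗ-+ : ∀ (xs : List I) (g h : I → ℕ) → ∑ₗ xs (λ x → g x ℕ.+ h x) ≡ ∑ₗ xs g ℕ.+ ∑ₗ xs h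
  ∑ₗ-+ []       g h = refl
  ∑ₗ-+ (x ∷ xs) g h = trans (cong (g x ℕ.+ h x ℕ.+_) (∑ₗ-+ xs g h))
                            (shuffle (g x) (h x) (∑ₗ xs g) (∑ₗ xs h))
    where
    shuffle : ∀ a b c d → a ℕ.+ b ℕ.+ (c ℕ.+ d) ≡ a ℕ.+ c ℕ.+ (b ℕ.+ d)
    shuffle = ℕSolver.solve-∀

  ∑ₗ-* : ∀ (xs : List I) c (g : I → ℕ) → ∑ₗ xs (λ x → c ℕ.* g x) ≡ c ℕ.* ∑ₗ xs g
  ∑ₗ-* []       c g = sym (ℕₚ.*-zeroʳ c)
  ∑ₗ-* (x ∷ xs) c g = trans (cong (c ℕ.* g x ℕ.+_) (∑ₗ-* xs c g)) (sym (ℕₚ.*-distribˡ-+ c (g x) _))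

  ∑ₗ-const : ∀ (xs : List I) c → ∑ₗ xs (λ _ → c) ≡ length xs ℕ.* c
  ∑ₗ-const []       c = refl
  ∑ₗ-const (x ∷ xs) c = cong (c ℕ.+_) (∑ₗ-const xs c)

  ∑ₗ-++ : ∀ (xs ys : List I) (g : I → ℕ) → ∑ₗ (xs ++ ys) g ≡ ∑ₗ xs g ℕ.+ ∑ₗ ys g
  ∑ₗ-++ xs ys g = trans (cong ListAction.sum (map-++ g xs ys)) (sum-++ (List.map g xs) _)

  ∑ₗ-map : ∀ (f : I → I′) (xs : List I) (g : I′ → ℕ) → ∑ₗ (List.map f xs) g ≡ ∑ₗ xs (λ x → g (f x))
  ∑ₗ-map f xs g = cong ListAction.sum (sym (map-∘ xs))

  ∑ₗ-swap : ∀ (xs : List I) (ys : List I′) (g : I → I′ → ℕ) →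
            ∑ₗ xs (λ x → ∑ₗ ys (g x)) ≡ ∑ₗ ys (λ y → ∑ₗ xs (λ x → g x y))
  ∑ₗ-swap []       ys g = sym (trans (∑ₗ-const ys 0) (ℕₚ.*-zeroʳ (length ys)))
  ∑ₗ-swap (x ∷ xs) ys g = trans (cong (∑ₗ ys (g x) ℕ.+_) (∑ₗ-swap xs ys g))
                                (sym (∑ₗ-+ ys (g x) (λ y → ∑ₗ xs (λ x → g x y))))

  ∑ₗ-cartesianProductWith : ∀ (f : I → I′ → I″) xs ys (g : I″ → ℕ) →
    ∑ₗ (cartesianProductWith f xs ys) g ≡ ∑ₗ xs (λ x → ∑ₗ ys (λ y → g (f x y)))
  ∑ₗ-cartesianProductWith f []       ys g = refl
  ∑ₗ-cartesianProductWith f (x ∷ xs) ys g =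
    trans (∑ₗ-++ (List.map (f x) ys) _ g)
          (cong₂ ℕ._+_ (∑ₗ-map (f x) ys g) (∑ₗ-cartesianProductWith f xs ys g))

  length-filter-∑ₗ : ∀ {Q : Pred I 0ℓ} (Q? : Decidable Q) xs →
                     length (filter Q? xs) ≡ ∑ₗ xs (λ x → 𝟙 (Q? x))
  length-filter-∑ₗ Q? []       = refl
  length-filter-∑ₗ Q? (x ∷ xs) with Q? x
  ... | yes _ = cong suc (length-filter-∑ₗ Q? xs)
  ... | no _  = length-filter-∑ₗ Q? xs

  ∑ₗ-vanishing : ∀ (xs : List I) (g : I → ℕ) → All (λ x → g x ≡ 0) xs → ∑ₗ xs g ≡ 0
  ∑ₗ-vanishing []       g []       = refl
  ∑ₗ-vanishing (x ∷ xs) g (e ∷ es) = cong₂ ℕ._+_ e (∑ₗ-vanishing xs g es)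

  ∑ₗ-supported : ∀ {a : I} {xs} → Unique xs → a ∈ xs → (g : I → ℕ) →
                 (∀ x → x ≢ a → g x ≡ 0) → ∑ₗ xs g ≡ g a
  ∑ₗ-supported {a = a} {xs = _ ∷ xs} (≢s ∷ _) (here refl) g van =
    trans (cong (g a ℕ.+_) (∑ₗ-vanishing xs g (All.map (λ a≢x → van _ (a≢x ∘ sym)) ≢s)))
          (ℕₚ.+-identityʳ (g a))
  ∑ₗ-supported {xs = y ∷ xs} (≢s ∷ u) (there a∈) g van =
    trans (cong (ℕ._+ ∑ₗ xs g) (van y (All.lookup ≢s a∈))) (∑ₗ-supported u a∈ g van)

  g≤∑ₗ : ∀ (g : I → ℕ) {a xs} → a ∈ xs → g a ℕ.≤ ∑ₗ xs g
  g≤∑ₗ g (here refl) = ℕₚ.m≤m+n _ _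
  g≤∑ₗ g (there a∈)  = ℕₚ.≤-trans (g≤∑ₗ g a∈) (ℕₚ.m≤n+m _ _)

opaque
  ∑ : Finite I → (I → ℕ) → ℕ
  ∑ fin = ∑ₗ (Finite.elements fin)

syntax ∑ fin (λ x → e) = ∑[ x ∈ fin ] e
infix 5 ∑

module _ (fin : Finite I) where
  open Finite fin

  opaque
    unfolding ∑

    ∑-cong : {g h : I → ℕ} → (∀ x → g x ≡ h x) → ∑ fin g ≡ ∑ fin h
    ∑-cong = ∑ₗ-cong elements

    ∑-mono : {g h : I → ℕ} → (∀ x → g x ℕ.≤ h x) → ∑ fin g ℕ.≤ ∑ fin h
    ∑-mono = ∑ₗ-mono elements

    ∑-+ : (g h : I → ℕ) → ∑ fin (λ x → g x ℕ.+ h x) ≡ ∑ fin g ℕ.+ ∑ fin h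
    ∑-+ = ∑ₗ-+ elements

    ∑-* : ∀ c (g : I → ℕ) → ∑ fin (λ x → c ℕ.* g x) ≡ c ℕ.* ∑ fin g
    ∑-* = ∑ₗ-* elements

    ∑-*ʳ : ∀ c (g : I → ℕ) → ∑ fin (λ x → g x ℕ.* c) ≡ ∑ fin g ℕ.* c
    ∑-*ʳ c g = trans (∑-cong (λ x → ℕₚ.*-comm (g x) c)) (trans (∑-* c g) (ℕₚ.*-comm c _))

    ∑-const : ∀ c → ∑ fin (λ _ → c) ≡ card fin ℕ.* c
    ∑-const = ∑ₗ-const elements

    count≡∑ : {Q : Pred I 0ℓ} (Q? : Decidable Q) → count fin Q? ≡ ∑[ x ∈ fin ] 𝟙 (Q? x)
    count≡∑ Q? = length-filter-∑ₗ Q? elements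

    count-mono : {Q S : Pred I 0ℓ} (Q? : Decidable Q) (S? : Decidable S) →
                 (∀ x → Q x → S x) → count fin Q? ℕ.≤ count fin S?
    count-mono Q? S? Q⊆S = subst₂ ℕ._≤_ (sym (count≡∑ Q?)) (sym (count≡∑ S?))
      (∑-mono (λ x → 𝟙-mono (Q⊆S x) (Q? x) (S? x)))

    g≤∑ : ∀ (g : I → ℕ) a → g a ℕ.≤ ∑ fin g
    g≤∑ g a = g≤∑ₗ g (complete a)

    ∑-supported : ∀ a (g : I → ℕ) → (∀ x → x ≢ a → g x ≡ 0) → ∑ fin g ≡ g a
    ∑-supported a = ∑ₗ-supported unique (complete a)

    ∑-𝟙≡ : (_≟_ : ∀ (x y : I) → Dec (x ≡ y)) → ∀ a (g : I → ℕ) →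
            ∑[ x ∈ fin ] 𝟙 (x ≟ a) ℕ.* g x ≡ g a
    ∑-𝟙≡ _≟_ a g =
      trans (∑-supported a _ (λ x x≢a → cong (ℕ._* g x) (𝟙-false x≢a (x ≟ a))))
            (trans (cong (ℕ._* g a) (𝟙-true refl (a ≟ a))) (ℕₚ.*-identityˡ (g a)))

    -- `map f elements` and `elements` are both free of duplicates and both contain everything, so
    -- each is a permutation of the other.
    ∑-reindex : (f f⁻¹ : I → I) → (∀ x → f (f⁻¹ x) ≡ x) → (∀ x → f⁻¹ (f x) ≡ x) →
                (g : I → ℕ) → ∑[ x ∈ fin ] g (f x) ≡ ∑ fin g
    ∑-reindex f f⁻¹ f∘f⁻¹ f⁻¹∘f g =
      trans (sym (∑ₗ-map f elements g))
            (sum-↭ (map⁺ g (∼bag⇒↭ (unique∧set⇒bag (Unique.map⁺ f-injective unique) unique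
              (mk⇔ (λ _ → complete _)
                   (λ _ → subst (_∈ _) (f∘f⁻¹ _) (∈-map⁺ f (complete (f⁻¹ _)))))))))
      where
      f-injective : ∀ {x y} → f x ≡ f y → x ≡ y
      f-injective {x} {y} eq = trans (sym (f⁻¹∘f x)) (trans (cong f⁻¹ eq) (f⁻¹∘f y))

    any-finite? : {Q : Pred I 0ℓ} → Decidable Q → Dec (∃ Q)
    any-finite? Q? with Any.any? Q? elements
    ... | yes q = yes (Any.satisfied q)
    ... | no ¬q = no λ (x , qx) → ¬q (lose (complete x) qx)

opaque
  unfolding ∑

  ∑-swap : (fin : Finite I) (fin′ : Finite I′) (g : I → I′ → ℕ) →
           ∑[ x ∈ fin ] ∑[ y ∈ fin′ ] g x y ≡ ∑[ y ∈ fin′ ] ∑[ x ∈ fin ] g x y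
  ∑-swap fin fin′ = ∑ₗ-swap (Finite.elements fin) (Finite.elements fin′)

  ∑-× : (fin : Finite I) (fin′ : Finite I′) (g : I × I′ → ℕ) →
        ∑ (×-finite fin fin′) g ≡ ∑[ x ∈ fin ] ∑[ y ∈ fin′ ] g (x , y)
  ∑-× fin fin′ = ∑ₗ-cartesianProductWith _,_ (Finite.elements fin) (Finite.elements fin′)

module _ (fin : Finite I) where

  opaque
    unfolding ∑

    ∑-[] : (g : Vec I 0 → ℕ) → ∑ (Vec-finite fin 0) g ≡ g []
    ∑-[] g = ℕₚ.+-identityʳ _

    ∑-∷ : ∀ n (g : Vec I (suc n) → ℕ) →
          ∑ (Vec-finite fin (suc n)) g ≡ ∑[ x ∈ fin ] ∑[ v ∈ Vec-finite fin n ] g (x ∷ v)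
    ∑-∷ n = ∑ₗ-cartesianProductWith _∷_ (Finite.elements fin) (vectors (Finite.elements fin) n)

card≡∑1 : (fin : Finite I) → card fin ≡ ∑[ _ ∈ fin ] 1
card≡∑1 fin = sym (trans (∑-const fin 1) (ℕₚ.*-identityʳ _))

card-× : (fin : Finite I) (fin′ : Finite I′) → card (×-finite fin fin′) ≡ card fin ℕ.* card fin′
card-× fin fin′ = begin
  card (×-finite fin fin′)                ≡⟨ card≡∑1 (×-finite fin fin′) ⟩
  (∑[ _ ∈ ×-finite fin fin′ ] 1)          ≡⟨ ∑-× fin fin′ (λ _ → 1) ⟩
  (∑[ _ ∈ fin ] ∑[ _ ∈ fin′ ] 1)          ≡⟨ ∑-const fin _ ⟩
  card fin ℕ.* (∑[ _ ∈ fin′ ] 1)            ≡⟨ cong (card fin ℕ.*_) (card≡∑1 fin′) ⟨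
  card fin ℕ.* card fin′                    ∎
  where open ≡-Reasoning

card-Vec : (fin : Finite I) → ∀ n → card (Vec-finite fin n) ≡ card fin ℕ.^ n
card-Vec fin zero    = refl
card-Vec fin (suc n) = begin
  card (Vec-finite fin (suc n))               ≡⟨ card≡∑1 (Vec-finite fin (suc n)) ⟩
  (∑[ _ ∈ Vec-finite fin (suc n) ] 1)         ≡⟨ ∑-∷ fin n (λ _ → 1) ⟩
  (∑[ _ ∈ fin ] ∑[ _ ∈ Vec-finite fin n ] 1)  ≡⟨ ∑-const fin _ ⟩
  card fin ℕ.* (∑[ _ ∈ Vec-finite fin n ] 1)    ≡⟨ cong (card fin ℕ.*_) (card≡∑1 (Vec-finite fin n)) ⟨
  card fin ℕ.* card (Vec-finite fin n)          ≡⟨ cong (card fin ℕ.*_) (card-Vec fin n) ⟩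
  card fin ℕ.* card fin ℕ.^ n                     ∎
  where open ≡-Reasoning

-- Every fibre of `f` has a point, and each `x` lies in exactly one fibre: count the pairs with
-- `f x ≡ y` in both orders.
card-surjection : (fin : Finite I) (fin′ : Finite I′) (_≟_ : ∀ (x y : I′) → Dec (x ≡ y)) (f : I → I′) →
                  (∀ y → ∃ λ x → f x ≡ y) → card fin′ ℕ.≤ card fin
card-surjection fin fin′ _≟_ f surj = begin
  card fin′                                       ≡⟨ card≡∑1 fin′ ⟩
  (∑[ _ ∈ fin′ ] 1)                               ≤⟨ ∑-mono fin′ fibre ⟩
  -- The factor 1 gives the summand the shape that `∑-𝟙≡` evaluates.
  (∑[ y ∈ fin′ ] ∑[ x ∈ fin ] 𝟙 (f x ≟ y) ℕ.* 1)    ≡⟨ ∑-swap fin′ fin _ ⟩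
  (∑[ x ∈ fin ] ∑[ y ∈ fin′ ] 𝟙 (f x ≟ y) ℕ.* 1)    ≡⟨ ∑-cong fin (λ x → trans
       (∑-cong fin′ (λ y → cong (ℕ._* 1) (𝟙-cong sym sym (f x ≟ y) (y ≟ f x))))
       (∑-𝟙≡ fin′ _≟_ (f x) (λ _ → 1))) ⟩
  (∑[ x ∈ fin ] 1)                                ≡⟨ card≡∑1 fin ⟨
  card fin                                        ∎
  where
  open ℕₚ.≤-Reasoning
  fibre : ∀ y → 1 ℕ.≤ ∑[ x ∈ fin ] 𝟙 (f x ≟ y) ℕ.* 1
  fibre y with surj y
  ... | x , fx≡y = begin
    1                                ≡⟨ cong (ℕ._* 1) (𝟙-true fx≡y (f x ≟ y)) ⟨
    𝟙 (f x ≟ y) ℕ.* 1                  ≤⟨ g≤∑ fin (λ x → 𝟙 (f x ≟ y) ℕ.* 1) x ⟩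
    (∑[ x ∈ fin ] 𝟙 (f x ≟ y) ℕ.* 1)   ∎

^-distribʳ-* : ∀ n a b → (a ℕ.* b) ℕ.^ n ≡ a ℕ.^ n ℕ.* b ℕ.^ n
^-distribʳ-* zero    a b = refl
^-distribʳ-* (suc n) a b = trans (cong (a ℕ.* b ℕ.*_) (^-distribʳ-* n a b)) (rearrange a b (a ℕ.^ n) (b ℕ.^ n))
  where
  rearrange : ∀ a b c d → a ℕ.* b ℕ.* (c ℕ.* d) ≡ a ℕ.* c ℕ.* (b ℕ.* d)
  rearrange = ℕSolver.solve-∀

-- Polynomial functions and Reed–Muller codes

module FieldProperties (F : FiniteField) where
  open FiniteField F

  module R = CommutativeRing commutativeRing

  open RingProperties R.ring public using (-1*x≈-x)
  open SemiringSolver R.commutativeSemiring public using (solve; _:=_; _:+_; _:*_)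

  zero-product : ∀ x y → x * y ≡ 0# → x ≡ 0# ⊎ y ≡ 0#
  zero-product x y xy≡0 with x ≟ 0#
  ... | yes x≡0 = inj₁ x≡0
  ... | no x≢0 with x⁻¹ , xx⁻¹≡1 ← inverse x x≢0 = inj₂ (begin
    y               ≡⟨ R.*-identityˡ y ⟨
    1# * y          ≡⟨ cong (_* y) xx⁻¹≡1 ⟨
    x * x⁻¹ * y     ≡⟨ rearrange x x⁻¹ y ⟩
    x⁻¹ * (x * y)   ≡⟨ cong (x⁻¹ *_) xy≡0 ⟩
    x⁻¹ * 0#        ≡⟨ R.zeroʳ x⁻¹ ⟩
    0#              ∎)
    where
    open ≡-Reasoning
    rearrange : ∀ x z y → x * z * y ≡ z * (x * y)
    rearrange = solve 3 (λ x z y → x :* z :* y := z :* (x :* y)) refl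

  x-y≡0⇒x≡y : ∀ x y → x + - y ≡ 0# → x ≡ y
  x-y≡0⇒x≡y x y eq = begin
    x                ≡⟨ R.+-identityʳ x ⟨
    x + 0#           ≡⟨ cong (x +_) (R.-‿inverseˡ y) ⟨
    x + (- y + y)    ≡⟨ R.+-assoc x (- y) y ⟨
    x + - y + y      ≡⟨ cong (_+ y) eq ⟩
    0# + y           ≡⟨ R.+-identityˡ y ⟩
    y                ∎
    where open ≡-Reasoning

  -- Writing x = c + (x - c) in a Horner step is the start of the division by x - c.
  +-[x-c]* : ∀ u x g c → u + x * g ≡ u + c * g + (x + - c) * g
  +-[x-c]* u x g c = begin
    u + x * g                        ≡⟨ R.+-identityʳ _ ⟨
    u + x * g + 0#                   ≡⟨ cong (u + x * g +_) (R.zeroˡ g) ⟨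
    u + x * g + 0# * g               ≡⟨ cong (λ z → u + x * g + z * g) (R.-‿inverseʳ c) ⟨
    u + x * g + (c + - c) * g        ≡⟨ solve 5 (λ u x g c c′ → u :+ x :* g :+ (c :+ c′) :* g :=
                                                   u :+ c :* g :+ (x :+ c′) :* g) refl u x g c (- c) ⟩
    u + c * g + (x + - c) * g        ∎
    where open ≡-Reasoning

module Polynomials (F : FiniteField) where
  open FiniteField F
  open FieldProperties F
  open ReedMuller F

  -- Polynomial functions in Horner form with respect to the first variable; unlike a vector
  -- of coefficients, this form can be divided by a linear factor x − c.
  data Polynomial : ∀ {n} → ℕ → (Vec Carrier n → Carrier) → Set where
    constant : ∀ {d} {f : Vec Carrier 0 → Carrier} → Polynomial d f
    extend   : ∀ {n} {f : Vec Carrier (suc n) → Carrier} {u} → Polynomial 0 u →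
               (∀ x v → f (x ∷ v) ≡ u v) → Polynomial 0 f
    -- `g` still depends on the first variable, so its powers are peeled off one at a time, each at
    -- the cost of one degree.
    horner   : ∀ {n d} {f : Vec Carrier (suc n) → Carrier} {u g} →
               Polynomial (suc d) u → Polynomial d g →
               (∀ x v → f (x ∷ v) ≡ u v + x * g (x ∷ v)) → Polynomial (suc d) f

  private
    variable
      n d : ℕ

  Polynomial-resp : {f g : Vec Carrier n → Carrier} → (∀ v → f v ≡ g v) →
                    Polynomial d f → Polynomial d g
  Polynomial-resp f≗g constant         = constant
  Polynomial-resp f≗g (extend u eq)    = extend u (λ x v → trans (sym (f≗g _)) (eq x v))
  Polynomial-resp f≗g (horner u g eq)  = horner u g (λ x v → trans (sym (f≗g _)) (eq x v))

  Polynomial-+ : {f g : Vec Carrier n → Carrier} → Polynomial d f → Polynomial d g →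
                 Polynomial d (λ v → f v + g v)
  Polynomial-+ constant constant = constant
  Polynomial-+ (extend u eq) (extend u′ eq′) =
    extend (Polynomial-+ u u′) (λ x v → cong₂ _+_ (eq x v) (eq′ x v))
  Polynomial-+ (horner u g eq) (horner u′ g′ eq′) =
    horner (Polynomial-+ u u′) (Polynomial-+ g g′)
      (λ x v → trans (cong₂ _+_ (eq x v) (eq′ x v)) (rearrange x _ _ _ _))
    where
    rearrange : ∀ x a b a′ b′ → a + x * b + (a′ + x * b′) ≡ a + a′ + x * (b + b′)
    rearrange = solve 5 (λ x a b a′ b′ → a :+ x :* b :+ (a′ :+ x :* b′) := a :+ a′ :+ x :* (b :+ b′)) refl

  Polynomial-scale : ∀ c {f : Vec Carrier n → Carrier} → Polynomial d f →
                     Polynomial d (λ v → c * f v)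
  Polynomial-scale c constant = constant
  Polynomial-scale c (extend u eq) =
    extend (Polynomial-scale c u) (λ x v → cong (c *_) (eq x v))
  Polynomial-scale c (horner u g eq) =
    horner (Polynomial-scale c u) (Polynomial-scale c g)
      (λ x v → trans (cong (c *_) (eq x v)) (rearrange c x _ _))
    where
    rearrange : ∀ c x a b → c * (a + x * b) ≡ c * a + x * (c * b)
    rearrange = solve 4 (λ c x a b → c :* (a :+ x :* b) := c :* a :+ x :* (c :* b)) refl

  Polynomial-0 : ∀ n d → Polynomial {n} d (λ _ → 0#)
  Polynomial-0 zero    d       = constant
  Polynomial-0 (suc n) zero    = extend (Polynomial-0 n zero) (λ x v → refl)
  Polynomial-0 (suc n) (suc d) =
    horner (Polynomial-0 n (suc d)) (Polynomial-0 (suc n) d)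
      (λ x v → sym (trans (R.+-identityˡ _) (R.zeroʳ x)))

  Polynomial-tail : {u : Vec Carrier n → Carrier} → Polynomial d u →
                    Polynomial {suc n} d (λ v → u (tail v))
  Polynomial-tail {d = zero}  u = extend u (λ x v → refl)
  Polynomial-tail {d = suc d} u =
    horner u (Polynomial-0 _ d) (λ x v → sym (trans (cong (_ +_) (R.zeroʳ x)) (R.+-identityʳ _)))

  Polynomial-head* : {g : Vec Carrier (suc n) → Carrier} → Polynomial d g →
                     Polynomial (suc d) (λ v → head v * g v)
  Polynomial-head* g = horner (Polynomial-0 _ _) g (λ x v → sym (R.+-identityˡ _))

  Polynomial-suc : {f : Vec Carrier n → Carrier} → Polynomial d f → Polynomial (suc d) f
  Polynomial-suc constant        = constant
  Polynomial-suc (extend u eq)   =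
    Polynomial-resp (λ { (x ∷ v) → sym (eq x v) }) (Polynomial-tail (Polynomial-suc u))
  Polynomial-suc (horner u g eq) = horner (Polynomial-suc u) (Polynomial-suc g) eq

  Polynomial-slice : {f : Vec Carrier (suc n) → Carrier} → Polynomial d f → ∀ c →
                     Polynomial d (λ v → f (c ∷ v))
  Polynomial-slice (extend u eq)   c = Polynomial-resp (λ v → sym (eq c v)) u
  Polynomial-slice (horner u g eq) c =
    Polynomial-resp (λ v → sym (eq c v))
      (Polynomial-+ u (Polynomial-scale c (Polynomial-suc (Polynomial-slice g c))))

  -- Synthetic division: if f = u + x g and, recursively, g = g(c) + (x - c) k, then f = f(c) + (x -
  -- c) (g + c k). In the base case g has degree 0, does not depend on x, and is itself the
  -- quotient.
  Polynomial-divide : {f : Vec Carrier (suc n) → Carrier} → Polynomial (suc d) f → ∀ c →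
    ∃ λ g → Polynomial d g × (∀ x v → f (x ∷ v) ≡ f (c ∷ v) + (x + - c) * g (x ∷ v))
  Polynomial-divide {f = f} (horner {u = u} {g} pu (extend {u = u′} pu′ eq′) eq) c =
    g , extend pu′ eq′ , λ x v → begin
      f (x ∷ v)                             ≡⟨ eq x v ⟩
      u v + x * g (x ∷ v)                   ≡⟨ +-[x-c]* (u v) x (g (x ∷ v)) c ⟩
      u v + c * g (x ∷ v) + (x + - c) * g (x ∷ v)
        ≡⟨ cong (λ y → u v + c * y + (x + - c) * g (x ∷ v)) (trans (eq′ x v) (sym (eq′ c v))) ⟩
      u v + c * g (c ∷ v) + (x + - c) * g (x ∷ v) ≡⟨ cong (_+ _) (eq c v) ⟨
      f (c ∷ v) + (x + - c) * g (x ∷ v)     ∎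
    where
    open ≡-Reasoning
  Polynomial-divide {f = f} (horner {u = u} {g} pu pg@(horner _ _ _) eq) c
    with k , pk , eq′ ← Polynomial-divide pg c =
    (λ v → g v + c * k v) , Polynomial-+ pg (Polynomial-scale c (Polynomial-suc pk)) , λ x v → begin
      f (x ∷ v)                             ≡⟨ eq x v ⟩
      u v + x * g (x ∷ v)                   ≡⟨ +-[x-c]* (u v) x (g (x ∷ v)) c ⟩
      u v + c * g (x ∷ v) + (x + - c) * g (x ∷ v)
        ≡⟨ cong (λ y → u v + c * y + (x + - c) * g (x ∷ v)) (eq′ x v) ⟩
      u v + c * (g (c ∷ v) + (x + - c) * k (x ∷ v)) + (x + - c) * g (x ∷ v)
        ≡⟨ rearrange (u v) (x + - c) (g (x ∷ v)) (g (c ∷ v)) (k (x ∷ v)) c ⟩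
      u v + c * g (c ∷ v) + (x + - c) * (g (x ∷ v) + c * k (x ∷ v)) ≡⟨ cong (_+ _) (eq c v) ⟨
      f (c ∷ v) + (x + - c) * (g (x ∷ v) + c * k (x ∷ v)) ∎
    where
    open ≡-Reasoning
    rearrange : ∀ u y g g′ k c → u + c * (g′ + y * k) + y * g ≡ u + c * g′ + y * (g + c * k)
    rearrange = solve 6 (λ u y g g′ k c → u :+ c :* (g′ :+ y :* k) :+ y :* g := u :+ c :* g′ :+ y :* (g :+ c :* k)) refl

  -- The Schwartz-Zippel bound

  zeros : (Vec Carrier n → Carrier) → ℕ
  zeros {n} f = ∑[ v ∈ points n ] 𝟙 (f v ≟ 0#)

  -- If f vanishes on a hyperplane x = c, divide by x − c; otherwise bound the zeros on each
  -- of these hyperplanes separately.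
  schwartz-zippel : {f : Vec Carrier n → Carrier} → Polynomial d f → ∀ w → f w ≢ 0# →
                    order ℕ.* zeros f ℕ.≤ d ℕ.* order ℕ.^ n
  schwartz-zippel {zero} {d} {f} _ [] f[]≢0 = begin
    order ℕ.* zeros f              ≡⟨ cong (order ℕ.*_) (trans (∑-[] finite _) (𝟙-false f[]≢0 (f [] ≟ 0#))) ⟩
    order ℕ.* 0                    ≡⟨ ℕₚ.*-zeroʳ order ⟩
    0                              ≤⟨ z≤n ⟩
    d ℕ.* order ℕ.^ 0              ∎
    where open ℕₚ.≤-Reasoning
  schwartz-zippel {suc n} {d} {f} pf (y ∷ w) fyw≢0
    with any-finite? finite (λ c → ¬? (any-finite? (points n) (λ v → ¬? (f (c ∷ v) ≟ 0#))))
  ... | no ¬vanishing = begin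
    order ℕ.* zeros f
      ≡⟨ cong (order ℕ.*_) (∑-∷ finite n _) ⟩
    order ℕ.* (∑[ c ∈ finite ] zeros (λ v → f (c ∷ v)))
      ≡⟨ ∑-* finite order _ ⟨
    (∑[ c ∈ finite ] order ℕ.* zeros (λ v → f (c ∷ v)))
      ≤⟨ ∑-mono finite bound ⟩
    (∑[ c ∈ finite ] d ℕ.* order ℕ.^ n)
      ≡⟨ ∑-const finite _ ⟩
    order ℕ.* (d ℕ.* order ℕ.^ n)
      ≡⟨ rearrange order d (order ℕ.^ n) ⟩
    d ℕ.* order ℕ.^ suc n ∎
    where
    open ℕₚ.≤-Reasoning
    rearrange : ∀ q d p → q ℕ.* (d ℕ.* p) ≡ d ℕ.* (q ℕ.* p)
    rearrange = ℕSolver.solve-∀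
    bound : ∀ c → order ℕ.* zeros (λ v → f (c ∷ v)) ℕ.≤ d ℕ.* order ℕ.^ n
    bound c with v , fcv≢0 ← decidable-stable (any-finite? (points n) (λ v → ¬? (f (c ∷ v) ≟ 0#))) (λ ∄v → ¬vanishing (c , ∄v)) =
      schwartz-zippel (Polynomial-slice pf c) v fcv≢0
  -- In degree 0 the first coordinate is irrelevant, so vanishing on the slice at `c` contradicts
  -- the nonzero value at `y ∷ w`.
  schwartz-zippel {suc n} {zero} {f} (extend u eq) (y ∷ w) fyw≢0 | yes (c , ∄v) =
    contradiction (w , λ fcw≡0 → fyw≢0 (trans (trans (eq y w) (sym (eq c w))) fcw≡0)) ∄v
  schwartz-zippel {suc n} {suc d} {f} pf (y ∷ w) fyw≢0 | yes (c , ∄v)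
    with g , pg , eq ← Polynomial-divide pf c = begin
    order ℕ.* zeros f
      ≡⟨ cong (order ℕ.*_) (∑-∷ finite n _) ⟩
    order ℕ.* (∑[ x ∈ finite ] ∑[ v ∈ points n ] 𝟙 (f (x ∷ v) ≟ 0#))
      ≤⟨ ℕₚ.*-monoʳ-≤ order (∑-mono finite (λ x → ∑-mono (points n) (split x))) ⟩
    order ℕ.* (∑[ x ∈ finite ] ∑[ v ∈ points n ] (𝟙 (x ≟ c) ℕ.* 1 ℕ.+ 𝟙 (g (x ∷ v) ≟ 0#)))
      ≡⟨ cong (order ℕ.*_) (trans (∑-cong finite (λ x → ∑-+ (points n) _ _)) (∑-+ finite _ _)) ⟩
    order ℕ.* ((∑[ x ∈ finite ] ∑[ v ∈ points n ] 𝟙 (x ≟ c) ℕ.* 1) ℕ.+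
               (∑[ x ∈ finite ] ∑[ v ∈ points n ] 𝟙 (g (x ∷ v) ≟ 0#)))
      ≡⟨ cong₂ (λ a b → order ℕ.* (a ℕ.+ b)) hyperplane (sym (∑-∷ finite n _)) ⟩
    order ℕ.* (order ℕ.^ n ℕ.+ zeros g)
      ≡⟨ ℕₚ.*-distribˡ-+ order _ _ ⟩
    order ℕ.^ suc n ℕ.+ order ℕ.* zeros g
      -- Multiplied by q, the points of the hyperplane cost `order ^ suc n`, exactly the room left
      -- by the drop in degree from `suc d` to `d`.
      ≤⟨ ℕₚ.+-monoʳ-≤ _ (schwartz-zippel pg (y ∷ w) gyw≢0) ⟩
    suc d ℕ.* order ℕ.^ suc n ∎
    where
    open ℕₚ.≤-Reasoning
    factor : ∀ x v → f (x ∷ v) ≡ (x + - c) * g (x ∷ v)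
    factor x v = trans (eq x v)
      (trans (cong (_+ _) (decidable-stable (f (c ∷ v) ≟ 0#) (λ fcv≢0 → ∄v (v , fcv≢0))))
             (R.+-identityˡ _))
    gyw≢0 : g (y ∷ w) ≢ 0#
    gyw≢0 gyw≡0 = fyw≢0 (trans (factor y w) (trans (cong (_ *_) gyw≡0) (R.zeroʳ _)))
    split : ∀ x v → 𝟙 (f (x ∷ v) ≟ 0#) ℕ.≤ 𝟙 (x ≟ c) ℕ.* 1 ℕ.+ 𝟙 (g (x ∷ v) ≟ 0#)
    split x v with f (x ∷ v) ≟ 0#
    ... | no _ = z≤n
    ... | yes fxv≡0 with zero-product _ _ (trans (sym (factor x v)) fxv≡0)
    ...   | inj₁ x-c≡0 = ℕₚ.≤-trans
      (ℕₚ.≤-reflexive (sym (cong (ℕ._* 1) (𝟙-true (x-y≡0⇒x≡y x c x-c≡0) (x ≟ c))))) (ℕₚ.m≤m+n _ _)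
    ...   | inj₂ g≡0 = ℕₚ.≤-trans (ℕₚ.≤-reflexive (sym (𝟙-true g≡0 (g (x ∷ v) ≟ 0#)))) (ℕₚ.m≤n+m _ _)
    hyperplane : (∑[ x ∈ finite ] ∑[ v ∈ points n ] 𝟙 (x ≟ c) ℕ.* 1) ≡ order ℕ.^ n
    hyperplane = begin-equality
      (∑[ x ∈ finite ] ∑[ v ∈ points n ] 𝟙 (x ≟ c) ℕ.* 1)
        ≡⟨ ∑-swap finite (points n) _ ⟩
      (∑[ v ∈ points n ] ∑[ x ∈ finite ] 𝟙 (x ≟ c) ℕ.* 1)
        ≡⟨ ∑-cong (points n) (λ v → ∑-𝟙≡ finite _≟_ c (λ _ → 1)) ⟩
      (∑[ v ∈ points n ] 1)
        ≡⟨ card≡∑1 (points n) ⟨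
      card (points n)
        ≡⟨ card-Vec finite n ⟩
      order ℕ.^ n ∎

  -- `eval` with an arbitrary list of exponents, to allow induction, and with arbitrary functions
  -- `φ` in place of the monomials, so that each monomial can be traded for its product with a
  -- coordinate.
  combination : (es : List (Vec ℕ n)) → Vec Carrier (length es) →
                (Vec ℕ n → Vec Carrier n → Carrier) → Vec Carrier n → Carrier
  combination es p φ x = sum (List.zipWith (λ c e → c * φ e x) (toList p) es)

  Polynomial-monomial : ∀ (e : Vec ℕ n) → Vec.sum e ℕ.≤ d → Polynomial d (evalMonomial e)
  Polynomial-monomial []          _  = constant
  Polynomial-monomial (zero  ∷ e) le =
    Polynomial-resp (λ { (x ∷ v) → sym (R.*-identityˡ _) }) (Polynomial-tail (Polynomial-monomial e le))
  Polynomial-monomial (suc k ∷ e) (s≤s le) =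
    Polynomial-resp (λ { (x ∷ v) → sym (R.*-assoc _ _ _) }) (Polynomial-head* (Polynomial-monomial (k ∷ e) le))

  RM⇒Polynomial : {f : Vec Carrier n → Carrier} → RM n d f → Polynomial d f
  RM⇒Polynomial {n} {d} (p , eq) =
    Polynomial-resp (λ x → sym (eq x)) (go (monomials n d) p (All.all-filter _ (vectors (List.upTo (suc d)) n)))
    where
    go : ∀ es (p : Vec Carrier (length es)) → All (λ e → Vec.sum e ℕ.≤ d) es →
         Polynomial d (combination es p evalMonomial)
    go []       []      []         = Polynomial-0 _ _
    go (e ∷ es) (c ∷ p) (le ∷ les) =
      Polynomial-+ (Polynomial-scale c (Polynomial-monomial e le)) (go es p les)

  RM-resp : {f g : Vec Carrier n → Carrier} → (∀ v → f v ≡ g v) → RM n d f → RM n d g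
  RM-resp f≗g (p , eq) = p , λ x → trans (sym (f≗g x)) (eq x)

  combination-0 : ∀ es φ (x : Vec Carrier n) → combination es (replicate _ 0#) φ x ≡ 0#
  combination-0 []       φ x = refl
  combination-0 (e ∷ es) φ x = trans (cong₂ _+_ (R.zeroˡ _) (combination-0 es φ x)) (R.+-identityˡ 0#)

  combination-+ : ∀ es p p′ φ (x : Vec Carrier n) →
    combination es p φ x + combination es p′ φ x ≡ combination es (zipWith _+_ p p′) φ x
  combination-+ []       []      []        φ x = R.+-identityˡ 0#
  combination-+ (e ∷ es) (c ∷ p) (c′ ∷ p′) φ x =
    trans (rearrange c c′ (φ e x) _ _) (cong (_ +_) (combination-+ es p p′ φ x))
    where
    rearrange : ∀ c c′ y s s′ → c * y + s + (c′ * y + s′) ≡ (c + c′) * y + (s + s′)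
    rearrange = solve 5 (λ c c′ y s s′ → c :* y :+ s :+ (c′ :* y :+ s′) := (c :+ c′) :* y :+ (s :+ s′)) refl

  combination-* : ∀ es a p φ (x : Vec Carrier n) →
    a * combination es p φ x ≡ combination es (Vec.map (a *_) p) φ x
  combination-* []       a []      φ x = R.zeroʳ a
  combination-* (e ∷ es) a (c ∷ p) φ x =
    trans (rearrange a c (φ e x) _) (cong (_ +_) (combination-* es a p φ x))
    where
    rearrange : ∀ a c y s → a * (c * y + s) ≡ a * c * y + a * s
    rearrange = solve 4 (λ a c y s → a :* (c :* y :+ s) := a :* c :* y :+ a :* s) refl

  combination-single : ∀ {e : Vec ℕ n} {es} → e ∈ es → ∀ φ →
    ∃ λ p → ∀ x → φ e x ≡ combination es p φ x
  combination-single {es = _ ∷ es} (here refl) φ = 1# ∷ replicate _ 0# , λ x →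
    sym (trans (cong₂ _+_ (R.*-identityˡ _) (combination-0 es φ x)) (R.+-identityʳ _))
  combination-single {es = _ ∷ es} (there e∈es) φ with p , eq ← combination-single e∈es φ = 0# ∷ p , λ x →
    trans (eq x) (sym (trans (cong (_+ combination es p φ x) (R.zeroˡ _)) (R.+-identityˡ _)))

  RM-0 : RM n d (λ _ → 0#)
  RM-0 {n} {d} = replicate _ 0# , λ x → sym (combination-0 (monomials n d) evalMonomial x)

  RM-+ : {f g : Vec Carrier n → Carrier} → RM n d f → RM n d g → RM n d (λ v → f v + g v)
  RM-+ {n} {d} (p , eq) (p′ , eq′) = zipWith _+_ p p′ , λ x →
    trans (cong₂ _+_ (eq x) (eq′ x)) (combination-+ (monomials n d) p p′ evalMonomial x)

  RM-scale : ∀ a {f : Vec Carrier n → Carrier} → RM n d f → RM n d (λ v → a * f v)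
  RM-scale {n} {d} a (p , eq) = Vec.map (a *_) p , λ x →
    trans (cong (a *_) (eq x)) (combination-* (monomials n d) a p evalMonomial x)

  RM-monomial : ∀ (e : Vec ℕ n) → Vec.sum e ℕ.≤ d → RM n d (evalMonomial e)
  RM-monomial {d = d} e le = combination-single (∈-filter⁺ _ (e∈vectors e le) le) evalMonomial
    where
    e∈vectors : ∀ {n} (e : Vec ℕ n) → Vec.sum e ℕ.≤ d → e ∈ vectors (List.upTo (suc d)) n
    e∈vectors []      le = here refl
    e∈vectors (k ∷ e) le = ∈-cartesianProductWith⁺ _∷_
      (∈-upTo⁺ (s≤s (ℕₚ.≤-trans (ℕₚ.m≤m+n k _) le))) (e∈vectors e (ℕₚ.≤-trans (ℕₚ.m≤n+m _ k) le))

  RM-combination : ∀ es p φ → All (λ e → RM n d (φ e)) es → RM n d (combination es p φ)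
  RM-combination []       []      φ []         = RM-0
  RM-combination (e ∷ es) (c ∷ p) φ (rm ∷ rms) = RM-+ (RM-scale c rm) (RM-combination es p φ rms)

  RM-suc : {f : Vec Carrier n → Carrier} → RM n d f → RM n (suc d) f
  RM-suc {n} {d} (p , eq) = RM-resp (λ x → sym (eq x)) (RM-combination (monomials n d) p evalMonomial
    (All.map (λ {e} le → RM-monomial e (ℕₚ.m≤n⇒m≤1+n le)) (All.all-filter _ (vectors (List.upTo (suc d)) n))))

  RM-const : ∀ c → RM n d (λ _ → c)
  RM-const {n} c = RM-resp (λ x → trans (cong (c *_) (trivial x)) (R.*-identityʳ c))
    (RM-scale c (RM-monomial (replicate n 0) (ℕₚ.≤-trans (ℕₚ.≤-reflexive (sum-0 n)) z≤n)))
    where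
    sum-0 : ∀ n → Vec.sum (replicate n 0) ≡ 0
    sum-0 zero    = refl
    sum-0 (suc n) = sum-0 n
    trivial : ∀ {n} (x : Vec Carrier n) → evalMonomial (replicate n 0) x ≡ 1#
    trivial []      = refl
    trivial (x ∷ v) = trans (R.*-identityˡ _) (trivial v)

  -- The product of a coordinate and a monomial is the monomial with exponent `i` raised by one, so
  -- each term of the combination gains one degree.
  RM-lookup* : ∀ i {f : Vec Carrier n → Carrier} → RM n d f → RM n (suc d) (λ x → lookup x i * f x)
  RM-lookup* {n} {d} i (p , eq) =
    RM-resp (λ x → trans (sym (distribute (monomials n d) p x)) (cong (lookup x i *_) (sym (eq x))))
      (RM-combination (monomials n d) p (λ e x → lookup x i * evalMonomial e x)
        (All.map (λ {e} le → RM-resp (increment e i)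
            (RM-monomial (updateAt e i suc) (ℕₚ.≤-trans (ℕₚ.≤-reflexive (sum-increment e i)) (s≤s le))))
          (All.all-filter _ (vectors (List.upTo (suc d)) n))))
    where
    distribute : ∀ es p x → lookup x i * combination es p evalMonomial x ≡
                            combination es p (λ e x → lookup x i * evalMonomial e x) x
    distribute []       []      x = R.zeroʳ _
    distribute (e ∷ es) (c ∷ p) x = trans (rearrange _ c _ _) (cong (_ +_) (distribute es p x))
      where
      rearrange : ∀ a c y s → a * (c * y + s) ≡ c * (a * y) + a * s
      rearrange = solve 4 (λ a c y s → a :* (c :* y :+ s) := c :* (a :* y) :+ a :* s) refl
    increment : ∀ {n} (e : Vec ℕ n) i x → evalMonomial (updateAt e i suc) x ≡ lookup x i * evalMonomial e x
    increment (k ∷ e) zero    (x ∷ v) = R.*-assoc _ _ _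
    increment (k ∷ e) (suc i) (x ∷ v) = trans (cong (_ *_) (increment e i v)) (rearrange _ _ _)
      where
      rearrange : ∀ a b c → a * (b * c) ≡ b * (a * c)
      rearrange = solve 3 (λ a b c → a :* (b :* c) := b :* (a :* c)) refl
    sum-increment : ∀ {n} (e : Vec ℕ n) i → Vec.sum (updateAt e i suc) ≡ suc (Vec.sum e)
    sum-increment (k ∷ e) zero    = refl
    sum-increment (k ∷ e) (suc i) = trans (cong (k ℕ.+_) (sum-increment e i)) (ℕₚ.+-suc k _)

  lookup-suc : (v : Vec Carrier (suc n)) → ∀ i → lookup v (suc i) ≡ lookup (tail v) i
  lookup-suc (x ∷ v) i = refl

  -- Multiplication by an affine form raises the degree by at most one; that is all that
  -- matters about the affine map x ↦ A x here.
  RM-∘ : ∀ {k} {f : Vec Carrier n → Carrier} (A : Vec Carrier k → Vec Carrier n) →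
         (∀ i {d g} → RM k d g → RM k (suc d) (λ x → lookup (A x) i * g x)) →
         Polynomial d f → RM k d (λ x → f (A x))
  RM-∘ {f = f} A affine constant = RM-resp (λ x → cong f (sym (empty (A x)))) (RM-const (f []))
    where
    empty : (v : Vec Carrier 0) → v ≡ []
    empty [] = refl
  RM-∘ {f = f} A affine (extend {u = u} pu eq) =
    RM-resp (λ x → sym (split (A x))) (RM-∘ (tail ∘ A) (λ i → RM-resp (λ x → cong (_* _) (lookup-suc (A x) i)) ∘ affine (suc i)) pu)
    where
    split : ∀ v → f v ≡ u (tail v)
    split (x ∷ v) = eq x v
  -- f ∘ A is u ∘ (tail ∘ A) plus the first coordinate of A times g ∘ A; `affine zero` accounts for
  -- the degree of this product.
  RM-∘ {f = f} A affine (horner {u = u} {g} pu pg eq) =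
    RM-resp (λ x → sym (split (A x)))
      (RM-+ (RM-∘ (tail ∘ A) (λ i → RM-resp (λ x → cong (_* _) (lookup-suc (A x) i)) ∘ affine (suc i)) pu)
            (affine zero (RM-∘ A affine pg)))
    where
    split : ∀ v → f v ≡ u (tail v) + lookup v zero * g v
    split (x ∷ v) = eq x v

  -- The agreements are the zeros of u - v, a polynomial that does not vanish at `w`. The difference
  -- is written u + (- 1) v because sums and scalings preserve `Polynomial`.
  agreements : {u v : Vec Carrier n → Carrier} → RM n d u → RM n d v → ∀ w → u w ≢ v w →
    order ℕ.* (∑[ x ∈ points n ] 𝟙 (u x ≟ v x)) ℕ.≤ d ℕ.* order ℕ.^ n
  agreements {n} {u = u} {v} rmu rmv w uw≢vw = ℕₚ.≤-trans
    (ℕₚ.*-monoʳ-≤ order (∑-mono (points n) (λ x → 𝟙-mono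
      (λ ux≡vx → trans (cong (λ y → y + - 1# * v x) ux≡vx) (cancel (v x))) (u x ≟ v x) (_ ≟ 0#))))
    (schwartz-zippel (Polynomial-+ (RM⇒Polynomial rmu) (Polynomial-scale (- 1#) (RM⇒Polynomial rmv))) w
      (λ eq → uw≢vw (x-y≡0⇒x≡y _ _ (trans (cong (u w +_) (negate (v w))) eq))))
    where
    cancel : ∀ y → y + - 1# * y ≡ 0#
    cancel y = trans (cong (y +_) (-1*x≈-x y)) (R.-‿inverseʳ y)
    negate : ∀ y → - y ≡ - 1# * y
    negate y = sym (-1*x≈-x y)

-- Restriction of codewords to planes

module PlaneRestriction {H F : FiniteField} (E : Extension H F) (m : ℕ) where
  open FiniteField F
  open FieldProperties F
  open ReedMuller F
  open Polynomials F
  open Walk E m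

  -- Each coordinate of `point P` is an affine form in the two parameters: its constant term needs
  -- `RM-suc`, its linear terms `RM-lookup*`.
  RM-restrict : ∀ {d f} → RM m d f → (P : Plane) → RM 2 d (f ∣ₚ P)
  RM-restrict rm P@(a , h , h′) = RM-∘ (point P) affine (RM⇒Polynomial rm)
    where
    affine : ∀ i {d g} → RM 2 d g → RM 2 (suc d) (λ w → lookup (point P w) i * g w)
    affine i {d} {g} rmg = RM-resp {d = suc d} expand
      (RM-+ {d = suc d} (RM-scale {d = suc d} (lookup a i) (RM-suc {d = d} rmg))
        (RM-+ {d = suc d} (RM-scale {d = suc d} (lookup h i) (RM-lookup* {d = d} zero rmg))
              (RM-scale {d = suc d} (lookup h′ i) (RM-lookup* {d = d} (suc zero) rmg))))
      where
      expand : ∀ w → lookup a i * g w + (lookup h i * (lookup w zero * g w) +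
                     lookup h′ i * (lookup w (suc zero) * g w)) ≡ lookup (point P w) i * g w
      expand w@(t ∷ s ∷ []) = trans (rearrange (lookup a i) (lookup h i) (lookup h′ i) t s (g w))
        (cong (_* g w) (sym coordinate))
        where
        rearrange : ∀ a h h′ t s y → a * y + (h * (t * y) + h′ * (s * y)) ≡ (a + t * h + s * h′) * y
        rearrange = solve 6 (λ a h h′ t s y → a :* y :+ (h :* (t :* y) :+ h′ :* (s :* y)) := (a :+ t :* h :+ s :* h′) :* y) refl
        coordinate : lookup (a +ᵛ t ·ᵛ h +ᵛ s ·ᵛ h′) i ≡ lookup a i + t * lookup h i + s * lookup h′ i
        coordinate = trans (lookup-zipWith _+_ i (a +ᵛ t ·ᵛ h) (s ·ᵛ h′))
          (cong₂ _+_ (trans (lookup-zipWith _+_ i a (t ·ᵛ h)) (cong (lookup a i +_) (lookup-map i (t *_) h)))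
                     (lookup-map i (s *_) h′))

-- Random lines in a plane

-- The surplus is (a - b)²; writing the larger number as the smaller plus k makes it k².
2ab≤a²+b² : ∀ a b → 2 ℕ.* (a ℕ.* b) ℕ.≤ a ℕ.* a ℕ.+ b ℕ.* b
2ab≤a²+b² a b with ℕₚ.≤-total a b
... | inj₁ a≤b with k , refl ← ℕₚ.m≤n⇒∃[o]m+o≡n a≤b =
  ℕₚ.≤-trans (ℕₚ.m≤m+n _ (k ℕ.* k)) (ℕₚ.≤-reflexive (identity a k))
  where
  identity : ∀ a k → 2 ℕ.* (a ℕ.* (a ℕ.+ k)) ℕ.+ k ℕ.* k ≡ a ℕ.* a ℕ.+ (a ℕ.+ k) ℕ.* (a ℕ.+ k)
  identity = ℕSolver.solve-∀
... | inj₂ b≤a with k , refl ← ℕₚ.m≤n⇒∃[o]m+o≡n b≤a =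
  ℕₚ.≤-trans (ℕₚ.m≤m+n _ (k ℕ.* k)) (ℕₚ.≤-reflexive (identity b k))
  where
  identity : ∀ b k → 2 ℕ.* ((b ℕ.+ k) ℕ.* b) ℕ.+ k ℕ.* k ≡ (b ℕ.+ k) ℕ.* (b ℕ.+ k) ℕ.+ b ℕ.* b
  identity = ℕSolver.solve-∀

-- This is c² ≤ (b - a)² freed of subtraction, the gain that Chebyshev's inequality draws from a
-- deviation of at least c.
squared-gap : ∀ a b c → a ℕ.+ c ℕ.≤ b → c ℕ.* c ℕ.+ 2 ℕ.* (a ℕ.* b) ℕ.≤ a ℕ.* a ℕ.+ b ℕ.* b
squared-gap a b c a+c≤b with k , refl ← ℕₚ.m≤n⇒∃[o]m+o≡n a+c≤b =
  ℕₚ.≤-trans (ℕₚ.m≤m+n _ (2 ℕ.* (c ℕ.* k) ℕ.+ k ℕ.* k)) (ℕₚ.≤-reflexive (identity a c k))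
  where
  identity : ∀ a c k → c ℕ.* c ℕ.+ 2 ℕ.* (a ℕ.* (a ℕ.+ c ℕ.+ k)) ℕ.+ (2 ℕ.* (c ℕ.* k) ℕ.+ k ℕ.* k) ≡
                       a ℕ.* a ℕ.+ (a ℕ.+ c ℕ.+ k) ℕ.* (a ℕ.+ c ℕ.+ k)
  identity = ℕSolver.solve-∀

-- The hypotheses combine to N q ≤ 16 W (q² − W) after cancelling 32 q⁴ W² and then q³, and
-- 16 W (q² − W) ≤ 4 q⁴ because 0 ≤ (q² − 2 W)².
chebyshev-arithmetic : ∀ q N W S .{{_ : ℕ.NonZero q}} →
  q ℕ.* q ℕ.* (q ℕ.* q) ℕ.* N ℕ.+ 2 ℕ.* (16 ℕ.* (q ℕ.* W)) ℕ.* (q ℕ.* (q ℕ.* (q ℕ.* W))) ℕ.≤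
    16 ℕ.* (q ℕ.* q) ℕ.* S ℕ.+ q ℕ.* (q ℕ.* (q ℕ.* q)) ℕ.* (16 ℕ.* (W ℕ.* W)) →
  S ℕ.+ q ℕ.* (W ℕ.* W) ≡ q ℕ.* (q ℕ.* (W ℕ.* W)) ℕ.+ q ℕ.* (q ℕ.* (q ℕ.* W)) →
  N ℕ.* q ℕ.≤ 4 ℕ.* (q ℕ.* q ℕ.* (q ℕ.* q))
chebyshev-arithmetic q N W S summed second-moment =
  ℕₚ.+-cancelʳ-≤ (16 ℕ.* (W ℕ.* W)) _ _ (ℕₚ.≤-trans variance am)
  where
  open ℕₚ.≤-Reasoning
  q³-nonZero : ℕ.NonZero (q ℕ.* q ℕ.* q)
  q³-nonZero = ℕₚ.m*n≢0 (q ℕ.* q) q {{ℕₚ.m*n≢0 q q}}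
  am : 16 ℕ.* (q ℕ.* q ℕ.* W) ℕ.≤ 4 ℕ.* (q ℕ.* q ℕ.* (q ℕ.* q)) ℕ.+ 16 ℕ.* (W ℕ.* W)
  am = subst₂ ℕ._≤_ (lhs (q ℕ.* q) W) (rhs (q ℕ.* q) W) (ℕₚ.*-monoʳ-≤ 4 (2ab≤a²+b² (q ℕ.* q) (2 ℕ.* W)))
    where
    lhs : ∀ p W → 4 ℕ.* (2 ℕ.* (p ℕ.* (2 ℕ.* W))) ≡ 16 ℕ.* (p ℕ.* W)
    lhs = ℕSolver.solve-∀
    rhs : ∀ p W → 4 ℕ.* (p ℕ.* p ℕ.+ 2 ℕ.* W ℕ.* (2 ℕ.* W)) ≡ 4 ℕ.* (p ℕ.* p) ℕ.+ 16 ℕ.* (W ℕ.* W)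
    rhs = ℕSolver.solve-∀
  variance : N ℕ.* q ℕ.+ 16 ℕ.* (W ℕ.* W) ℕ.≤ 16 ℕ.* (q ℕ.* q ℕ.* W)
  variance = ℕₚ.*-cancelˡ-≤ (q ℕ.* q ℕ.* q) {{q³-nonZero}}
    (ℕₚ.+-cancelˡ-≤ (2 ℕ.* (16 ℕ.* (q ℕ.* q ℕ.* (q ℕ.* q) ℕ.* (W ℕ.* W)))) _ _ (begin
      2 ℕ.* (16 ℕ.* (q ℕ.* q ℕ.* (q ℕ.* q) ℕ.* (W ℕ.* W))) ℕ.+ q ℕ.* q ℕ.* q ℕ.* (N ℕ.* q ℕ.+ 16 ℕ.* (W ℕ.* W))
        ≡⟨ step₁ 16 q N W ⟩
      q ℕ.* q ℕ.* (q ℕ.* q) ℕ.* N ℕ.+ 2 ℕ.* (16 ℕ.* (q ℕ.* W)) ℕ.* (q ℕ.* (q ℕ.* (q ℕ.* W))) ℕ.+ 16 ℕ.* (q ℕ.* q) ℕ.* (q ℕ.* (W ℕ.* W))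
        ≤⟨ ℕₚ.+-monoˡ-≤ (16 ℕ.* (q ℕ.* q) ℕ.* (q ℕ.* (W ℕ.* W))) summed ⟩
      16 ℕ.* (q ℕ.* q) ℕ.* S ℕ.+ q ℕ.* (q ℕ.* (q ℕ.* q)) ℕ.* (16 ℕ.* (W ℕ.* W)) ℕ.+ 16 ℕ.* (q ℕ.* q) ℕ.* (q ℕ.* (W ℕ.* W))
        ≡⟨ step₂ 16 q S W ⟩
      16 ℕ.* (q ℕ.* q) ℕ.* (S ℕ.+ q ℕ.* (W ℕ.* W)) ℕ.+ q ℕ.* (q ℕ.* (q ℕ.* q)) ℕ.* (16 ℕ.* (W ℕ.* W))
        ≡⟨ cong (λ z → 16 ℕ.* (q ℕ.* q) ℕ.* z ℕ.+ q ℕ.* (q ℕ.* (q ℕ.* q)) ℕ.* (16 ℕ.* (W ℕ.* W))) second-moment ⟩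
      16 ℕ.* (q ℕ.* q) ℕ.* (q ℕ.* (q ℕ.* (W ℕ.* W)) ℕ.+ q ℕ.* (q ℕ.* (q ℕ.* W))) ℕ.+ q ℕ.* (q ℕ.* (q ℕ.* q)) ℕ.* (16 ℕ.* (W ℕ.* W))
        ≡⟨ step₃ 16 q W ⟩
      2 ℕ.* (16 ℕ.* (q ℕ.* q ℕ.* (q ℕ.* q) ℕ.* (W ℕ.* W))) ℕ.+ q ℕ.* q ℕ.* q ℕ.* (16 ℕ.* (q ℕ.* q ℕ.* W)) ∎))
    where
    step₁ : ∀ c q N W →
      2 ℕ.* (c ℕ.* (q ℕ.* q ℕ.* (q ℕ.* q) ℕ.* (W ℕ.* W))) ℕ.+ q ℕ.* q ℕ.* q ℕ.* (N ℕ.* q ℕ.+ c ℕ.* (W ℕ.* W)) ≡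
      q ℕ.* q ℕ.* (q ℕ.* q) ℕ.* N ℕ.+ 2 ℕ.* (c ℕ.* (q ℕ.* W)) ℕ.* (q ℕ.* (q ℕ.* (q ℕ.* W))) ℕ.+ c ℕ.* (q ℕ.* q) ℕ.* (q ℕ.* (W ℕ.* W))
    step₁ = ℕSolver.solve-∀
    step₂ : ∀ c q S W →
      c ℕ.* (q ℕ.* q) ℕ.* S ℕ.+ q ℕ.* (q ℕ.* (q ℕ.* q)) ℕ.* (c ℕ.* (W ℕ.* W)) ℕ.+ c ℕ.* (q ℕ.* q) ℕ.* (q ℕ.* (W ℕ.* W)) ≡
      c ℕ.* (q ℕ.* q) ℕ.* (S ℕ.+ q ℕ.* (W ℕ.* W)) ℕ.+ q ℕ.* (q ℕ.* (q ℕ.* q)) ℕ.* (c ℕ.* (W ℕ.* W))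
    step₂ = ℕSolver.solve-∀
    step₃ : ∀ c q W →
      c ℕ.* (q ℕ.* q) ℕ.* (q ℕ.* (q ℕ.* (W ℕ.* W)) ℕ.+ q ℕ.* (q ℕ.* (q ℕ.* W))) ℕ.+ q ℕ.* (q ℕ.* (q ℕ.* q)) ℕ.* (c ℕ.* (W ℕ.* W)) ≡
      2 ℕ.* (c ℕ.* (q ℕ.* q ℕ.* (q ℕ.* q) ℕ.* (W ℕ.* W))) ℕ.+ q ℕ.* q ℕ.* q ℕ.* (c ℕ.* (q ℕ.* q ℕ.* W))
    step₃ = ℕSolver.solve-∀

module AffineSums (F : FiniteField) where
  open FiniteField F
  open FieldProperties F

  ∑-translate : ∀ a (g : Carrier → ℕ) → ∑[ s ∈ finite ] g (s + a) ≡ ∑ finite g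
  ∑-translate a = ∑-reindex finite (_+ a) (_+ - a)
    (λ s → trans (R.+-assoc s (- a) a) (trans (cong (s +_) (R.-‿inverseˡ a)) (R.+-identityʳ s)))
    (λ s → trans (R.+-assoc s a (- a)) (trans (cong (s +_) (R.-‿inverseʳ a)) (R.+-identityʳ s)))

  ∑-scale : ∀ c → c ≢ 0# → (g : Carrier → ℕ) → ∑[ t ∈ finite ] g (t * c) ≡ ∑ finite g
  ∑-scale c c≢0 with c⁻¹ , cc⁻¹≡1 ← inverse c c≢0 = ∑-reindex finite (_* c) (_* c⁻¹)
    (λ t → trans (solve 3 (λ t c d → t :* d :* c := t :* (c :* d)) refl t c c⁻¹) (unit t))
    (λ t → trans (R.*-assoc t c c⁻¹) (unit t))
    where
    unit : ∀ t → t * (c * c⁻¹) ≡ t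
    unit t = trans (cong (t *_) cc⁻¹≡1) (R.*-identityʳ t)

  ∑-affine : ∀ a c → c ≢ 0# → (g : Carrier → ℕ) → ∑[ t ∈ finite ] g (t * c + a) ≡ ∑ finite g
  ∑-affine a c c≢0 g = trans (∑-scale c c≢0 (λ y → g (y + a))) (∑-translate a g)

  -- The base point alone makes a point of the line uniform: for each t, adding u t permutes the
  -- field.
  ∑-on-line : ∀ u (φ : Carrier → ℕ) → ∑[ s ∈ finite ] ∑[ t ∈ finite ] φ (s + u * t) ≡ order ℕ.* ∑ finite φ
  ∑-on-line u φ = trans (∑-swap finite finite _)
    (trans (∑-cong finite (λ t → ∑-translate (u * t) φ)) (∑-const finite _))

  -- Two distinct points of the line through a uniform point in a uniform direction are independent.
  ∑-on-line-pair : ∀ {u v} → u ≢ v → (φ : Carrier → Carrier → ℕ) →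
    ∑[ s ∈ finite ] ∑[ t ∈ finite ] φ (s + u * t) (s + v * t) ≡
    ∑[ y ∈ finite ] ∑[ z ∈ finite ] φ y z
  ∑-on-line-pair {u} {v} u≢v φ = begin
    (∑[ s ∈ finite ] ∑[ t ∈ finite ] φ (s + u * t) (s + v * t))
      ≡⟨ ∑-swap finite finite _ ⟩
    (∑[ t ∈ finite ] ∑[ s ∈ finite ] φ (s + u * t) (s + v * t))
      -- With y = s + u t as new variable the second point becomes y + t (v - u), and t (v - u) runs
      -- through the field because u ≠ v.
      ≡⟨ ∑-cong finite (λ t → ∑-cong finite (λ s → cong (φ (s + u * t)) (difference s t))) ⟩
    (∑[ t ∈ finite ] ∑[ s ∈ finite ] φ (s + u * t) (t * (v + - u) + (s + u * t)))
      ≡⟨ ∑-cong finite (λ t → ∑-translate (u * t) (λ y → φ y (t * (v + - u) + y))) ⟩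
    (∑[ t ∈ finite ] ∑[ y ∈ finite ] φ y (t * (v + - u) + y))
      ≡⟨ ∑-swap finite finite _ ⟩
    (∑[ y ∈ finite ] ∑[ t ∈ finite ] φ y (t * (v + - u) + y))
      ≡⟨ ∑-cong finite (λ y → ∑-affine y (v + - u) v-u≢0 (φ y)) ⟩
    (∑[ y ∈ finite ] ∑[ z ∈ finite ] φ y z) ∎
    where
    open ≡-Reasoning
    v-u≢0 : v + - u ≢ 0#
    v-u≢0 eq = u≢v (sym (x-y≡0⇒x≡y v u eq))
    difference : ∀ s t → s + v * t ≡ t * (v + - u) + (s + u * t)
    difference s t = begin
      s + v * t                         ≡⟨ R.+-identityʳ _ ⟨
      s + v * t + 0#                    ≡⟨ cong (s + v * t +_) (R.zeroˡ t) ⟨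
      s + v * t + 0# * t                ≡⟨ cong (λ z → s + v * t + z * t) (R.-‿inverseʳ u) ⟨
      s + v * t + (u + - u) * t         ≡⟨ solve 5 (λ s t u u′ v → s :+ v :* t :+ (u :+ u′) :* t :=
                                             t :* (v :+ u′) :+ (s :+ u :* t)) refl s t u (- u) v ⟩
      t * (v + - u) + (s + u * t)       ∎

  Quad : Set
  Quad = Carrier × Carrier × Carrier × Carrier

  quads : Finite Quad
  quads = ×-finite finite (×-finite finite (×-finite finite finite))

  card-quads : card quads ≡ order ℕ.* (order ℕ.* (order ℕ.* order))
  card-quads = trans (card-× finite (×-finite finite (×-finite finite finite)))
    (cong (order ℕ.*_) (trans (card-× finite (×-finite finite finite)) (cong (order ℕ.*_) (card-× finite finite))))

  -- Grouping s with t and s′ with t′ separates the two coordinates of the plane; each is a random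
  -- line in F, to which the one-dimensional lemmas apply.
  ∑-quads : (g : Carrier → Carrier → Carrier → Carrier → ℕ) →
    (∑[ (s , s′ , t , t′) ∈ quads ] g s s′ t t′) ≡
    ∑[ s ∈ finite ] ∑[ t ∈ finite ] ∑[ s′ ∈ finite ] ∑[ t′ ∈ finite ] g s s′ t t′
  ∑-quads g = trans (∑-× finite _ _) (∑-cong finite λ s →
              trans (trans (∑-× finite _ _) (∑-cong finite λ s′ → ∑-× finite finite _)) (∑-swap finite finite _))

  -- (s , s′ , t , t′) encodes the line with base point (s , s′) and direction (t , t′).
  onLine : (Carrier → Carrier → ℕ) → Carrier → Quad → ℕ
  onLine β u (s , s′ , t , t′) = β (s + u * t) (s′ + u * t′)

  ∑-onLine : ∀ β u → ∑ quads (onLine β u) ≡ order ℕ.* (order ℕ.* (∑[ y ∈ finite ] ∑ finite (β y)))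
  ∑-onLine β u = begin
    ∑ quads (onLine β u)
      ≡⟨ ∑-quads (λ s s′ t t′ → onLine β u (s , s′ , t , t′)) ⟩
    (∑[ s ∈ finite ] ∑[ t ∈ finite ] ∑[ s′ ∈ finite ] ∑[ t′ ∈ finite ] β (s + u * t) (s′ + u * t′))
      ≡⟨ ∑-cong finite (λ s → ∑-cong finite (λ t → ∑-on-line u (β (s + u * t)))) ⟩
    (∑[ s ∈ finite ] ∑[ t ∈ finite ] order ℕ.* ∑ finite (β (s + u * t)))
      ≡⟨ ∑-on-line u (λ y → order ℕ.* ∑ finite (β y)) ⟩
    order ℕ.* (∑[ y ∈ finite ] order ℕ.* ∑ finite (β y))
      ≡⟨ cong (order ℕ.*_) (∑-* finite order _) ⟩
    order ℕ.* (order ℕ.* (∑[ y ∈ finite ] ∑ finite (β y))) ∎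
    where open ≡-Reasoning

  markedOn : (Carrier → Carrier → ℕ) → Quad → ℕ
  markedOn β r = ∑[ u ∈ finite ] onLine β u r

  ∑-markedOn : ∀ β → ∑ quads (markedOn β) ≡ order ℕ.* (order ℕ.* (order ℕ.* (∑[ y ∈ finite ] ∑ finite (β y))))
  ∑-markedOn β = trans (∑-swap quads finite (λ r u → onLine β u r))
    (trans (∑-cong finite (∑-onLine β)) (∑-const finite _))

  -- `β` is the indicator of the marked points of a plane with q² points. Idempotence makes it
  -- 0-1-valued, and this is what evaluates the diagonal of the second moment. The random variable
  -- is the number of marked points on a random line, of mean W/q.
  module Chebyshev (β : Carrier → Carrier → ℕ) (β-idem : ∀ y z → β y z ℕ.* β y z ≡ β y z) where

    marked : ℕ
    marked = ∑[ y ∈ finite ] ∑[ z ∈ finite ] β y z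

    private
      q = order
      W = marked
      X = markedOn β
      at = onLine β

      two-points : ∀ {u v} → u ≢ v → ∑[ r ∈ quads ] at u r ℕ.* at v r ≡ W ℕ.* W
      two-points {u} {v} u≢v = begin
        (∑[ r ∈ quads ] at u r ℕ.* at v r)
          ≡⟨ ∑-quads (λ s s′ t t′ → at u (s , s′ , t , t′) ℕ.* at v (s , s′ , t , t′)) ⟩
        (∑[ s ∈ finite ] ∑[ t ∈ finite ] ∑[ s′ ∈ finite ] ∑[ t′ ∈ finite ]
          β (s + u * t) (s′ + u * t′) ℕ.* β (s + v * t) (s′ + v * t′))
          ≡⟨ ∑-cong finite (λ s → ∑-cong finite (λ t →
               ∑-on-line-pair u≢v (λ y′ z′ → β (s + u * t) y′ ℕ.* β (s + v * t) z′))) ⟩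
        (∑[ s ∈ finite ] ∑[ t ∈ finite ] ∑[ y′ ∈ finite ] ∑[ z′ ∈ finite ] β (s + u * t) y′ ℕ.* β (s + v * t) z′)
          ≡⟨ ∑-on-line-pair u≢v (λ y z → ∑[ y′ ∈ finite ] ∑[ z′ ∈ finite ] β y y′ ℕ.* β z z′) ⟩
        (∑[ y ∈ finite ] ∑[ z ∈ finite ] ∑[ y′ ∈ finite ] ∑[ z′ ∈ finite ] β y y′ ℕ.* β z z′)
          ≡⟨ ∑-cong finite (λ y → ∑-cong finite (λ z → trans
               (∑-cong finite (λ y′ → ∑-* finite (β y y′) (β z)))
               (∑-*ʳ finite (∑ finite (β z)) (β y)))) ⟩
        (∑[ y ∈ finite ] ∑[ z ∈ finite ] ∑ finite (β y) ℕ.* ∑ finite (β z))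
          ≡⟨ trans (∑-cong finite (λ y → ∑-* finite (∑ finite (β y)) _)) (∑-*ʳ finite W _) ⟩
        W ℕ.* W ∎
        where open ≡-Reasoning

      -- For u ≠ v the two points are independent, and for u = v the product collapses by
      -- idempotence. The indicator terms merge both cases into one equation without subtraction.
      pair-sum : ∀ u v → (∑[ r ∈ quads ] at u r ℕ.* at v r) ℕ.+ 𝟙 (v ≟ u) ℕ.* (W ℕ.* W) ≡
                         W ℕ.* W ℕ.+ 𝟙 (v ≟ u) ℕ.* (q ℕ.* (q ℕ.* W))
      pair-sum u v with v ≟ u
      ... | no v≢u = cong (ℕ._+ 0) (two-points (v≢u ∘ sym))
      ... | yes refl = trans (ℕₚ.+-comm _ (1 ℕ.* (W ℕ.* W)))
        (cong₂ ℕ._+_ (ℕₚ.*-identityˡ (W ℕ.* W))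
          (trans (trans (∑-cong quads (λ (s , s′ , t , t′) → β-idem _ _)) (∑-onLine β v)) (sym (ℕₚ.*-identityˡ _))))

      -- The identity E X² = W/q + (1 − 1/q) W²/q², multiplied by q⁴ and free of subtraction.
      second-moment : (∑[ r ∈ quads ] X r ℕ.* X r) ℕ.+ q ℕ.* (W ℕ.* W) ≡
                      q ℕ.* (q ℕ.* (W ℕ.* W)) ℕ.+ q ℕ.* (q ℕ.* (q ℕ.* W))
      second-moment = begin
        (∑[ r ∈ quads ] X r ℕ.* X r) ℕ.+ q ℕ.* (W ℕ.* W)
          ≡⟨ cong₂ ℕ._+_ expand (sym (diagonal (W ℕ.* W))) ⟩
        (∑[ u ∈ finite ] ∑[ v ∈ finite ] ∑[ r ∈ quads ] at u r ℕ.* at v r) ℕ.+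
        (∑[ u ∈ finite ] ∑[ v ∈ finite ] 𝟙 (v ≟ u) ℕ.* (W ℕ.* W))
          ≡⟨ trans (∑-cong finite (λ u → ∑-+ finite _ _)) (∑-+ finite _ _) ⟨
        (∑[ u ∈ finite ] ∑[ v ∈ finite ]
          ((∑[ r ∈ quads ] at u r ℕ.* at v r) ℕ.+ 𝟙 (v ≟ u) ℕ.* (W ℕ.* W)))
          ≡⟨ ∑-cong finite (λ u → ∑-cong finite (λ v → pair-sum u v)) ⟩
        (∑[ u ∈ finite ] ∑[ v ∈ finite ] (W ℕ.* W ℕ.+ 𝟙 (v ≟ u) ℕ.* (q ℕ.* (q ℕ.* W))))
          ≡⟨ trans (∑-cong finite (λ u → ∑-+ finite _ _)) (∑-+ finite _ _) ⟩
        (∑[ u ∈ finite ] ∑[ v ∈ finite ] W ℕ.* W) ℕ.+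
        (∑[ u ∈ finite ] ∑[ v ∈ finite ] 𝟙 (v ≟ u) ℕ.* (q ℕ.* (q ℕ.* W)))
          ≡⟨ cong₂ ℕ._+_ (trans (∑-const finite _) (cong (q ℕ.*_) (∑-const finite _))) (diagonal _) ⟩
        q ℕ.* (q ℕ.* (W ℕ.* W)) ℕ.+ q ℕ.* (q ℕ.* (q ℕ.* W)) ∎
        where
        open ≡-Reasoning
        diagonal : ∀ c → (∑[ u ∈ finite ] ∑[ v ∈ finite ] 𝟙 (v ≟ u) ℕ.* c) ≡ q ℕ.* c
        diagonal c = trans (∑-cong finite (λ u → ∑-𝟙≡ finite _≟_ u (λ _ → c))) (∑-const finite c)
        expand : (∑[ r ∈ quads ] X r ℕ.* X r) ≡
                 ∑[ u ∈ finite ] ∑[ v ∈ finite ] ∑[ r ∈ quads ] at u r ℕ.* at v r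
        expand = begin
          (∑[ r ∈ quads ] X r ℕ.* X r)
            ≡⟨ ∑-cong quads (λ r → sym (trans (∑-cong finite (λ u → ∑-* finite (at u r) _)) (∑-*ʳ finite (X r) _))) ⟩
          (∑[ r ∈ quads ] ∑[ u ∈ finite ] ∑[ v ∈ finite ] at u r ℕ.* at v r)
            ≡⟨ ∑-swap quads finite _ ⟩
          (∑[ u ∈ finite ] ∑[ r ∈ quads ] ∑[ v ∈ finite ] at u r ℕ.* at v r)
            ≡⟨ ∑-cong finite (λ u → ∑-swap quads finite _) ⟩
          (∑[ u ∈ finite ] ∑[ v ∈ finite ] ∑[ r ∈ quads ] at u r ℕ.* at v r) ∎

      light : Quad → ℕ
      light r = 𝟙 (4 ℕ.* X r ℕₚ.<? q)

      -- The expansions of the squares and of the cross term in (4 q X - 4 W)², arranged so that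
      -- sums of X and X² can be pulled out.
      fourfold : ∀ q X W → 4 ℕ.* (q ℕ.* X) ℕ.* (4 ℕ.* (q ℕ.* X)) ℕ.+ 4 ℕ.* W ℕ.* (4 ℕ.* W) ≡
                           16 ℕ.* (q ℕ.* q) ℕ.* (X ℕ.* X) ℕ.+ 16 ℕ.* (W ℕ.* W)
      fourfold = ℕSolver.solve-∀

      fourfold′ : ∀ q X W → 2 ℕ.* (4 ℕ.* (q ℕ.* X) ℕ.* (4 ℕ.* W)) ≡ 2 ℕ.* (16 ℕ.* (q ℕ.* W)) ℕ.* X
      fourfold′ = ℕSolver.solve-∀

      pointwise : q ℕ.* q ℕ.≤ 2 ℕ.* W → ∀ r →
        q ℕ.* q ℕ.* (q ℕ.* q) ℕ.* light r ℕ.+ 2 ℕ.* (16 ℕ.* (q ℕ.* W)) ℕ.* X r ℕ.≤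
        16 ℕ.* (q ℕ.* q) ℕ.* (X r ℕ.* X r) ℕ.+ 16 ℕ.* (W ℕ.* W)
      pointwise heavy r = go (4 ℕ.* X r ℕₚ.<? q)
        where
        open ℕₚ.≤-Reasoning
        regroup : ∀ q X → 4 ℕ.* (q ℕ.* X) ≡ q ℕ.* (4 ℕ.* X)
        regroup = ℕSolver.solve-∀
        double : ∀ c → c ℕ.+ c ≡ 2 ℕ.* c
        double = ℕSolver.solve-∀
        double₂ : ∀ c → 2 ℕ.* (2 ℕ.* c) ≡ 4 ℕ.* c
        double₂ = ℕSolver.solve-∀
        gap : 4 ℕ.* X r ℕ.< q → 4 ℕ.* (q ℕ.* X r) ℕ.+ q ℕ.* q ℕ.≤ 4 ℕ.* W
        gap 4X<q = begin
          4 ℕ.* (q ℕ.* X r) ℕ.+ q ℕ.* q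
            ≡⟨ cong (ℕ._+ q ℕ.* q) (regroup q (X r)) ⟩
          q ℕ.* (4 ℕ.* X r) ℕ.+ q ℕ.* q
            ≤⟨ ℕₚ.+-monoˡ-≤ (q ℕ.* q) (ℕₚ.*-monoʳ-≤ q (ℕₚ.<⇒≤ 4X<q)) ⟩
          q ℕ.* q ℕ.+ q ℕ.* q
            ≡⟨ double (q ℕ.* q) ⟩
          2 ℕ.* (q ℕ.* q)
            ≤⟨ ℕₚ.*-monoʳ-≤ 2 heavy ⟩
          2 ℕ.* (2 ℕ.* W)
            ≡⟨ double₂ W ⟩
          4 ℕ.* W ∎
        go : (l : Dec (4 ℕ.* X r ℕ.< q)) →
          q ℕ.* q ℕ.* (q ℕ.* q) ℕ.* 𝟙 l ℕ.+ 2 ℕ.* (16 ℕ.* (q ℕ.* W)) ℕ.* X r ℕ.≤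
          16 ℕ.* (q ℕ.* q) ℕ.* (X r ℕ.* X r) ℕ.+ 16 ℕ.* (W ℕ.* W)
        go (yes 4X<q) = subst₂ ℕ._≤_
          (cong₂ ℕ._+_ (sym (ℕₚ.*-identityʳ (q ℕ.* q ℕ.* (q ℕ.* q)))) (fourfold′ q (X r) W)) (fourfold q (X r) W)
          (squared-gap (4 ℕ.* (q ℕ.* X r)) (4 ℕ.* W) (q ℕ.* q) (gap 4X<q))
        go (no _) = subst₂ ℕ._≤_
          (trans (fourfold′ q (X r) W) (cong (ℕ._+ 2 ℕ.* (16 ℕ.* (q ℕ.* W)) ℕ.* X r) (sym (ℕₚ.*-zeroʳ (q ℕ.* q ℕ.* (q ℕ.* q))))))
          (fourfold q (X r) W)
          (2ab≤a²+b² (4 ℕ.* (q ℕ.* X r)) (4 ℕ.* W))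

      N = ∑ quads light
      S = ∑[ r ∈ quads ] X r ℕ.* X r

      summed : q ℕ.* q ℕ.≤ 2 ℕ.* W →
        q ℕ.* q ℕ.* (q ℕ.* q) ℕ.* N ℕ.+ 2 ℕ.* (16 ℕ.* (q ℕ.* W)) ℕ.* (q ℕ.* (q ℕ.* (q ℕ.* W))) ℕ.≤
        16 ℕ.* (q ℕ.* q) ℕ.* S ℕ.+ q ℕ.* (q ℕ.* (q ℕ.* q)) ℕ.* (16 ℕ.* (W ℕ.* W))
      summed heavy = begin
        q ℕ.* q ℕ.* (q ℕ.* q) ℕ.* N ℕ.+ 2 ℕ.* (16 ℕ.* (q ℕ.* W)) ℕ.* (q ℕ.* (q ℕ.* (q ℕ.* W)))
          ≡⟨ cong₂ ℕ._+_ (∑-* quads (q ℕ.* q ℕ.* (q ℕ.* q)) light)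
               (trans (∑-* quads (2 ℕ.* (16 ℕ.* (q ℕ.* W))) X) (cong (2 ℕ.* (16 ℕ.* (q ℕ.* W)) ℕ.*_) (∑-markedOn β))) ⟨
        (∑[ r ∈ quads ] q ℕ.* q ℕ.* (q ℕ.* q) ℕ.* light r) ℕ.+ (∑[ r ∈ quads ] 2 ℕ.* (16 ℕ.* (q ℕ.* W)) ℕ.* X r)
          ≡⟨ ∑-+ quads _ _ ⟨
        (∑[ r ∈ quads ] (q ℕ.* q ℕ.* (q ℕ.* q) ℕ.* light r ℕ.+ 2 ℕ.* (16 ℕ.* (q ℕ.* W)) ℕ.* X r))
          ≤⟨ ∑-mono quads (pointwise heavy) ⟩
        (∑[ r ∈ quads ] (16 ℕ.* (q ℕ.* q) ℕ.* (X r ℕ.* X r) ℕ.+ 16 ℕ.* (W ℕ.* W)))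
          ≡⟨ ∑-+ quads _ _ ⟩
        (∑[ r ∈ quads ] 16 ℕ.* (q ℕ.* q) ℕ.* (X r ℕ.* X r)) ℕ.+ (∑[ r ∈ quads ] 16 ℕ.* (W ℕ.* W))
          ≡⟨ cong₂ ℕ._+_ (∑-* quads (16 ℕ.* (q ℕ.* q)) (λ r → X r ℕ.* X r))
               (trans (∑-const quads (16 ℕ.* (W ℕ.* W))) (cong (ℕ._* (16 ℕ.* (W ℕ.* W))) card-quads)) ⟩
        16 ℕ.* (q ℕ.* q) ℕ.* S ℕ.+ q ℕ.* (q ℕ.* (q ℕ.* q)) ℕ.* (16 ℕ.* (W ℕ.* W)) ∎
        where open ℕₚ.≤-Reasoning

    light-lines : order ℕ.* order ℕ.≤ 2 ℕ.* marked →
      (∑[ r ∈ quads ] 𝟙 (4 ℕ.* markedOn β r ℕₚ.<? order)) ℕ.* order ℕ.≤ 4 ℕ.* (order ℕ.* order ℕ.* (order ℕ.* order))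
    light-lines heavy = chebyshev-arithmetic q N W S {{card-nonZero finite}} (summed heavy) second-moment

-- Random F-combinations of vectors over H

-- `split` says that `_⊗_` enumerates C exactly once. Taken with `_∷_`, this separates the first
-- column of a matrix stored by rows; taken with `_,_`, it separates coefficients from directions.
∑-zipWith : {A B C : Set} (finA : Finite A) (finB : Finite B) (finC : Finite C) (_⊗_ : A → B → C) →
  ((g : C → ℕ) → ∑ finC g ≡ ∑[ a ∈ finA ] ∑[ b ∈ finB ] g (a ⊗ b)) →
  ∀ n (g : Vec C n → ℕ) →
  ∑ (Vec-finite finC n) g ≡ ∑[ as ∈ Vec-finite finA n ] ∑[ bs ∈ Vec-finite finB n ] g (zipWith _⊗_ as bs)
∑-zipWith finA finB finC _⊗_ split zero g = begin
  ∑ (Vec-finite finC 0) g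
    ≡⟨ ∑-[] finC g ⟩
  g []
    ≡⟨ trans (∑-[] finA _) (∑-[] finB _) ⟨
  (∑[ as ∈ Vec-finite finA 0 ] ∑[ bs ∈ Vec-finite finB 0 ] g (zipWith _⊗_ as bs)) ∎
  where open ≡-Reasoning
∑-zipWith finA finB finC _⊗_ split (suc n) g = begin
  ∑ (Vec-finite finC (suc n)) g
    ≡⟨ trans (∑-∷ finC n g) (split _) ⟩
  (∑[ a ∈ finA ] ∑[ b ∈ finB ] ∑[ cs ∈ Vec-finite finC n ] g ((a ⊗ b) ∷ cs))
    ≡⟨ ∑-cong finA (λ a → ∑-cong finB (λ b → ∑-zipWith finA finB finC _⊗_ split n _)) ⟩
  (∑[ a ∈ finA ] ∑[ b ∈ finB ] ∑[ as ∈ Vec-finite finA n ] ∑[ bs ∈ Vec-finite finB n ]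
    g ((a ⊗ b) ∷ zipWith _⊗_ as bs))
    ≡⟨ ∑-cong finA (λ a → ∑-swap finB (Vec-finite finA n) _) ⟩
  (∑[ a ∈ finA ] ∑[ as ∈ Vec-finite finA n ] ∑[ b ∈ finB ] ∑[ bs ∈ Vec-finite finB n ]
    g ((a ⊗ b) ∷ zipWith _⊗_ as bs))
    ≡⟨ trans (∑-∷ finA n _) (∑-cong finA (λ a → ∑-cong (Vec-finite finA n) (λ as → ∑-∷ finB n _))) ⟨
  (∑[ as ∈ Vec-finite finA (suc n) ] ∑[ bs ∈ Vec-finite finB (suc n) ] g (zipWith _⊗_ as bs)) ∎
  where open ≡-Reasoning

module RandomCombinations {H F : FiniteField} (E : Extension H F) where
  open FiniteField F
  open FieldProperties F
  open AffineSums F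
  open Extension E using (embed; homomorphism; HasDegree)
  private
    module H where
      open FiniteField H public
      open FieldProperties H public
  open IsRingHomomorphism homomorphism using (+-homo; *-homo; 0#-homo; 1#-homo)

  private
    q = order
    h = H.order

  embed-≢0 : ∀ {a} → a ≢ H.0# → embed a ≢ 0#
  embed-≢0 {a} a≢0 ea≡0 with a⁻¹ , aa⁻¹≡1 ← H.inverse a a≢0 = 1≢0 (begin
    1#                      ≡⟨ 1#-homo ⟨
    embed H.1#              ≡⟨ cong embed aa⁻¹≡1 ⟨
    embed (a H.* a⁻¹)       ≡⟨ *-homo a a⁻¹ ⟩
    embed a * embed a⁻¹     ≡⟨ cong (_* embed a⁻¹) ea≡0 ⟩
    0# * embed a⁻¹          ≡⟨ R.zeroˡ _ ⟩
    0#                      ∎)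
    where open ≡-Reasoning

  dot : ∀ {k} → Vec Carrier k → Vec H.Carrier k → Carrier
  dot []      []      = 0#
  dot (c ∷ c⃗) (a ∷ a⃗) = c * embed a + dot c⃗ a⃗

  0⃗ : ∀ {k} → Vec H.Carrier k
  0⃗ = replicate _ H.0#

  dot-+ : ∀ {k} (c : Vec Carrier k) a b → dot c (zipWith H._+_ a b) ≡ dot c a + dot c b
  dot-+ []      []      []      = sym (R.+-identityˡ 0#)
  dot-+ (c ∷ c⃗) (a ∷ a⃗) (b ∷ b⃗) = trans
    (cong₂ (λ x y → c * x + y) (+-homo a b) (dot-+ c⃗ a⃗ b⃗))
    (solve 5 (λ c a b x y → c :* (a :+ b) :+ (x :+ y) := c :* a :+ x :+ (c :* b :+ y)) refl
      c (embed a) (embed b) _ _)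

  neg : ∀ {k} → Vec H.Carrier k → Vec H.Carrier k
  neg = Vec.map (H.-_)

  +-neg-cancel : ∀ {k} (b a : Vec H.Carrier k) → zipWith H._+_ (zipWith H._+_ a (neg b)) b ≡ a
  +-neg-cancel []      []      = refl
  +-neg-cancel (b ∷ b⃗) (a ∷ a⃗) = cong₂ _∷_
    (trans (H.R.+-assoc a (H.- b) b) (trans (cong (a H.+_) (H.R.-‿inverseˡ b)) (H.R.+-identityʳ a)))
    (+-neg-cancel b⃗ a⃗)

  neg-+-cancel : ∀ {k} (b a : Vec H.Carrier k) → zipWith H._+_ (zipWith H._+_ a b) (neg b) ≡ a
  neg-+-cancel []      []      = refl
  neg-+-cancel (b ∷ b⃗) (a ∷ a⃗) = cong₂ _∷_
    (trans (H.R.+-assoc a b (H.- b)) (trans (cong (a H.+_) (H.R.-‿inverseʳ b)) (H.R.+-identityʳ a)))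
    (neg-+-cancel b⃗ a⃗)

  dot-minus : ∀ {k} (c : Vec Carrier k) a b → dot c (zipWith H._+_ a (neg b)) + dot c b ≡ dot c a
  dot-minus c a b = trans (sym (dot-+ c _ b)) (cong (dot c) (+-neg-cancel b a))

  -- The recursion skips the zero entries of `a`. At the first nonzero one, the coefficient of that
  -- entry alone makes the dot product uniform, whatever the others are.
  ∑-dot-coefficients : ∀ {k} (a : Vec H.Carrier k) → a ≢ 0⃗ → (g : Carrier → ℕ) →
    q ℕ.* (∑[ c ∈ points k ] g (dot c a)) ≡ q ℕ.^ k ℕ.* ∑ finite g
  ∑-dot-coefficients []      a≢0 g = contradiction refl a≢0
  ∑-dot-coefficients {suc k} (a ∷ a⃗) a≢0 g with a H.≟ H.0#
  ... | no a₀≢0 = begin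
    q ℕ.* (∑[ c ∈ points (suc k) ] g (dot c (a ∷ a⃗)))
      ≡⟨ cong (q ℕ.*_) (trans (∑-∷ finite k _) (∑-swap finite (points k) _)) ⟩
    q ℕ.* (∑[ c⃗ ∈ points k ] ∑[ c ∈ finite ] g (c * embed a + dot c⃗ a⃗))
      ≡⟨ cong (q ℕ.*_) (∑-cong (points k) (λ c⃗ → ∑-affine (dot c⃗ a⃗) (embed a) (embed-≢0 a₀≢0) g)) ⟩
    q ℕ.* (∑[ _ ∈ points k ] ∑ finite g)
      ≡⟨ cong (q ℕ.*_) (trans (∑-const (points k) _) (cong (ℕ._* ∑ finite g) (card-Vec finite k))) ⟩
    q ℕ.* (q ℕ.^ k ℕ.* ∑ finite g)
      ≡⟨ ℕₚ.*-assoc q (q ℕ.^ k) _ ⟨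
    q ℕ.^ suc k ℕ.* ∑ finite g ∎
    where open ≡-Reasoning
  ... | yes refl = begin
    q ℕ.* (∑[ c ∈ points (suc k) ] g (dot c (H.0# ∷ a⃗)))
      ≡⟨ cong (q ℕ.*_) (∑-∷ finite k _) ⟩
    q ℕ.* (∑[ c ∈ finite ] ∑[ c⃗ ∈ points k ] g (c * embed H.0# + dot c⃗ a⃗))
      ≡⟨ cong (q ℕ.*_) (∑-cong finite (λ c → ∑-cong (points k) (λ c⃗ → cong g (drop c _)))) ⟩
    q ℕ.* (∑[ c ∈ finite ] ∑[ c⃗ ∈ points k ] g (dot c⃗ a⃗))
      ≡⟨ cong (q ℕ.*_) (∑-const finite _) ⟩
    q ℕ.* (q ℕ.* (∑[ c⃗ ∈ points k ] g (dot c⃗ a⃗)))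
      ≡⟨ cong (q ℕ.*_) (∑-dot-coefficients a⃗ (λ a⃗≡0 → a≢0 (cong (H.0# ∷_) a⃗≡0)) g) ⟩
    q ℕ.* (q ℕ.^ k ℕ.* ∑ finite g)
      ≡⟨ ℕₚ.*-assoc q (q ℕ.^ k) _ ⟨
    q ℕ.^ suc k ℕ.* ∑ finite g ∎
    where
    open ≡-Reasoning
    drop : ∀ c x → c * embed H.0# + x ≡ x
    drop c x = trans (cong (λ z → c * z + x) 0#-homo) (trans (cong (_+ x) (R.zeroʳ c)) (R.+-identityˡ x))

  module _ {k} (c : Vec Carrier k) where

    fibre : Carrier → ℕ
    fibre y = ∑[ a ∈ H.points k ] 𝟙 (dot c a ≟ y)

    Hit : Carrier → Set
    Hit y = ∃ λ a → dot c a ≡ y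

    Hit? : Decidable Hit
    Hit? y = any-finite? (H.points k) (λ a → dot c a ≟ y)

    Bad : Set
    Bad = ∃ λ y → ¬ Hit y

    Bad? : Dec Bad
    Bad? = any-finite? finite (¬? ∘ Hit?)

    -- By additivity of `dot c`, adding a preimage of `y` carries the kernel bijectively onto the
    -- fibre over `y`.
    fibre-hit : ∀ {y} → Hit y → fibre y ≡ fibre 0#
    fibre-hit {y} (a₀ , ca₀≡y) = begin
      fibre y
        ≡⟨ ∑-reindex (H.points k) (λ a → zipWith H._+_ a a₀) (λ a → zipWith H._+_ a (neg a₀))
             (+-neg-cancel a₀) (neg-+-cancel a₀) _ ⟨
      (∑[ a ∈ H.points k ] 𝟙 (dot c (zipWith H._+_ a a₀) ≟ y))
        ≡⟨ ∑-cong (H.points k) (λ a → 𝟙-cong (to a) (from a) _ _) ⟩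
      fibre 0# ∎
      where
      open ≡-Reasoning
      to : ∀ a → dot c (zipWith H._+_ a a₀) ≡ y → dot c a ≡ 0#
      to a eq = begin
        dot c a                               ≡⟨ R.+-identityʳ _ ⟨
        dot c a + 0#                          ≡⟨ cong (dot c a +_) (R.-‿inverseʳ (dot c a₀)) ⟨
        dot c a + (dot c a₀ + - dot c a₀)     ≡⟨ R.+-assoc _ _ _ ⟨
        dot c a + dot c a₀ + - dot c a₀       ≡⟨ cong (_+ - dot c a₀) (trans (sym (dot-+ c a a₀)) (trans eq (sym ca₀≡y))) ⟩
        dot c a₀ + - dot c a₀                 ≡⟨ R.-‿inverseʳ _ ⟩
        0#                                    ∎
      from : ∀ a → dot c a ≡ 0# → dot c (zipWith H._+_ a a₀) ≡ y
      from a ca≡0 = trans (dot-+ c a a₀) (trans (cong (_+ dot c a₀) ca≡0) (trans (R.+-identityˡ _) ca₀≡y))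

    fibre-¬hit : ∀ {y} → ¬ Hit y → fibre y ≡ 0
    fibre-¬hit {y} ¬hit = trans (∑-cong (H.points k) (λ a → 𝟙-false (λ eq → ¬hit (a , eq)) (dot c a ≟ y)))
                                (trans (∑-const (H.points k) 0) (ℕₚ.*-zeroʳ (card (H.points k))))

    fibre≤fibre0 : ∀ y → fibre y ℕ.≤ fibre 0#
    fibre≤fibre0 y with Hit? y
    ... | yes hit = ℕₚ.≤-reflexive (fibre-hit hit)
    ... | no ¬hit = ℕₚ.≤-trans (ℕₚ.≤-reflexive (fibre-¬hit ¬hit)) z≤n

    ∑-fibre : (g : Carrier → ℕ) → ∑[ a ∈ H.points k ] g (dot c a) ≡ ∑[ y ∈ finite ] fibre y ℕ.* g y
    ∑-fibre g = begin
      (∑[ a ∈ H.points k ] g (dot c a))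
        ≡⟨ ∑-cong (H.points k) (λ a → sym (trans
             (∑-cong finite (λ y → cong (ℕ._* g y) (𝟙-cong sym sym (dot c a ≟ y) (y ≟ dot c a))))
             (∑-𝟙≡ finite _≟_ (dot c a) g))) ⟩
      (∑[ a ∈ H.points k ] ∑[ y ∈ finite ] 𝟙 (dot c a ≟ y) ℕ.* g y)
        ≡⟨ ∑-swap (H.points k) finite _ ⟩
      (∑[ y ∈ finite ] ∑[ a ∈ H.points k ] 𝟙 (dot c a ≟ y) ℕ.* g y)
        ≡⟨ ∑-cong finite (λ y → ∑-*ʳ (H.points k) (g y) _) ⟩
      (∑[ y ∈ finite ] fibre y ℕ.* g y) ∎
      where open ≡-Reasoning

    ∑-fibre-sizes : ∑ finite fibre ≡ h ℕ.^ k
    ∑-fibre-sizes = begin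
      ∑ finite fibre                         ≡⟨ ∑-cong finite (λ y → sym (ℕₚ.*-identityʳ _)) ⟩
      (∑[ y ∈ finite ] fibre y ℕ.* 1)        ≡⟨ ∑-fibre (λ _ → 1) ⟨
      (∑[ a ∈ H.points k ] 1)                ≡⟨ card≡∑1 (H.points k) ⟨
      card (H.points k)                      ≡⟨ card-Vec H.finite k ⟩
      h ℕ.^ k                                ∎
      where open ≡-Reasoning

    ∑-good : ¬ Bad → (g : Carrier → ℕ) → ∑[ a ∈ H.points k ] g (dot c a) ≡ fibre 0# ℕ.* ∑ finite g
    ∑-good good g = trans (∑-fibre g)
      (trans (∑-cong finite (λ y → cong (ℕ._* g y) (fibre-hit (decidable-stable (Hit? y) (λ ¬hit → good (y , ¬hit))))))
             (∑-* finite (fibre 0#) g))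

    kernel-good : ¬ Bad → q ℕ.* fibre 0# ≡ h ℕ.^ k
    kernel-good good = begin
      q ℕ.* fibre 0#              ≡⟨ ∑-const finite _ ⟨
      (∑[ _ ∈ finite ] fibre 0#)  ≡⟨ ∑-cong finite (λ y → fibre-hit (decidable-stable (Hit? y) (λ ¬hit → good (y , ¬hit)))) ⟨
      ∑ finite fibre              ≡⟨ ∑-fibre-sizes ⟩
      h ℕ.^ k                     ∎
      where open ≡-Reasoning

    -- If z is not in the image, then at most one of y and y + z is, so the kernel is at
    -- least twice as large as for a surjection.
    kernel-large : h ℕ.^ k ℕ.+ 𝟙 Bad? ℕ.* h ℕ.^ k ℕ.≤ q ℕ.* fibre 0#
    kernel-large with Bad?
    ... | no _ = let open ℕₚ.≤-Reasoning in begin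
      h ℕ.^ k ℕ.+ 0               ≡⟨ ℕₚ.+-identityʳ _ ⟩
      h ℕ.^ k                     ≡⟨ ∑-fibre-sizes ⟨
      ∑ finite fibre              ≤⟨ ∑-mono finite fibre≤fibre0 ⟩
      (∑[ _ ∈ finite ] fibre 0#)  ≡⟨ ∑-const finite _ ⟩
      q ℕ.* fibre 0#              ∎
    ... | yes (z , ¬hit) = let open ℕₚ.≤-Reasoning in begin
      h ℕ.^ k ℕ.+ 1 ℕ.* h ℕ.^ k
        ≡⟨ cong₂ ℕ._+_ (sym ∑-fibre-sizes) (trans (ℕₚ.*-identityˡ _) (trans (sym ∑-fibre-sizes) (sym (∑-translate z fibre)))) ⟩
      ∑ finite fibre ℕ.+ (∑[ y ∈ finite ] fibre (y + z))
        ≡⟨ ∑-+ finite _ _ ⟨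
      (∑[ y ∈ finite ] (fibre y ℕ.+ fibre (y + z)))
        ≤⟨ ∑-mono finite two-fibres ⟩
      (∑[ _ ∈ finite ] fibre 0#)
        ≡⟨ ∑-const finite _ ⟩
      q ℕ.* fibre 0# ∎
      where
      two-fibres : ∀ y → fibre y ℕ.+ fibre (y + z) ℕ.≤ fibre 0#
      two-fibres y with Hit? y | Hit? (y + z)
      ... | no ¬hy | _ = ℕₚ.≤-trans (ℕₚ.≤-reflexive (cong (ℕ._+ fibre (y + z)) (fibre-¬hit ¬hy))) (fibre≤fibre0 (y + z))
      ... | yes _ | no ¬hyz = ℕₚ.≤-trans
        (ℕₚ.≤-reflexive (trans (cong (fibre y ℕ.+_) (fibre-¬hit ¬hyz)) (ℕₚ.+-identityʳ _))) (fibre≤fibre0 y)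
      ... | yes (a , ca≡y) | yes (b , cb≡y+z) = contradiction
        (zipWith H._+_ b (neg a) , difference) ¬hit
        where
        difference : dot c (zipWith H._+_ b (neg a)) ≡ z
        difference = begin
          w                     ≡⟨ R.+-identityʳ w ⟨
          w + 0#                ≡⟨ cong (w +_) (R.-‿inverseʳ y) ⟨
          w + (y + - y)         ≡⟨ R.+-assoc w y (- y) ⟨
          w + y + - y           ≡⟨ cong (_+ - y) (trans (cong (w +_) (sym ca≡y)) (trans (dot-minus c b a) cb≡y+z)) ⟩
          y + z + - y           ≡⟨ solve 3 (λ y z y′ → y :+ z :+ y′ := z :+ (y :+ y′)) refl y z (- y) ⟩
          z + (y + - y)         ≡⟨ cong (z +_) (R.-‿inverseʳ y) ⟩
          z + 0#                ≡⟨ R.+-identityʳ z ⟩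
          z                     ∎
          where
          open ≡-Reasoning
          w = dot c (zipWith H._+_ b (neg a))

  bads : ℕ → ℕ
  bads k = ∑[ c ∈ points k ] 𝟙 (Bad? c)

  -- Double counting of the pairs (c , a) with `dot c a ≡ 0#`, weighted by q. By `kernel-large`
  -- every c contributes at least h^k, and a bad c twice that. Every a ≠ 0 contributes exactly q^k
  -- and a = 0 contributes q · q^k. The common term q^k · h^k cancels and leaves the bad tuples
  -- against the contribution of a = 0.
  bads-bound : ∀ k → bads k ℕ.* h ℕ.^ k ℕ.≤ q ℕ.* q ℕ.^ k
  bads-bound k = ℕₚ.+-cancelˡ-≤ (q ℕ.^ k ℕ.* h ℕ.^ k) _ _ (begin
    q ℕ.^ k ℕ.* h ℕ.^ k ℕ.+ bads k ℕ.* h ℕ.^ k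
      ≡⟨ cong₂ ℕ._+_ (trans (∑-const (points k) _) (cong (ℕ._* h ℕ.^ k) (card-Vec finite k))) (∑-*ʳ (points k) (h ℕ.^ k) _) ⟨
    (∑[ c ∈ points k ] h ℕ.^ k) ℕ.+ (∑[ c ∈ points k ] 𝟙 (Bad? c) ℕ.* h ℕ.^ k)
      ≡⟨ ∑-+ (points k) _ _ ⟨
    (∑[ c ∈ points k ] (h ℕ.^ k ℕ.+ 𝟙 (Bad? c) ℕ.* h ℕ.^ k))
      ≤⟨ ∑-mono (points k) kernel-large ⟩
    (∑[ c ∈ points k ] q ℕ.* fibre c 0#)
      ≡⟨ ∑-* (points k) q _ ⟩
    q ℕ.* (∑[ c ∈ points k ] ∑[ a ∈ H.points k ] 𝟙 (dot c a ≟ 0#))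
      ≡⟨ trans (cong (q ℕ.*_) (∑-swap (points k) (H.points k) _)) (sym (∑-* (H.points k) q _)) ⟩
    (∑[ a ∈ H.points k ] q ℕ.* (∑[ c ∈ points k ] 𝟙 (dot c a ≟ 0#)))
      ≤⟨ ∑-mono (H.points k) orthogonal ⟩
    (∑[ a ∈ H.points k ] (q ℕ.^ k ℕ.+ 𝟙 (≡-dec H._≟_ a 0⃗) ℕ.* (q ℕ.* q ℕ.^ k)))
      ≡⟨ ∑-+ (H.points k) _ _ ⟩
    (∑[ a ∈ H.points k ] q ℕ.^ k) ℕ.+ (∑[ a ∈ H.points k ] 𝟙 (≡-dec H._≟_ a 0⃗) ℕ.* (q ℕ.* q ℕ.^ k))
      ≡⟨ cong₂ ℕ._+_ (trans (∑-const (H.points k) _) (trans (cong (ℕ._* q ℕ.^ k) (card-Vec H.finite k)) (ℕₚ.*-comm (h ℕ.^ k) _)))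
                     (∑-𝟙≡ (H.points k) (≡-dec H._≟_) 0⃗ _) ⟩
    q ℕ.^ k ℕ.* h ℕ.^ k ℕ.+ q ℕ.* q ℕ.^ k ∎)
    where
    open ℕₚ.≤-Reasoning
    orthogonal : ∀ a → q ℕ.* (∑[ c ∈ points k ] 𝟙 (dot c a ≟ 0#)) ℕ.≤
                       q ℕ.^ k ℕ.+ 𝟙 (≡-dec H._≟_ a 0⃗) ℕ.* (q ℕ.* q ℕ.^ k)
    orthogonal a with ≡-dec H._≟_ a 0⃗
    ... | no a≢0 = ℕₚ.≤-reflexive (begin-equality
      q ℕ.* (∑[ c ∈ points k ] 𝟙 (dot c a ≟ 0#))   ≡⟨ ∑-dot-coefficients a a≢0 (λ y → 𝟙 (y ≟ 0#)) ⟩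
      q ℕ.^ k ℕ.* (∑[ y ∈ finite ] 𝟙 (y ≟ 0#))     ≡⟨ cong (q ℕ.^ k ℕ.*_) (trans (∑-cong finite (λ y → sym (ℕₚ.*-identityʳ _)))
                                                         (∑-𝟙≡ finite _≟_ 0# (λ _ → 1))) ⟩
      q ℕ.^ k ℕ.* 1                                ≡⟨ ℕₚ.*-identityʳ _ ⟩
      q ℕ.^ k                                      ≡⟨ ℕₚ.+-identityʳ _ ⟨
      q ℕ.^ k ℕ.+ 0                                ∎)
    ... | yes _ = begin
      q ℕ.* (∑[ c ∈ points k ] 𝟙 (dot c a ≟ 0#))   ≤⟨ ℕₚ.*-monoʳ-≤ q (∑-mono (points k) (λ c → 𝟙≤1 _)) ⟩
      q ℕ.* (∑[ c ∈ points k ] 1)                  ≡⟨ cong (q ℕ.*_) (trans (sym (card≡∑1 (points k))) (card-Vec finite k)) ⟩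
      q ℕ.* q ℕ.^ k                                ≡⟨ ℕₚ.*-identityˡ _ ⟨
      1 ℕ.* (q ℕ.* q ℕ.^ k)                        ≤⟨ ℕₚ.m≤n+m _ (q ℕ.^ k) ⟩
      q ℕ.^ k ℕ.+ 1 ℕ.* (q ℕ.* q ℕ.^ k)            ∎

  order≤ : ∀ {m} → HasDegree m → q ℕ.≤ h ℕ.^ m
  order≤ {m} (b , basis) = subst (q ℕ.≤_) (card-Vec H.finite m)
    (card-surjection (H.points m) finite _≟_ (λ c → Extension.combination E c b) (Extension.IsBasis.spanning basis))

  combine : ∀ {k m} → Vec Carrier k → Vec (Vec H.Carrier m) k → Vec Carrier m
  combine []      []      = replicate _ 0#
  combine (c ∷ c⃗) (a ∷ K) = zipWith _+_ (Vec.map (c *_) (Vec.map embed a)) (combine c⃗ K)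

  -- The coordinates of a combination of the rows are the values of `dot c` on the columns, so
  -- uniformity can be shown one column at a time.
  combine-∷ : ∀ {k m} (c : Vec Carrier k) (a : Vec H.Carrier k) (K : Vec (Vec H.Carrier m) k) →
              combine c (zipWith _∷_ a K) ≡ dot c a ∷ combine c K
  combine-∷ []      []      []      = refl
  combine-∷ (c ∷ c⃗) (a ∷ a⃗) (k ∷ K) = cong (zipWith _+_ _) (combine-∷ c⃗ a⃗ K)

  matrices : ∀ k m → Finite (Vec (Vec H.Carrier m) k)
  matrices k m = Vec-finite (H.points m) k

  -- The m columns of K vary independently, and for a good `c` each of them takes every value of F
  -- exactly `fibre c 0#` times under `dot c`.
  ∑-combine-good : ∀ {k} (c : Vec Carrier k) → ¬ Bad c → ∀ m (b : Vec Carrier m → ℕ) →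
    ∑[ K ∈ matrices k m ] b (combine c K) ≡ fibre c 0# ℕ.^ m ℕ.* ∑ (points m) b
  ∑-combine-good {k} c good zero b = begin
    (∑[ K ∈ matrices k 0 ] b (combine c K))     ≡⟨ ∑-cong (matrices k 0) (λ K → cong b (empty (combine c K))) ⟩
    (∑[ K ∈ matrices k 0 ] b [])                ≡⟨ ∑-const (matrices k 0) _ ⟩
    card (matrices k 0) ℕ.* b []                ≡⟨ cong (ℕ._* b []) (trans (card-Vec (H.points 0) k) (ℕₚ.^-zeroˡ k)) ⟩
    1 ℕ.* b []                                  ≡⟨ cong (1 ℕ.*_) (∑-[] finite b) ⟨
    1 ℕ.* ∑ (points 0) b                        ∎
    where
    open ≡-Reasoning
    empty : (v : Vec Carrier 0) → v ≡ []
    empty [] = refl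
  ∑-combine-good {k} c good (suc m) b = begin
    (∑[ K ∈ matrices k (suc m) ] b (combine c K))
      ≡⟨ ∑-zipWith H.finite (H.points m) (H.points (suc m)) _∷_ (∑-∷ H.finite m) k _ ⟩
    (∑[ a ∈ H.points k ] ∑[ K ∈ matrices k m ] b (combine c (zipWith _∷_ a K)))
      ≡⟨ ∑-cong (H.points k) (λ a → ∑-cong (matrices k m) (λ K → cong b (combine-∷ c a K))) ⟩
    (∑[ a ∈ H.points k ] ∑[ K ∈ matrices k m ] b (dot c a ∷ combine c K))
      ≡⟨ ∑-cong (H.points k) (λ a → ∑-combine-good c good m (λ y → b (dot c a ∷ y))) ⟩
    (∑[ a ∈ H.points k ] κ ℕ.^ m ℕ.* (∑[ y ∈ points m ] b (dot c a ∷ y)))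
      ≡⟨ ∑-* (H.points k) (κ ℕ.^ m) _ ⟩
    κ ℕ.^ m ℕ.* (∑[ a ∈ H.points k ] ∑[ y ∈ points m ] b (dot c a ∷ y))
      ≡⟨ cong (κ ℕ.^ m ℕ.*_) (∑-good c good (λ x → ∑[ y ∈ points m ] b (x ∷ y))) ⟩
    κ ℕ.^ m ℕ.* (κ ℕ.* (∑[ x ∈ finite ] ∑[ y ∈ points m ] b (x ∷ y)))
      ≡⟨ cong (λ z → κ ℕ.^ m ℕ.* (κ ℕ.* z)) (∑-∷ finite m b) ⟨
    κ ℕ.^ m ℕ.* (κ ℕ.* ∑ (points (suc m)) b)
      ≡⟨ rearrange κ (κ ℕ.^ m) _ ⟩
    κ ℕ.^ suc m ℕ.* ∑ (points (suc m)) b ∎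
    where
    open ≡-Reasoning
    κ = fibre c 0#
    rearrange : ∀ a b c → b ℕ.* (a ℕ.* c) ≡ a ℕ.* b ℕ.* c
    rearrange = ℕSolver.solve-∀

  -- A good tuple of coefficients makes the combination exactly uniform; the bad ones are rare.
  ∑-combine : ∀ k m (b : Vec Carrier m → ℕ) → (∀ y → b y ℕ.≤ 1) →
    q ℕ.^ m ℕ.* (∑[ c ∈ points k ] ∑[ K ∈ matrices k m ] b (combine c K)) ℕ.≤
    (h ℕ.^ k) ℕ.^ m ℕ.* (q ℕ.^ k ℕ.* ∑ (points m) b ℕ.+ bads k ℕ.* q ℕ.^ m)
  ∑-combine k m b b≤1 = begin
    q ℕ.^ m ℕ.* (∑[ c ∈ points k ] ∑[ K ∈ matrices k m ] b (combine c K))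
      ≡⟨ ∑-* (points k) (q ℕ.^ m) _ ⟨
    (∑[ c ∈ points k ] q ℕ.^ m ℕ.* (∑[ K ∈ matrices k m ] b (combine c K)))
      ≤⟨ ∑-mono (points k) pointwise ⟩
    (∑[ c ∈ points k ] (h ℕ.^ k) ℕ.^ m ℕ.* (∑ (points m) b ℕ.+ 𝟙 (Bad? c) ℕ.* q ℕ.^ m))
      ≡⟨ ∑-* (points k) ((h ℕ.^ k) ℕ.^ m) _ ⟩
    (h ℕ.^ k) ℕ.^ m ℕ.* (∑[ c ∈ points k ] (∑ (points m) b ℕ.+ 𝟙 (Bad? c) ℕ.* q ℕ.^ m))
      ≡⟨ cong ((h ℕ.^ k) ℕ.^ m ℕ.*_) (trans (∑-+ (points k) _ _) (cong₂ ℕ._+_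
           (trans (∑-const (points k) _) (cong (ℕ._* ∑ (points m) b) (card-Vec finite k)))
           (∑-*ʳ (points k) (q ℕ.^ m) _))) ⟩
    (h ℕ.^ k) ℕ.^ m ℕ.* (q ℕ.^ k ℕ.* ∑ (points m) b ℕ.+ bads k ℕ.* q ℕ.^ m) ∎
    where
    open ℕₚ.≤-Reasoning
    rearrange : ∀ a b c → a ℕ.* (b ℕ.* c) ≡ (a ℕ.* b) ℕ.* c
    rearrange = ℕSolver.solve-∀
    pointwise : ∀ c → q ℕ.^ m ℕ.* (∑[ K ∈ matrices k m ] b (combine c K)) ℕ.≤
                      (h ℕ.^ k) ℕ.^ m ℕ.* (∑ (points m) b ℕ.+ 𝟙 (Bad? c) ℕ.* q ℕ.^ m)
    pointwise c with Bad? c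
    ... | no good = ℕₚ.≤-reflexive (begin-equality
      q ℕ.^ m ℕ.* (∑[ K ∈ matrices k m ] b (combine c K))
        ≡⟨ cong (q ℕ.^ m ℕ.*_) (∑-combine-good c good m b) ⟩
      q ℕ.^ m ℕ.* (fibre c 0# ℕ.^ m ℕ.* ∑ (points m) b)
        ≡⟨ ℕₚ.*-assoc (q ℕ.^ m) _ _ ⟨
      q ℕ.^ m ℕ.* fibre c 0# ℕ.^ m ℕ.* ∑ (points m) b
        ≡⟨ cong (ℕ._* ∑ (points m) b) (trans (sym (^-distribʳ-* m q (fibre c 0#))) (cong (ℕ._^ m) (kernel-good c good))) ⟩
      (h ℕ.^ k) ℕ.^ m ℕ.* ∑ (points m) b
        ≡⟨ cong ((h ℕ.^ k) ℕ.^ m ℕ.*_) (ℕₚ.+-identityʳ _) ⟨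
      (h ℕ.^ k) ℕ.^ m ℕ.* (∑ (points m) b ℕ.+ 0) ∎)
    -- For a bad tuple nothing is known about the combination, so all of its matrices are charged.
    ... | yes _ = begin
      q ℕ.^ m ℕ.* (∑[ K ∈ matrices k m ] b (combine c K))
        ≤⟨ ℕₚ.*-monoʳ-≤ (q ℕ.^ m) (∑-mono (matrices k m) (λ K → b≤1 (combine c K))) ⟩
      q ℕ.^ m ℕ.* (∑[ K ∈ matrices k m ] 1)
        ≡⟨ cong (q ℕ.^ m ℕ.*_) size ⟩
      q ℕ.^ m ℕ.* (h ℕ.^ k) ℕ.^ m
        ≡⟨ trans (ℕₚ.*-comm (q ℕ.^ m) _) (cong ((h ℕ.^ k) ℕ.^ m ℕ.*_) (sym (ℕₚ.*-identityˡ (q ℕ.^ m)))) ⟩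
      (h ℕ.^ k) ℕ.^ m ℕ.* (1 ℕ.* q ℕ.^ m)
        ≤⟨ ℕₚ.*-monoʳ-≤ ((h ℕ.^ k) ℕ.^ m) (ℕₚ.m≤n+m _ (∑ (points m) b)) ⟩
      (h ℕ.^ k) ℕ.^ m ℕ.* (∑ (points m) b ℕ.+ 1 ℕ.* q ℕ.^ m) ∎
      where
      size : (∑[ K ∈ matrices k m ] 1) ≡ (h ℕ.^ k) ℕ.^ m
      size = begin-equality
        (∑[ K ∈ matrices k m ] 1)   ≡⟨ card≡∑1 (matrices k m) ⟨
        card (matrices k m)         ≡⟨ card-Vec (H.points m) k ⟩
        card (H.points m) ℕ.^ k     ≡⟨ cong (ℕ._^ k) (card-Vec H.finite m) ⟩
        (h ℕ.^ m) ℕ.^ k             ≡⟨ ℕₚ.^-*-assoc h m k ⟩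
        h ℕ.^ (m ℕ.* k)             ≡⟨ cong (h ℕ.^_) (ℕₚ.*-comm m k) ⟩
        h ℕ.^ (k ℕ.* m)             ≡⟨ ℕₚ.^-*-assoc h k m ⟨
        (h ℕ.^ k) ℕ.^ m             ∎

-- The random walk

∑-pairs : {A : Set} (fin : Finite A) (g : Vec A 2 → ℕ) →
          ∑ (Vec-finite fin 2) g ≡ ∑[ y ∈ fin ] ∑[ z ∈ fin ] g (y ∷ z ∷ [])
∑-pairs fin g = trans (∑-∷ fin 1 g) (∑-cong fin (λ y → trans (∑-∷ fin 0 _) (∑-cong fin (λ z → ∑-[] fin _))))

module VectorAlgebra (F : FiniteField) where
  open FiniteField F
  open FieldProperties F

  private
    _⊕_ : ∀ {n} → Vec Carrier n → Vec Carrier n → Vec Carrier n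
    _⊕_ = zipWith _+_
    _⊙_ : ∀ {n} → Carrier → Vec Carrier n → Vec Carrier n
    t ⊙ v = Vec.map (t *_) v
    infixl 6 _⊕_
    infixl 7 _⊙_

  ⊕-assoc : ∀ {n} (x y z : Vec Carrier n) → x ⊕ y ⊕ z ≡ x ⊕ (y ⊕ z)
  ⊕-assoc []      []      []      = refl
  ⊕-assoc (x ∷ xs) (y ∷ ys) (z ∷ zs) = cong₂ _∷_ (R.+-assoc x y z) (⊕-assoc xs ys zs)

  ⊕-0 : ∀ {n} (x : Vec Carrier n) → x ⊕ replicate n 0# ≡ x
  ⊕-0 []       = refl
  ⊕-0 (x ∷ xs) = cong₂ _∷_ (R.+-identityʳ x) (⊕-0 xs)

  ⊕-0⊙ : ∀ {n} (x k : Vec Carrier n) → x ⊕ 0# ⊙ k ≡ x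
  ⊕-0⊙ []       []       = refl
  ⊕-0⊙ (x ∷ xs) (k ∷ ks) = cong₂ _∷_ (trans (cong (x +_) (R.zeroˡ k)) (R.+-identityʳ x)) (⊕-0⊙ xs ks)

  -- Substituting the new base point and direction shows that the parameter u moves along the line
  -- (s + u t , s′ + u t′) of the old plane, while v moves along the fresh direction `k`.
  ⊕-step : ∀ {n} (x h h′ k : Vec Carrier n) s s′ t t′ u v →
    x ⊕ s ⊙ h ⊕ s′ ⊙ h′ ⊕ u ⊙ (t ⊙ h ⊕ t′ ⊙ h′) ⊕ v ⊙ k ≡
    x ⊕ (s + u * t) ⊙ h ⊕ (s′ + u * t′) ⊙ h′ ⊕ v ⊙ k
  ⊕-step []       []       []         []       s s′ t t′ u v = refl
  ⊕-step (x ∷ xs) (h ∷ hs) (h′ ∷ hs′) (k ∷ ks) s s′ t t′ u v = cong₂ _∷_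
    (cong (_+ v * k) (solve 8 (λ x h h′ s s′ t t′ u →
      x :+ s :* h :+ s′ :* h′ :+ u :* (t :* h :+ t′ :* h′) :=
      x :+ (s :+ u :* t) :* h :+ (s′ :+ u :* t′) :* h′) refl x h h′ s s′ t t′ u))
    (⊕-step xs hs hs′ ks s s′ t t′ u v)

  ⊕-cancel : ∀ {n} (a x : Vec Carrier n) → a ⊕ (Vec.map (-_) a ⊕ x) ≡ x
  ⊕-cancel []       []       = refl
  ⊕-cancel (a ∷ as) (x ∷ xs) = cong₂ _∷_
    (trans (sym (R.+-assoc a (- a) x)) (trans (cong (_+ x) (R.-‿inverseʳ a)) (R.+-identityˡ x))) (⊕-cancel as xs)

  ⊕-cancel′ : ∀ {n} (a x : Vec Carrier n) → Vec.map (-_) a ⊕ (a ⊕ x) ≡ x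
  ⊕-cancel′ []       []       = refl
  ⊕-cancel′ (a ∷ as) (x ∷ xs) = cong₂ _∷_
    (trans (sym (R.+-assoc (- a) a x)) (trans (cong (_+ x) (R.-‿inverseˡ a)) (R.+-identityˡ x))) (⊕-cancel′ as xs)

  ∑-⊕ : ∀ {n} a (g : Vec Carrier n → ℕ) → ∑[ x ∈ points n ] g (a ⊕ x) ≡ ∑ (points n) g
  ∑-⊕ {n} a = ∑-reindex (points n) (a ⊕_) (Vec.map (-_) a ⊕_) (⊕-cancel a) (⊕-cancel′ a)

module WalkSums {H F : FiniteField} (E : Extension H F) (m : ℕ) where
  open FiniteField F
  open FieldProperties F
  open AffineSums F
  open VectorAlgebra F
  open Extension E using (embed; HasDegree)
  open RandomCombinations E
  open Walk E m
  private
    module H = FiniteField H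
    q = order
    h = H.order
    Hᵐ = H.points m

  rounds : Finite Round
  rounds = ×-finite finite (×-finite finite (×-finite finite (×-finite finite Hᵐ)))

  card-rounds : card rounds ≡ q ℕ.* (q ℕ.* (q ℕ.* (q ℕ.* h ℕ.^ m)))
  card-rounds =
    trans (card-× finite (×-finite finite (×-finite finite (×-finite finite Hᵐ)))) (cong (q ℕ.*_)
    (trans (card-× finite (×-finite finite (×-finite finite Hᵐ))) (cong (q ℕ.*_)
    (trans (card-× finite (×-finite finite Hᵐ)) (cong (q ℕ.*_)
    (trans (card-× finite Hᵐ) (cong (q ℕ.*_) (card-Vec H.finite m))))))))

  ∑-rounds : (g : Round → ℕ) →
    ∑ rounds g ≡ ∑[ (s , s′ , t , t′) ∈ quads ] ∑[ k ∈ Hᵐ ] g (s , s′ , t , t′ , k)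
  ∑-rounds g = begin
    ∑ rounds g
      ≡⟨ ∑-× finite _ g ⟩
    (∑[ s ∈ finite ] ∑[ r ∈ ×-finite finite (×-finite finite (×-finite finite Hᵐ)) ] g (s , r))
      ≡⟨ ∑-cong finite (λ s → trans (∑-× finite _ _) (∑-cong finite (λ s′ → trans (∑-× finite _ _)
           (∑-cong finite (λ t → ∑-× finite Hᵐ _))))) ⟩
    (∑[ s ∈ finite ] ∑[ s′ ∈ finite ] ∑[ t ∈ finite ] ∑[ t′ ∈ finite ] ∑[ k ∈ Hᵐ ] g (s , s′ , t , t′ , k))
      ≡⟨ ∑-cong finite (λ s → ∑-swap finite finite _) ⟩
    (∑[ s ∈ finite ] ∑[ t ∈ finite ] ∑[ s′ ∈ finite ] ∑[ t′ ∈ finite ] ∑[ k ∈ Hᵐ ] g (s , s′ , t , t′ , k))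
      ≡⟨ ∑-quads (λ s s′ t t′ → ∑[ k ∈ Hᵐ ] g (s , s′ , t , t′ , k)) ⟨
    (∑[ (s , s′ , t , t′) ∈ quads ] ∑[ k ∈ Hᵐ ] g (s , s′ , t , t′ , k)) ∎
    where open ≡-Reasoning

  offset : Carrier × Vec H.Carrier m → Vec Carrier m
  offset (v , k) = v ·ᵛ Vec.map embed k

  point-step : ∀ P s s′ t t′ k u v →
    point (step P (s , s′ , t , t′ , k)) (u ∷ v ∷ []) ≡
    point P ((s + u * t) ∷ (s′ + u * t′) ∷ []) +ᵛ offset (v , k)
  point-step (x , h , h′) s s′ t t′ k u v = ⊕-step x h h′ (Vec.map embed k) s s′ t t′ u v

  lastPlane : ∀ {n} → Plane → Vec Round n → Plane
  lastPlane P []       = P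
  lastPlane P (r ∷ rs) = lastPlane (step P r) rs

  planeSum lineSum : (Vec Carrier m → ℕ) → Plane → ℕ
  planeSum b P = ∑[ w ∈ points 2 ] b (point P w)
  lineSum b P  = ∑[ u ∈ finite ] b (point P (u ∷ 0# ∷ []))

  planeSum-pairs : ∀ b P → planeSum b P ≡ ∑[ y ∈ finite ] ∑[ z ∈ finite ] b (point P (y ∷ z ∷ []))
  planeSum-pairs b P = ∑-pairs finite _

  -- At v = 0 the fresh direction drops out: the tested line lies inside the preceding plane, with
  -- (s , s′ , t , t′) as its encoding there.
  lineSum-step : ∀ b P s s′ t t′ k →
    lineSum b (step P (s , s′ , t , t′ , k)) ≡ markedOn (λ y z → b (point P (y ∷ z ∷ []))) (s , s′ , t , t′)
  lineSum-step b P s s′ t t′ k = ∑-cong finite (λ u →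
    cong b (trans (point-step P s s′ t t′ k u 0#) (⊕-0⊙ _ (Vec.map embed k))))

  offsets : Finite (Carrier × Vec H.Carrier m)
  offsets = ×-finite finite Hᵐ

  -- A uniform point of the next plane is a uniform point of the current one, displaced by a
  -- uniform multiple of the fresh direction.
  ∑-planeSum-step : ∀ b P → ∑[ r ∈ rounds ] planeSum b (step P r) ≡
    q ℕ.* (q ℕ.* (q ℕ.* (∑[ o ∈ offsets ] planeSum (λ y → b (y +ᵛ offset o)) P)))
  ∑-planeSum-step b P = begin
    (∑[ r ∈ rounds ] planeSum b (step P r))
      ≡⟨ ∑-rounds _ ⟩
    (∑[ (s , s′ , t , t′) ∈ quads ] ∑[ k ∈ Hᵐ ] planeSum b (step P (s , s′ , t , t′ , k)))
      ≡⟨ ∑-cong quads (λ (s , s′ , t , t′) → trans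
           (∑-cong Hᵐ (λ k → trans (planeSum-pairs b _) (∑-cong finite (λ u → ∑-cong finite (λ v →
             cong b (point-step P s s′ t t′ k u v))))))
           (∑-swap Hᵐ finite _)) ⟩
    -- Summing over u is summing along a random line of the old plane. The first-moment formula
    -- needs no 0-1 values, so the weight Ψ may absorb the displacement by v and `k`.
    (∑[ r ∈ quads ] markedOn Ψ r)
      ≡⟨ ∑-markedOn Ψ ⟩
    q ℕ.* (q ℕ.* (q ℕ.* (∑[ y ∈ finite ] ∑[ z ∈ finite ] Ψ y z)))
      ≡⟨ cong (λ S → q ℕ.* (q ℕ.* (q ℕ.* S))) collect ⟨
    q ℕ.* (q ℕ.* (q ℕ.* (∑[ o ∈ offsets ] planeSum (λ y → b (y +ᵛ offset o)) P))) ∎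
    where
    open ≡-Reasoning
    Ψ : Carrier → Carrier → ℕ
    Ψ y z = ∑[ k ∈ Hᵐ ] ∑[ v ∈ finite ] b (point P (y ∷ z ∷ []) +ᵛ offset (v , k))
    collect : (∑[ o ∈ offsets ] planeSum (λ y → b (y +ᵛ offset o)) P) ≡ ∑[ y ∈ finite ] ∑[ z ∈ finite ] Ψ y z
    collect = begin
      (∑[ o ∈ offsets ] planeSum (λ y → b (y +ᵛ offset o)) P)
        ≡⟨ ∑-cong offsets (λ o → planeSum-pairs (λ y → b (y +ᵛ offset o)) P) ⟩
      (∑[ o ∈ offsets ] ∑[ y ∈ finite ] ∑[ z ∈ finite ] b (point P (y ∷ z ∷ []) +ᵛ offset o))
        ≡⟨ ∑-swap offsets finite _ ⟩
      (∑[ y ∈ finite ] ∑[ o ∈ offsets ] ∑[ z ∈ finite ] b (point P (y ∷ z ∷ []) +ᵛ offset o))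
        ≡⟨ ∑-cong finite (λ y → ∑-swap offsets finite _) ⟩
      (∑[ y ∈ finite ] ∑[ z ∈ finite ] ∑[ o ∈ offsets ] b (point P (y ∷ z ∷ []) +ᵛ offset o))
        ≡⟨ ∑-cong finite (λ y → ∑-cong finite (λ z → trans (∑-× finite Hᵐ _) (∑-swap finite Hᵐ _))) ⟩
      (∑[ y ∈ finite ] ∑[ z ∈ finite ] Ψ y z) ∎

  total : ∀ {n} → Vec (Carrier × Vec H.Carrier m) n → Vec Carrier m
  total []      = replicate m 0#
  total (o ∷ L) = offset o +ᵛ total L

  -- Iteration of the one-step identity: the displacements accumulate in `total` and are absorbed
  -- into the function being summed. The factor q³ per round compares its four scalars from F with
  -- the single one kept in an offset.
  ∑-planeSum-walk : ∀ n b P → ∑[ rs ∈ Vec-finite rounds n ] planeSum b (lastPlane P rs) ≡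
    (q ℕ.* (q ℕ.* q)) ℕ.^ n ℕ.* (∑[ L ∈ Vec-finite offsets n ] planeSum (λ y → b (y +ᵛ total L)) P)
  ∑-planeSum-walk zero b P = begin
    (∑[ rs ∈ Vec-finite rounds 0 ] planeSum b (lastPlane P rs))
      ≡⟨ ∑-[] rounds _ ⟩
    planeSum b P
      ≡⟨ ∑-cong (points 2) (λ w → cong b (⊕-0 (point P w))) ⟨
    planeSum (λ y → b (y +ᵛ replicate m 0#)) P
      ≡⟨ trans (ℕₚ.*-identityˡ _) (∑-[] offsets _) ⟨
    1 ℕ.* (∑[ L ∈ Vec-finite offsets 0 ] planeSum (λ y → b (y +ᵛ total L)) P) ∎
    where open ≡-Reasoning
  ∑-planeSum-walk (suc n) b P = begin
    (∑[ rs ∈ Vec-finite rounds (suc n) ] planeSum b (lastPlane P rs))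
      ≡⟨ ∑-∷ rounds n _ ⟩
    (∑[ r ∈ rounds ] ∑[ rs ∈ Vec-finite rounds n ] planeSum b (lastPlane (step P r) rs))
      ≡⟨ ∑-cong rounds (λ r → ∑-planeSum-walk n b (step P r)) ⟩
    (∑[ r ∈ rounds ] q³ ℕ.^ n ℕ.* (∑[ L ∈ Vec-finite offsets n ] planeSum (b/ L) (step P r)))
      ≡⟨ trans (∑-* rounds (q³ ℕ.^ n) _) (cong (q³ ℕ.^ n ℕ.*_) (∑-swap rounds (Vec-finite offsets n) _)) ⟩
    q³ ℕ.^ n ℕ.* (∑[ L ∈ Vec-finite offsets n ] ∑[ r ∈ rounds ] planeSum (b/ L) (step P r))
      ≡⟨ cong (q³ ℕ.^ n ℕ.*_) (∑-cong (Vec-finite offsets n) (λ L → trans (∑-planeSum-step (b/ L) P) (rearrange₁ q _))) ⟩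
    q³ ℕ.^ n ℕ.* (∑[ L ∈ Vec-finite offsets n ] q³ ℕ.* (∑[ o ∈ offsets ] planeSum (λ y → b/ L (y +ᵛ offset o)) P))
      ≡⟨ cong (q³ ℕ.^ n ℕ.*_) (trans (∑-* (Vec-finite offsets n) q³ _) (cong (q³ ℕ.*_) (∑-swap (Vec-finite offsets n) offsets _))) ⟩
    q³ ℕ.^ n ℕ.* (q³ ℕ.* (∑[ o ∈ offsets ] ∑[ L ∈ Vec-finite offsets n ] planeSum (λ y → b/ L (y +ᵛ offset o)) P))
      ≡⟨ rearrange₂ q³ (q³ ℕ.^ n) _ ⟩
    q³ ℕ.^ suc n ℕ.* (∑[ o ∈ offsets ] ∑[ L ∈ Vec-finite offsets n ] planeSum (λ y → b/ L (y +ᵛ offset o)) P)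
      ≡⟨ cong (q³ ℕ.^ suc n ℕ.*_) (∑-cong offsets (λ o → ∑-cong (Vec-finite offsets n) (λ L →
           ∑-cong (points 2) (λ w → cong b (⊕-assoc (point P w) (offset o) (total L)))))) ⟩
    q³ ℕ.^ suc n ℕ.* (∑[ o ∈ offsets ] ∑[ L ∈ Vec-finite offsets n ] planeSum (λ y → b (y +ᵛ total (o ∷ L))) P)
      ≡⟨ cong (q³ ℕ.^ suc n ℕ.*_) (∑-∷ offsets n _) ⟨
    q³ ℕ.^ suc n ℕ.* (∑[ L ∈ Vec-finite offsets (suc n) ] planeSum (λ y → b (y +ᵛ total L)) P) ∎
    where
    open ≡-Reasoning
    q³ = q ℕ.* (q ℕ.* q)
    b/ : Vec (Carrier × Vec H.Carrier m) n → Vec Carrier m → ℕ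
    b/ L y = b (y +ᵛ total L)
    rearrange₁ : ∀ q S → q ℕ.* (q ℕ.* (q ℕ.* S)) ≡ q ℕ.* (q ℕ.* q) ℕ.* S
    rearrange₁ = ℕSolver.solve-∀
    rearrange₂ : ∀ a b c → b ℕ.* (a ℕ.* c) ≡ a ℕ.* b ℕ.* c
    rearrange₂ = ℕSolver.solve-∀

  startPlane : Vec Carrier m → Vec H.Carrier m × Vec H.Carrier m → Plane
  startPlane x (h₀ , h₀′) = x , Vec.map embed h₀ , Vec.map embed h₀′

  total-combine : ∀ {n} (c : Vec Carrier n) K → total (zipWith _,_ c K) ≡ combine c K
  total-combine []      []      = refl
  total-combine (c ∷ c⃗) (k ∷ K) = cong (_ +ᵛ_) (total-combine c⃗ K)

  -- The two parameters of a point of the starting plane, paired with h₀ and h₀′, are two more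
  -- offsets; together with those of the m rounds they make 2 + m pairs of a coefficient and a
  -- direction.
  ∑-planeSum-outcomes : ∀ b x → ∑[ (h₀ , rs) ∈ outcomes ] planeSum b (lastPlane (startPlane x h₀) rs) ≡
    (q ℕ.* (q ℕ.* q)) ℕ.^ m ℕ.*
    (∑[ c ∈ points (2 ℕ.+ m) ] ∑[ K ∈ matrices (2 ℕ.+ m) m ] b (x +ᵛ combine c K))
  ∑-planeSum-outcomes b x = begin
    (∑[ (h₀ , rs) ∈ outcomes ] planeSum b (lastPlane (startPlane x h₀) rs))
      ≡⟨ ∑-× (×-finite Hᵐ Hᵐ) (Vec-finite rounds m) _ ⟩
    (∑[ h₀ ∈ ×-finite Hᵐ Hᵐ ] ∑[ rs ∈ Vec-finite rounds m ] planeSum b (lastPlane (startPlane x h₀) rs))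
      ≡⟨ trans (∑-cong (×-finite Hᵐ Hᵐ) (λ h₀ → ∑-planeSum-walk m b (startPlane x h₀))) (∑-* (×-finite Hᵐ Hᵐ) (q³ ℕ.^ m) _) ⟩
    q³ ℕ.^ m ℕ.* (∑[ h₀ ∈ ×-finite Hᵐ Hᵐ ] ∑[ L ∈ Vec-finite offsets m ] planeSum (λ y → b (y +ᵛ total L)) (startPlane x h₀))
      ≡⟨ cong (q³ ℕ.^ m ℕ.*_) reorder ⟩
    q³ ℕ.^ m ℕ.* (∑[ L ∈ Vec-finite offsets (2 ℕ.+ m) ] b (x +ᵛ total L))
      ≡⟨ cong (q³ ℕ.^ m ℕ.*_) (∑-zipWith finite Hᵐ offsets _,_ (∑-× finite Hᵐ) (2 ℕ.+ m) _) ⟩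
    q³ ℕ.^ m ℕ.* (∑[ c ∈ points (2 ℕ.+ m) ] ∑[ K ∈ matrices (2 ℕ.+ m) m ] b (x +ᵛ total (zipWith _,_ c K)))
      ≡⟨ cong (q³ ℕ.^ m ℕ.*_) (∑-cong (points (2 ℕ.+ m)) (λ c → ∑-cong (matrices (2 ℕ.+ m) m) (λ K →
           cong (λ y → b (x +ᵛ y)) (total-combine c K)))) ⟩
    q³ ℕ.^ m ℕ.* (∑[ c ∈ points (2 ℕ.+ m) ] ∑[ K ∈ matrices (2 ℕ.+ m) m ] b (x +ᵛ combine c K)) ∎
    where
    open ≡-Reasoning
    q³ = q ℕ.* (q ℕ.* q)
    term : Vec (Carrier × Vec H.Carrier m) m → Vec H.Carrier m → Vec H.Carrier m → Carrier → Carrier → ℕ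
    term L h₀ h₀′ u v = b (x +ᵛ offset (u , h₀) +ᵛ offset (v , h₀′) +ᵛ total L)
    reassociate : ∀ L h₀ h₀′ u v → term L h₀ h₀′ u v ≡ b (x +ᵛ total ((u , h₀) ∷ (v , h₀′) ∷ L))
    reassociate L h₀ h₀′ u v = cong b (trans (⊕-assoc _ _ _) (⊕-assoc _ _ _))
    reorder : (∑[ h₀ ∈ ×-finite Hᵐ Hᵐ ] ∑[ L ∈ Vec-finite offsets m ] planeSum (λ y → b (y +ᵛ total L)) (startPlane x h₀)) ≡
              ∑[ L ∈ Vec-finite offsets (2 ℕ.+ m) ] b (x +ᵛ total L)
    reorder = begin
      (∑[ h₀ ∈ ×-finite Hᵐ Hᵐ ] ∑[ L ∈ Vec-finite offsets m ] planeSum (λ y → b (y +ᵛ total L)) (startPlane x h₀))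
        ≡⟨ ∑-× Hᵐ Hᵐ _ ⟩
      (∑[ h₀ ∈ Hᵐ ] ∑[ h₀′ ∈ Hᵐ ] ∑[ L ∈ Vec-finite offsets m ] planeSum (λ y → b (y +ᵛ total L)) (startPlane x (h₀ , h₀′)))
        ≡⟨ ∑-cong Hᵐ (λ h₀ → ∑-cong Hᵐ (λ h₀′ → ∑-cong (Vec-finite offsets m) (λ L → planeSum-pairs (λ y → b (y +ᵛ total L)) (startPlane x (h₀ , h₀′))))) ⟩
      (∑[ h₀ ∈ Hᵐ ] ∑[ h₀′ ∈ Hᵐ ] ∑[ L ∈ Vec-finite offsets m ] ∑[ u ∈ finite ] ∑[ v ∈ finite ] term L h₀ h₀′ u v)
        ≡⟨ ∑-cong Hᵐ (λ h₀ → trans (∑-cong Hᵐ (λ h₀′ → ∑-swap (Vec-finite offsets m) finite _)) (∑-swap Hᵐ finite _)) ⟩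
      (∑[ h₀ ∈ Hᵐ ] ∑[ u ∈ finite ] ∑[ h₀′ ∈ Hᵐ ] ∑[ L ∈ Vec-finite offsets m ] ∑[ v ∈ finite ] term L h₀ h₀′ u v)
        ≡⟨ ∑-cong Hᵐ (λ h₀ → ∑-cong finite (λ u → trans (∑-cong Hᵐ (λ h₀′ → ∑-swap (Vec-finite offsets m) finite _)) (∑-swap Hᵐ finite _))) ⟩
      (∑[ h₀ ∈ Hᵐ ] ∑[ u ∈ finite ] ∑[ v ∈ finite ] ∑[ h₀′ ∈ Hᵐ ] ∑[ L ∈ Vec-finite offsets m ] term L h₀ h₀′ u v)
        ≡⟨ ∑-swap Hᵐ finite _ ⟩
      (∑[ u ∈ finite ] ∑[ h₀ ∈ Hᵐ ] ∑[ v ∈ finite ] ∑[ h₀′ ∈ Hᵐ ] ∑[ L ∈ Vec-finite offsets m ] term L h₀ h₀′ u v)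
        ≡⟨ ∑-cong finite (λ u → ∑-cong Hᵐ (λ h₀ → ∑-cong finite (λ v → ∑-cong Hᵐ (λ h₀′ →
             ∑-cong (Vec-finite offsets m) (λ L → reassociate L h₀ h₀′ u v))))) ⟩
      (∑[ u ∈ finite ] ∑[ h₀ ∈ Hᵐ ] ∑[ v ∈ finite ] ∑[ h₀′ ∈ Hᵐ ] ∑[ L ∈ Vec-finite offsets m ]
        b (x +ᵛ total ((u , h₀) ∷ (v , h₀′) ∷ L)))
        ≡⟨ trans (∑-× finite Hᵐ _) (∑-cong finite (λ u → ∑-cong Hᵐ (λ h₀ → ∑-× finite Hᵐ _))) ⟨
      (∑[ o ∈ offsets ] ∑[ o′ ∈ offsets ] ∑[ L ∈ Vec-finite offsets m ] b (x +ᵛ total (o ∷ o′ ∷ L)))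
        ≡⟨ trans (∑-∷ offsets (suc m) _) (∑-cong offsets (λ o → ∑-∷ offsets m _)) ⟨
      (∑[ L ∈ Vec-finite offsets (2 ℕ.+ m) ] b (x +ᵛ total L)) ∎

  card-outcomes : card outcomes ≡ h ℕ.^ m ℕ.* h ℕ.^ m ℕ.* card rounds ℕ.^ m
  card-outcomes = trans (card-× (×-finite Hᵐ Hᵐ) (Vec-finite rounds m)) (cong₂ ℕ._*_
    (trans (card-× Hᵐ Hᵐ) (cong₂ ℕ._*_ (card-Vec H.finite m) (card-Vec H.finite m))) (card-Vec rounds m))

  last-plane-nearly-uniform : HasDegree m → ∀ b → (∀ y → b y ℕ.≤ 1) → ∀ x →
    q ℕ.^ m ℕ.* (h ℕ.* h) ℕ.* (∑[ (h₀ , rs) ∈ outcomes ] planeSum b (lastPlane (startPlane x h₀) rs)) ℕ.≤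
    card outcomes ℕ.* (q ℕ.* q) ℕ.* (∑ (points m) b ℕ.* (h ℕ.* h) ℕ.+ q ℕ.^ m)
  -- With denominators cleared: the mean density of b on the last plane is at most its density in
  -- F^m plus 1/h². The bad tuples have density at most q/h^(m+2), and q ≤ h^m turns this into 1/h².
  last-plane-nearly-uniform degree b b≤1 x = begin
    q ℕ.^ m ℕ.* (h ℕ.* h) ℕ.* (∑[ (h₀ , rs) ∈ outcomes ] planeSum b (lastPlane (startPlane x h₀) rs))
      ≡⟨ cong (q ℕ.^ m ℕ.* (h ℕ.* h) ℕ.*_) (∑-planeSum-outcomes b x) ⟩
    q ℕ.^ m ℕ.* (h ℕ.* h) ℕ.* (q³ ℕ.^ m ℕ.* S)
      ≡⟨ rearrange₁ (q ℕ.^ m) (h ℕ.* h) (q³ ℕ.^ m) S ⟩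
    q³ ℕ.^ m ℕ.* (h ℕ.* h) ℕ.* (q ℕ.^ m ℕ.* S)
      ≤⟨ ℕₚ.*-monoʳ-≤ (q³ ℕ.^ m ℕ.* (h ℕ.* h)) (∑-combine k m (λ y → b (x +ᵛ y)) (λ y → b≤1 (x +ᵛ y))) ⟩
    q³ ℕ.^ m ℕ.* (h ℕ.* h) ℕ.* ((h ℕ.^ k) ℕ.^ m ℕ.* (q ℕ.^ k ℕ.* (∑[ y ∈ points m ] b (x +ᵛ y)) ℕ.+ bads k ℕ.* q ℕ.^ m))
      ≡⟨ cong (λ z → q³ ℕ.^ m ℕ.* (h ℕ.* h) ℕ.* ((h ℕ.^ k) ℕ.^ m ℕ.* (q ℕ.^ k ℕ.* z ℕ.+ bads k ℕ.* q ℕ.^ m))) (∑-⊕ x b) ⟩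
    q³ ℕ.^ m ℕ.* (h ℕ.* h) ℕ.* ((h ℕ.^ k) ℕ.^ m ℕ.* (q ℕ.^ k ℕ.* B ℕ.+ bads k ℕ.* q ℕ.^ m))
      ≡⟨ rearrange₂ (q³ ℕ.^ m) (h ℕ.* h) ((h ℕ.^ k) ℕ.^ m) (q ℕ.^ k) B (bads k) (q ℕ.^ m) ⟩
    q³ ℕ.^ m ℕ.* (h ℕ.^ k) ℕ.^ m ℕ.* (q ℕ.^ k ℕ.* (B ℕ.* (h ℕ.* h)) ℕ.+ bads k ℕ.* (h ℕ.* h) ℕ.* q ℕ.^ m)
      ≤⟨ ℕₚ.*-monoʳ-≤ (q³ ℕ.^ m ℕ.* (h ℕ.^ k) ℕ.^ m) (ℕₚ.+-monoʳ-≤ _ (ℕₚ.*-monoˡ-≤ (q ℕ.^ m) bads-small)) ⟩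
    q³ ℕ.^ m ℕ.* (h ℕ.^ k) ℕ.^ m ℕ.* (q ℕ.^ k ℕ.* (B ℕ.* (h ℕ.* h)) ℕ.+ q ℕ.^ k ℕ.* q ℕ.^ m)
      ≡⟨ cong₂ (λ y z → y ℕ.* z ℕ.* (q ℕ.^ k ℕ.* (B ℕ.* (h ℕ.* h)) ℕ.+ q ℕ.^ k ℕ.* q ℕ.^ m)) q³ᵐ hᵏᵐ ⟩
    a ℕ.* (a ℕ.* a) ℕ.* (e ℕ.* (e ℕ.* e ℕ.^ m)) ℕ.* (q ℕ.^ k ℕ.* (B ℕ.* (h ℕ.* h)) ℕ.+ q ℕ.^ k ℕ.* q ℕ.^ m)
      ≡⟨ rearrange₃ a e (e ℕ.^ m) q B (h ℕ.* h) ⟩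
    e ℕ.* e ℕ.* (a ℕ.* (a ℕ.* (a ℕ.* (a ℕ.* e ℕ.^ m)))) ℕ.* (q ℕ.* q) ℕ.* (B ℕ.* (h ℕ.* h) ℕ.+ a)
      ≡⟨ cong (λ z → z ℕ.* (q ℕ.* q) ℕ.* (B ℕ.* (h ℕ.* h) ℕ.+ a)) outcomes≡ ⟨
    card outcomes ℕ.* (q ℕ.* q) ℕ.* (B ℕ.* (h ℕ.* h) ℕ.+ q ℕ.^ m) ∎
    where
    open ℕₚ.≤-Reasoning
    k = 2 ℕ.+ m
    q³ = q ℕ.* (q ℕ.* q)
    a = q ℕ.^ m
    e = h ℕ.^ m
    B = ∑ (points m) b
    S = ∑[ c ∈ points k ] ∑[ K ∈ matrices k m ] b (x +ᵛ combine c K)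
    rearrange₁ : ∀ a h q S → a ℕ.* h ℕ.* (q ℕ.* S) ≡ q ℕ.* h ℕ.* (a ℕ.* S)
    rearrange₁ = ℕSolver.solve-∀
    rearrange₂ : ∀ q h e p B b a → q ℕ.* h ℕ.* (e ℕ.* (p ℕ.* B ℕ.+ b ℕ.* a)) ≡
                                   q ℕ.* e ℕ.* (p ℕ.* (B ℕ.* h) ℕ.+ b ℕ.* h ℕ.* a)
    rearrange₂ = ℕSolver.solve-∀
    rearrange₃ : ∀ a e f q B h →
      a ℕ.* (a ℕ.* a) ℕ.* (e ℕ.* (e ℕ.* f)) ℕ.* (q ℕ.* (q ℕ.* a) ℕ.* (B ℕ.* h) ℕ.+ q ℕ.* (q ℕ.* a) ℕ.* a) ≡
      e ℕ.* e ℕ.* (a ℕ.* (a ℕ.* (a ℕ.* (a ℕ.* f)))) ℕ.* (q ℕ.* q) ℕ.* (B ℕ.* h ℕ.+ a)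
    rearrange₃ = ℕSolver.solve-∀
    power : ∀ x y → (x ℕ.* y) ℕ.^ m ≡ x ℕ.^ m ℕ.* y ℕ.^ m
    power = ^-distribʳ-* m
    q³ᵐ : q³ ℕ.^ m ≡ a ℕ.* (a ℕ.* a)
    q³ᵐ = trans (power q _) (cong (a ℕ.*_) (power q q))
    hᵏᵐ : (h ℕ.^ k) ℕ.^ m ≡ e ℕ.* (e ℕ.* e ℕ.^ m)
    hᵏᵐ = trans (power h _) (cong (e ℕ.*_) (power h _))
    outcomes≡ : card outcomes ≡ e ℕ.* e ℕ.* (a ℕ.* (a ℕ.* (a ℕ.* (a ℕ.* e ℕ.^ m))))
    outcomes≡ = trans card-outcomes (cong (e ℕ.* e ℕ.*_) (trans (cong (ℕ._^ m) card-rounds)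
      (trans (power q _) (cong (a ℕ.*_) (trans (power q _) (cong (a ℕ.*_) (trans (power q _) (cong (a ℕ.*_) (power q e)))))))))
    e-nonZero : ℕ.NonZero e
    e-nonZero = ℕₚ.m^n≢0 h m {{card-nonZero H.finite}}
    bads-small : bads k ℕ.* (h ℕ.* h) ℕ.≤ q ℕ.^ k
    bads-small = ℕₚ.*-cancelʳ-≤ _ _ e {{e-nonZero}} (begin
      bads k ℕ.* (h ℕ.* h) ℕ.* e     ≡⟨ regroup (bads k) h e ⟩
      bads k ℕ.* h ℕ.^ k             ≤⟨ bads-bound k ⟩
      q ℕ.* q ℕ.^ k                  ≤⟨ ℕₚ.*-monoˡ-≤ (q ℕ.^ k) (order≤ degree) ⟩
      e ℕ.* q ℕ.^ k                  ≡⟨ ℕₚ.*-comm e _ ⟩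
      q ℕ.^ k ℕ.* e                  ∎)
      where
      regroup : ∀ b h e → b ℕ.* (h ℕ.* h) ℕ.* e ≡ b ℕ.* (h ℕ.* (h ℕ.* e))
      regroup = ℕSolver.solve-∀

  -- Walks on which every line is a faithful sample of its plane

  module LineSampling (b : Vec Carrier m → ℕ) (b-idem : ∀ y → b y ℕ.* b y ≡ b y) where

    -- As an implication it is vacuous when less than half of `P` is marked, so that its failure
    -- probability has a bound valid for every `P`.
    StepOk : Plane → Round → Set
    StepOk P r = q ℕ.* q ℕ.≤ 2 ℕ.* planeSum b P → q ℕ.≤ 4 ℕ.* lineSum b (step P r)

    StepOk? : ∀ P r → Dec (StepOk P r)
    StepOk? P r = (q ℕ.* q ℕₚ.≤? 2 ℕ.* planeSum b P) →-dec (q ℕₚ.≤? 4 ℕ.* lineSum b (step P r))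

    WalkOk : ∀ {n} → Plane → Vec Round n → Set
    WalkOk P []       = ⊤
    WalkOk P (r ∷ rs) = StepOk P r × WalkOk (step P r) rs

    WalkOk? : ∀ {n} P (rs : Vec Round n) → Dec (WalkOk P rs)
    WalkOk? P []       = yes tt
    WalkOk? P (r ∷ rs) = StepOk? P r ×-dec WalkOk? (step P r) rs

    -- A failing step means that half of the plane is marked but less than a quarter of the line,
    -- the situation of `light-lines`. The line does not depend on the fresh direction, so summing
    -- over `k` multiplies the count by h^m.
    bad-steps : ∀ P → (∑[ r ∈ rounds ] 𝟙 (¬? (StepOk? P r))) ℕ.* q ℕ.≤ 4 ℕ.* card rounds
    bad-steps P = go (q ℕ.* q ℕₚ.≤? 2 ℕ.* planeSum b P)
      where
      open ℕₚ.≤-Reasoning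
      β : Carrier → Carrier → ℕ
      β y z = b (point P (y ∷ z ∷ []))
      open Chebyshev β (λ y z → b-idem (point P (y ∷ z ∷ [])))
      light : Quad → ℕ
      light r = 𝟙 (4 ℕ.* markedOn β r ℕₚ.<? q)
      go : Dec (q ℕ.* q ℕ.≤ 2 ℕ.* planeSum b P) →
           (∑[ r ∈ rounds ] 𝟙 (¬? (StepOk? P r))) ℕ.* q ℕ.≤ 4 ℕ.* card rounds
      go (no ¬heavy) = begin
        (∑[ r ∈ rounds ] 𝟙 (¬? (StepOk? P r))) ℕ.* q
          ≡⟨ cong (ℕ._* q) (trans (∑-cong rounds (λ r → 𝟙-false (λ ¬ok → ¬ok (λ heavy → contradiction heavy ¬heavy)) (¬? (StepOk? P r))))
                                  (trans (∑-const rounds 0) (ℕₚ.*-zeroʳ (card rounds)))) ⟩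
        0
          ≤⟨ z≤n ⟩
        4 ℕ.* card rounds ∎
      go (yes heavy) = begin
        (∑[ r ∈ rounds ] 𝟙 (¬? (StepOk? P r))) ℕ.* q
          ≡⟨ cong (ℕ._* q) (∑-rounds _) ⟩
        (∑[ (s , s′ , t , t′) ∈ quads ] ∑[ k ∈ Hᵐ ] 𝟙 (¬? (StepOk? P (s , s′ , t , t′ , k)))) ℕ.* q
          ≤⟨ ℕₚ.*-monoˡ-≤ q (∑-mono quads (λ (s , s′ , t , t′) → ∑-mono Hᵐ (λ k →
               𝟙-mono (λ ¬ok → ℕₚ.≰⇒> (λ q≤ → ¬ok (λ _ → subst (λ z → q ℕ.≤ 4 ℕ.* z) (sym (lineSum-step b P s s′ t t′ k)) q≤))) _ _))) ⟩
        (∑[ r ∈ quads ] ∑[ k ∈ Hᵐ ] light r) ℕ.* q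
          ≡⟨ cong (ℕ._* q) (trans (∑-cong quads (λ r → trans (∑-const Hᵐ (light r)) (cong (ℕ._* light r) (card-Vec H.finite m)))) (∑-* quads (h ℕ.^ m) light)) ⟩
        h ℕ.^ m ℕ.* (∑ quads light) ℕ.* q
          ≡⟨ ℕₚ.*-assoc (h ℕ.^ m) _ q ⟩
        h ℕ.^ m ℕ.* ((∑ quads light) ℕ.* q)
          ≤⟨ ℕₚ.*-monoʳ-≤ (h ℕ.^ m) (light-lines (subst (λ z → q ℕ.* q ℕ.≤ 2 ℕ.* z) (planeSum-pairs b P) heavy)) ⟩
        h ℕ.^ m ℕ.* (4 ℕ.* (q ℕ.* q ℕ.* (q ℕ.* q)))
          ≡⟨ rearrange (h ℕ.^ m) q ⟩
        4 ℕ.* (q ℕ.* (q ℕ.* (q ℕ.* (q ℕ.* h ℕ.^ m))))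
          ≡⟨ cong (4 ℕ.*_) card-rounds ⟨
        4 ℕ.* card rounds ∎
        where
        rearrange : ∀ e q → e ℕ.* (4 ℕ.* (q ℕ.* q ℕ.* (q ℕ.* q))) ≡ 4 ℕ.* (q ℕ.* (q ℕ.* (q ℕ.* (q ℕ.* e))))
        rearrange = ℕSolver.solve-∀

    good-steps : ∀ P → (q ℕ.∸ 4) ℕ.* card rounds ℕ.≤ q ℕ.* (∑[ r ∈ rounds ] 𝟙 (StepOk? P r))
    good-steps P = begin
      (q ℕ.∸ 4) ℕ.* card rounds                          ≡⟨ ℕₚ.*-distribʳ-∸ (card rounds) q 4 ⟩
      q ℕ.* card rounds ℕ.∸ 4 ℕ.* card rounds            ≤⟨ ℕₚ.∸-monoʳ-≤ (q ℕ.* card rounds) (bad-steps P) ⟩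
      q ℕ.* card rounds ℕ.∸ bad ℕ.* q                    ≡⟨ cong₂ ℕ._∸_ split (ℕₚ.*-comm bad q) ⟩
      q ℕ.* good ℕ.+ q ℕ.* bad ℕ.∸ q ℕ.* bad             ≡⟨ ℕₚ.m+n∸n≡m (q ℕ.* good) (q ℕ.* bad) ⟩
      q ℕ.* good                                         ∎
      where
      open ℕₚ.≤-Reasoning
      good = ∑[ r ∈ rounds ] 𝟙 (StepOk? P r)
      bad  = ∑[ r ∈ rounds ] 𝟙 (¬? (StepOk? P r))
      split : q ℕ.* card rounds ≡ q ℕ.* good ℕ.+ q ℕ.* bad
      split = trans (cong (q ℕ.*_) (trans (card≡∑1 rounds) (trans
        (∑-cong rounds (λ r → sym (𝟙-¬? (StepOk? P r)))) (∑-+ rounds _ _)))) (ℕₚ.*-distribˡ-+ q good bad)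

    -- The estimate for one step is uniform in the plane, so it applies to the plane reached by any
    -- earlier rounds, and the factors multiply.
    good-walks : ∀ n P → (q ℕ.∸ 4) ℕ.^ n ℕ.* card rounds ℕ.^ n ℕ.≤
                         q ℕ.^ n ℕ.* (∑[ rs ∈ Vec-finite rounds n ] 𝟙 (WalkOk? P rs))
    good-walks zero P = ℕₚ.≤-reflexive (cong (1 ℕ.*_) (sym (∑-[] rounds _)))
    good-walks (suc n) P = begin
      (q ℕ.∸ 4) ℕ.^ suc n ℕ.* ρ ℕ.^ suc n
        ≡⟨ rearrange₁ (q ℕ.∸ 4) ((q ℕ.∸ 4) ℕ.^ n) ρ (ρ ℕ.^ n) ⟩
      (q ℕ.∸ 4) ℕ.* ρ ℕ.* ((q ℕ.∸ 4) ℕ.^ n ℕ.* ρ ℕ.^ n)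
        ≤⟨ ℕₚ.*-monoˡ-≤ _ (good-steps P) ⟩
      q ℕ.* (∑[ r ∈ rounds ] 𝟙 (StepOk? P r)) ℕ.* ((q ℕ.∸ 4) ℕ.^ n ℕ.* ρ ℕ.^ n)
        ≡⟨ trans (ℕₚ.*-assoc q _ _) (cong (q ℕ.*_) (sym (∑-*ʳ rounds _ _))) ⟩
      q ℕ.* (∑[ r ∈ rounds ] 𝟙 (StepOk? P r) ℕ.* ((q ℕ.∸ 4) ℕ.^ n ℕ.* ρ ℕ.^ n))
        ≤⟨ ℕₚ.*-monoʳ-≤ q (∑-mono rounds (λ r → ℕₚ.*-monoʳ-≤ (𝟙 (StepOk? P r)) (good-walks n (step P r)))) ⟩
      q ℕ.* (∑[ r ∈ rounds ] 𝟙 (StepOk? P r) ℕ.* (q ℕ.^ n ℕ.* (∑[ rs ∈ Vec-finite rounds n ] 𝟙 (WalkOk? (step P r) rs))))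
        ≡⟨ cong (q ℕ.*_) (∑-cong rounds (λ r → rearrange₂ (𝟙 (StepOk? P r)) (q ℕ.^ n) _)) ⟩
      q ℕ.* (∑[ r ∈ rounds ] q ℕ.^ n ℕ.* (𝟙 (StepOk? P r) ℕ.* (∑[ rs ∈ Vec-finite rounds n ] 𝟙 (WalkOk? (step P r) rs))))
        ≡⟨ trans (cong (q ℕ.*_) (∑-* rounds (q ℕ.^ n) _)) (sym (ℕₚ.*-assoc q _ _)) ⟩
      q ℕ.^ suc n ℕ.* (∑[ r ∈ rounds ] 𝟙 (StepOk? P r) ℕ.* (∑[ rs ∈ Vec-finite rounds n ] 𝟙 (WalkOk? (step P r) rs)))
        ≡⟨ cong (q ℕ.^ suc n ℕ.*_) (trans (∑-∷ rounds n _) (∑-cong rounds (λ r → trans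
             (∑-cong (Vec-finite rounds n) (λ rs → 𝟙-×-dec (StepOk? P r) (WalkOk? (step P r) rs))) (∑-* (Vec-finite rounds n) (𝟙 (StepOk? P r)) (λ rs → 𝟙 (WalkOk? (step P r) rs)))))) ⟨
      q ℕ.^ suc n ℕ.* (∑[ rs ∈ Vec-finite rounds (suc n) ] 𝟙 (WalkOk? P rs)) ∎
      where
      open ℕₚ.≤-Reasoning
      ρ = card rounds
      rearrange₁ : ∀ a b c d → a ℕ.* b ℕ.* (c ℕ.* d) ≡ a ℕ.* c ℕ.* (b ℕ.* d)
      rearrange₁ = ℕSolver.solve-∀
      rearrange₂ : ∀ a b c → a ℕ.* (b ℕ.* c) ≡ b ℕ.* (a ℕ.* c)
      rearrange₂ = ℕSolver.solve-∀

    good-outcomes : ∀ x → (q ℕ.∸ 4) ℕ.^ m ℕ.* card outcomes ℕ.≤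
                          q ℕ.^ m ℕ.* (∑[ (h₀ , rs) ∈ outcomes ] 𝟙 (WalkOk? (startPlane x h₀) rs))
    good-outcomes x = begin
      (q ℕ.∸ 4) ℕ.^ m ℕ.* card outcomes
        ≡⟨ cong ((q ℕ.∸ 4) ℕ.^ m ℕ.*_) (trans (card-× Hᵐ² (Vec-finite rounds m)) (cong (card Hᵐ² ℕ.*_) (card-Vec rounds m))) ⟩
      (q ℕ.∸ 4) ℕ.^ m ℕ.* (card Hᵐ² ℕ.* card rounds ℕ.^ m)
        ≡⟨ rearrange ((q ℕ.∸ 4) ℕ.^ m) (card Hᵐ²) _ ⟩
      card Hᵐ² ℕ.* ((q ℕ.∸ 4) ℕ.^ m ℕ.* card rounds ℕ.^ m)
        ≡⟨ ∑-const Hᵐ² _ ⟨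
      (∑[ h₀ ∈ Hᵐ² ] (q ℕ.∸ 4) ℕ.^ m ℕ.* card rounds ℕ.^ m)
        ≤⟨ ∑-mono Hᵐ² (λ h₀ → good-walks m (startPlane x h₀)) ⟩
      (∑[ h₀ ∈ Hᵐ² ] q ℕ.^ m ℕ.* (∑[ rs ∈ Vec-finite rounds m ] 𝟙 (WalkOk? (startPlane x h₀) rs)))
        ≡⟨ ∑-* Hᵐ² (q ℕ.^ m) _ ⟩
      q ℕ.^ m ℕ.* (∑[ h₀ ∈ Hᵐ² ] ∑[ rs ∈ Vec-finite rounds m ] 𝟙 (WalkOk? (startPlane x h₀) rs))
        ≡⟨ cong (q ℕ.^ m ℕ.*_) (∑-× Hᵐ² (Vec-finite rounds m) _) ⟨
      q ℕ.^ m ℕ.* (∑[ (h₀ , rs) ∈ outcomes ] 𝟙 (WalkOk? (startPlane x h₀) rs)) ∎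
      where
      open ℕₚ.≤-Reasoning
      Hᵐ² = ×-finite Hᵐ Hᵐ
      rearrange : ∀ a b c → a ℕ.* (b ℕ.* c) ≡ b ℕ.* (a ℕ.* c)
      rearrange = ℕSolver.solve-∀

-- Distances

open import Data.Integer.Base as ℤ using (+_)
import Data.Integer.Properties as ℤₚ
open import Data.Rational.Base as ℚ using (ℚ; 0ℚ; 1ℚ; ½; _/_)
import Data.Rational.Properties as ℚₚ
open import Data.List.Extrema (DecTotalOrder.totalOrder ℚₚ.≤-decTotalOrder) using (v≤min⁺)
open import Data.Rational.Solver using (module +-*-Solver)
open import Data.Rational.Unnormalised.Base as ℚᵘ using (mkℚᵘ; *≡*; *≤*)
import Data.Rational.Unnormalised.Properties as ℚᵘₚ

-- Opaque, since unfolding it would expose the gcd normalisation in _/_.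
opaque
  ι : ℕ → ℚ
  ι n = + n / 1

  ι≡ : ∀ n → ι n ≡ + n / 1
  ι≡ n = refl

  toℚᵘ-ι : ∀ n → ℚ.toℚᵘ (ι n) ℚᵘ.≃ mkℚᵘ (+ n) 0
  toℚᵘ-ι n = ℚₚ.toℚᵘ-fromℚᵘ (mkℚᵘ (+ n) 0)

ι-+ : ∀ a b → ι (a ℕ.+ b) ≡ ι a ℚ.+ ι b
ι-+ a b = ℚₚ.toℚᵘ-injective (begin
  ℚ.toℚᵘ (ι (a ℕ.+ b))                ≈⟨ toℚᵘ-ι (a ℕ.+ b) ⟩
  mkℚᵘ (+ (a ℕ.+ b)) 0                ≈⟨ *≡* (cong (ℤ._* (+ 1)) (trans (ℤₚ.pos-+ a b) (sym (cong₂ ℤ._+_ (ℤₚ.*-identityʳ (+ a)) (ℤₚ.*-identityʳ (+ b)))))) ⟩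
  mkℚᵘ (+ a) 0 ℚᵘ.+ mkℚᵘ (+ b) 0      ≈⟨ ℚᵘₚ.+-cong (toℚᵘ-ι a) (toℚᵘ-ι b) ⟨
  ℚ.toℚᵘ (ι a) ℚᵘ.+ ℚ.toℚᵘ (ι b)      ≈⟨ ℚₚ.toℚᵘ-homo-+ (ι a) (ι b) ⟨
  ℚ.toℚᵘ (ι a ℚ.+ ι b)                ∎)
  where open ℚᵘₚ.≃-Reasoning

ι-* : ∀ a b → ι (a ℕ.* b) ≡ ι a ℚ.* ι b
ι-* a b = ℚₚ.toℚᵘ-injective (begin
  ℚ.toℚᵘ (ι (a ℕ.* b))                ≈⟨ toℚᵘ-ι (a ℕ.* b) ⟩
  mkℚᵘ (+ (a ℕ.* b)) 0                ≈⟨ *≡* (cong (ℤ._* (+ 1)) (ℤₚ.pos-* a b)) ⟩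
  mkℚᵘ (+ a) 0 ℚᵘ.* mkℚᵘ (+ b) 0      ≈⟨ ℚᵘₚ.*-cong (toℚᵘ-ι a) (toℚᵘ-ι b) ⟨
  ℚ.toℚᵘ (ι a) ℚᵘ.* ℚ.toℚᵘ (ι b)      ≈⟨ ℚₚ.toℚᵘ-homo-* (ι a) (ι b) ⟨
  ℚ.toℚᵘ (ι a ℚ.* ι b)                ∎)
  where open ℚᵘₚ.≃-Reasoning

ι-mono-≤ : ∀ {a b} → a ℕ.≤ b → ι a ℚ.≤ ι b
ι-mono-≤ {a} {b} a≤b = ℚₚ.toℚᵘ-cancel-≤ (begin
  ℚ.toℚᵘ (ι a)     ≃⟨ toℚᵘ-ι a ⟩
  mkℚᵘ (+ a) 0     ≤⟨ *≤* (ℤₚ.*-monoʳ-≤-nonNeg (+ 1) (ℤ.+≤+ a≤b)) ⟩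
  mkℚᵘ (+ b) 0     ≃⟨ toℚᵘ-ι b ⟨
  ℚ.toℚᵘ (ι b)     ∎)
  where open ℚᵘₚ.≤-Reasoning

/-*-ι : ∀ a c .{{_ : ℕ.NonZero c}} → (+ a / c) ℚ.* ι c ≡ ι a
/-*-ι a (suc c) = ℚₚ.toℚᵘ-injective (begin
  ℚ.toℚᵘ ((+ a / suc c) ℚ.* ι (suc c))                ≈⟨ ℚₚ.toℚᵘ-homo-* (+ a / suc c) (ι (suc c)) ⟩
  ℚ.toℚᵘ (+ a / suc c) ℚᵘ.* ℚ.toℚᵘ (ι (suc c))        ≈⟨ ℚᵘₚ.*-cong (ℚₚ.toℚᵘ-fromℚᵘ (mkℚᵘ (+ a) c)) (toℚᵘ-ι (suc c)) ⟩
  mkℚᵘ (+ a) c ℚᵘ.* mkℚᵘ (+ suc c) 0                  ≈⟨ *≡* (trans (ℤₚ.*-identityʳ _) (cong (λ n → (+ a) ℤ.* (+ suc n)) (sym (ℕₚ.*-identityʳ c)))) ⟩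
  mkℚᵘ (+ a) 0                                        ≈⟨ toℚᵘ-ι a ⟨
  ℚ.toℚᵘ (ι a)                                        ∎)
  where open ℚᵘₚ.≃-Reasoning

instance
  ι-nonNeg : ∀ {n} → ℚ.NonNegative (ι n)
  ι-nonNeg {n} = ℚ.nonNegative (subst (ℚ._≤ ι n) (ι≡ 0) (ι-mono-≤ {0} {n} z≤n))

ι-pos : ∀ n .{{_ : ℕ.NonZero n}} → ℚ.Positive (ι n)
ι-pos (suc n) = ℚ.positive (ℚₚ.<-≤-trans (subst (0ℚ ℚ.<_) (sym (ι≡ 1)) (ℚₚ.positive⁻¹ 1ℚ)) (ι-mono-≤ {1} {suc n} (s≤s z≤n)))

ι-cancel-≤ : ∀ {a b} → ι a ℚ.≤ ι b → a ℕ.≤ b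
ι-cancel-≤ {a} {b} ιa≤ιb with a ℕₚ.≤? b
... | yes a≤b = a≤b
... | no a≰b = contradiction (begin-strict
  ι b              ≡⟨ ℚₚ.+-identityˡ (ι b) ⟨
  0ℚ ℚ.+ ι b       <⟨ ℚₚ.+-monoˡ-< (ι b) (ℚₚ.positive⁻¹ 1ℚ) ⟩
  1ℚ ℚ.+ ι b       ≡⟨ cong (ℚ._+ ι b) (ι≡ 1) ⟨
  ι 1 ℚ.+ ι b      ≡⟨ ι-+ 1 b ⟨
  ι (suc b)        ≤⟨ ι-mono-≤ (ℕₚ.≰⇒> a≰b) ⟩
  ι a              ≤⟨ ιa≤ιb ⟩
  ι b              ∎) (ℚₚ.<-irrefl refl)
  where open ℚₚ.≤-Reasoning

p≤q+r⇒p-q≤r : ∀ p q r → p ℚ.≤ q ℚ.+ r → p ℚ.- q ℚ.≤ r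
p≤q+r⇒p-q≤r p q r le = subst (p ℚ.- q ℚ.≤_) (+-*-Solver.solve 2 (λ q r → q :+ r :- q := r) refl q r)
  (ℚₚ.+-monoˡ-≤ (ℚ.- q) le)
  where open +-*-Solver

markov : {A : Set} (fin : Finite A) {Q : Pred A 0ℓ} (Q? : Decidable Q) (c : ℚ) (g : A → ℕ) →
         (∀ x → Q x → c ℚ.≤ ι (g x)) → c ℚ.* ι (∑[ x ∈ fin ] 𝟙 (Q? x)) ℚ.≤ ι (∑ fin g)
markov {A} fin {Q} Q? c g large = go
  where
  pointwise : ∀ x → c ℚ.* ι (𝟙 (Q? x)) ℚ.≤ ι (g x)
  pointwise x with Q? x
  ... | yes qx = ℚₚ.≤-trans (ℚₚ.≤-reflexive (trans (cong (c ℚ.*_) (ι≡ 1)) (ℚₚ.*-identityʳ c))) (large x qx)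
  ... | no _   = ℚₚ.≤-trans (ℚₚ.≤-reflexive (trans (cong (c ℚ.*_) (ι≡ 0)) (ℚₚ.*-zeroʳ c))) (ℚₚ.nonNegative⁻¹ (ι (g x)))
  onList : ∀ xs → c ℚ.* ι (ListAction.sum (List.map (λ x → 𝟙 (Q? x)) xs)) ℚ.≤ ι (ListAction.sum (List.map g xs))
  onList []       = ℚₚ.≤-reflexive (trans (cong (c ℚ.*_) (ι≡ 0)) (trans (ℚₚ.*-zeroʳ c) (sym (ι≡ 0))))
  onList (x ∷ xs) = begin
    c ℚ.* ι (𝟙 (Q? x) ℕ.+ S)                 ≡⟨ cong (c ℚ.*_) (ι-+ (𝟙 (Q? x)) S) ⟩
    c ℚ.* (ι (𝟙 (Q? x)) ℚ.+ ι S)             ≡⟨ ℚₚ.*-distribˡ-+ c _ _ ⟩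
    c ℚ.* ι (𝟙 (Q? x)) ℚ.+ c ℚ.* ι S         ≤⟨ ℚₚ.+-mono-≤ (pointwise x) (onList xs) ⟩
    ι (g x) ℚ.+ ι (ListAction.sum (List.map g xs))      ≡⟨ ι-+ (g x) _ ⟨
    ι (g x ℕ.+ ListAction.sum (List.map g xs))          ∎
    where
    open ℚₚ.≤-Reasoning
    S = ListAction.sum (List.map (λ x → 𝟙 (Q? x)) xs)
  opaque
    unfolding ∑
    go : c ℚ.* ι (∑[ x ∈ fin ] 𝟙 (Q? x)) ℚ.≤ ι (∑ fin g)
    go = onList (Finite.elements fin)

minimum-≰ : {A : Set} (fin : Finite A) (g : A → ℚ) {ρ : ℚ} → ¬ ρ ℚ.≤ minimum fin g → ∃ λ x → g x ℚ.< ρ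
minimum-≰ fin g {ρ} ρ≰min with any-finite? fin (λ x → g x ℚₚ.<? ρ)
... | yes found = found
... | no none = contradiction
  (v≤min⁺ (ρ≤ (Finite.witness fin)) (All.map⁺ (All.universal ρ≤ (Finite.elements fin)))) ρ≰min
  where
  ρ≤ : ∀ x → ρ ℚ.≤ g x
  ρ≤ x = ℚₚ.≮⇒≥ (λ gx<ρ → none (x , gx<ρ))

-- Either summand of the weighted distance is at most the whole, and the 2 in its denominator turns
-- ρ into 2ρ. Applied to each summand in turn, it bounds the disagreement both on A and on the whole
-- index set.
half-bound : ∀ x c (p y ρ : ℚ) .{{_ : ℕ.NonZero (2 ℕ.* c)}} → p ℚ.* ι (2 ℕ.* c) ≡ ι x →
             0ℚ ℚ.≤ y → p ℚ.+ y ℚ.< ρ → ι x ℚ.< twice ρ ℚ.* ι c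
half-bound x c p y ρ p≡ 0≤y p+y<ρ = begin-strict
  ι x                      ≡⟨ p≡ ⟨
  p ℚ.* ι (2 ℕ.* c)        <⟨ ℚₚ.*-monoˡ-<-pos (ι (2 ℕ.* c)) {{ι-pos (2 ℕ.* c)}} p<ρ ⟩
  ρ ℚ.* ι (2 ℕ.* c)        ≡⟨ cong (ρ ℚ.*_) (trans (ι-* 2 c) (cong (ℚ._* ι c) (ι≡ 2))) ⟩
  ρ ℚ.* (2ℚ ℚ.* ι c)       ≡⟨ ℚₚ.*-assoc ρ 2ℚ (ι c) ⟨
  ρ ℚ.* 2ℚ ℚ.* ι c         ≡⟨ cong (ℚ._* ι c) (ℚₚ.*-comm ρ 2ℚ) ⟩
  twice ρ ℚ.* ι c          ∎
  where
  open ℚₚ.≤-Reasoning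
  2ℚ = + 2 / 1
  p<ρ : p ℚ.< ρ
  p<ρ = begin-strict
    p           ≡⟨ ℚₚ.+-identityʳ p ⟨
    p ℚ.+ 0ℚ    ≤⟨ ℚₚ.+-monoʳ-≤ p 0≤y ⟩
    p ℚ.+ y     <⟨ p+y<ρ ⟩
    ρ           ∎

0≤/ : ∀ x c .{{_ : ℕ.NonZero c}} → 0ℚ ℚ.≤ + x / c
0≤/ x c = ℚₚ.nonNegative⁻¹ (+ x / c) {{ℚₚ.normalize-nonNeg x c}}

module _ {I V : Set} (fin : Finite I) (_≟_ : DecidableEquality V) where
  open Hamming fin _≟_

  distOn-bounds : ∀ {A : Pred I 0ℓ} (A? : Decidable A) (A≢∅ : ∃ A) u v {ρ} → distOn A? A≢∅ u v ℚ.< ρ →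
    ι (count fin (λ i → A? i ×-dec differ? u v i)) ℚ.< twice ρ ℚ.* ι (count fin A?) ×
    ι (count fin (differ? u v)) ℚ.< twice ρ ℚ.* ι (card fin)
  distOn-bounds A? A≢∅ u v {ρ} close =
    half-bound x a p r ρ {{2a-nonZero}} (/-*-ι x (2 ℕ.* a) {{2a-nonZero}}) (0≤/ y (2 ℕ.* N) {{2N-nonZero}}) close ,
    half-bound y N r p ρ {{2N-nonZero}} (/-*-ι y (2 ℕ.* N) {{2N-nonZero}}) (0≤/ x (2 ℕ.* a) {{2a-nonZero}})
      (subst (ℚ._< ρ) (ℚₚ.+-comm p r) close)
    where
    a = count fin A?
    x = count fin (λ i → A? i ×-dec differ? u v i)
    y = count fin (differ? u v)
    N = card fin
    2a-nonZero = ℕₚ.m*n≢0 2 a {{_}} {{count-nonZero fin A? A≢∅}}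
    2N-nonZero = ℕₚ.m*n≢0 2 N {{_}} {{card-nonZero fin}}
    p = (+ x / (2 ℕ.* a)) {{2a-nonZero}}
    r = (+ y / (2 ℕ.* N)) {{2N-nonZero}}

-- Where g and v differ, u cannot agree with both. Summed over all points this is the triangle
-- inequality for disagreement counts, with the agreements of g and v as the defect.
triangle : {V : Set} {u g v : V} (g≟v : Dec (g ≡ v)) (u≟g : Dec (u ≡ g)) (u≟v : Dec (u ≡ v)) →
           1 ℕ.≤ 𝟙 g≟v ℕ.+ (𝟙 (¬? u≟g) ℕ.+ 𝟙 (¬? u≟v))
triangle (yes _)  _         _         = s≤s z≤n
triangle (no _)   (no _)    _         = s≤s z≤n
triangle (no _)   (yes _)   (no _)    = s≤s z≤n
triangle (no g≢v) (yes u≡g) (yes u≡v) = contradiction (trans (sym u≡g) u≡v) g≢v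

module Thresholds (δ e ρ : ℚ) (δ≡1-e : δ ≡ 1ℚ ℚ.- e) (0≤e : 0ℚ ℚ.≤ e) (e≤1/4 : e ℚ.≤ + 1 / 4)
                  (ρ≤δ/8 : ρ ℚ.≤ δ ℚ.* (+ 1 / 8)) where
  open ℚₚ.≤-Reasoning
  open +-*-Solver

  δ≤1 : δ ℚ.≤ 1ℚ
  δ≤1 = subst (ℚ._≤ 1ℚ) (sym δ≡1-e) (p≤q+r⇒p-q≤r 1ℚ e 1ℚ (begin
    1ℚ             ≡⟨ ℚₚ.+-identityˡ 1ℚ ⟨
    0ℚ ℚ.+ 1ℚ      ≤⟨ ℚₚ.+-monoˡ-≤ 1ℚ 0≤e ⟩
    e ℚ.+ 1ℚ       ∎))

  3/4≤δ : + 3 / 4 ℚ.≤ δ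
  3/4≤δ = subst (+ 3 / 4 ℚ.≤_) (sym δ≡1-e) (ℚₚ.+-monoʳ-≤ 1ℚ (ℚₚ.neg-antimono-≤ e≤1/4))

  twice≤ : twice ρ ℚ.≤ δ ℚ.* (+ 1 / 4)
  twice≤ = begin
    (+ 2 / 1) ℚ.* ρ                     ≤⟨ ℚₚ.*-monoˡ-≤-nonNeg (+ 2 / 1) ρ≤δ/8 ⟩
    (+ 2 / 1) ℚ.* (δ ℚ.* (+ 1 / 8))     ≡⟨ ℚₚ.*-comm (+ 2 / 1) (δ ℚ.* (+ 1 / 8)) ⟩
    δ ℚ.* (+ 1 / 8) ℚ.* (+ 2 / 1)       ≡⟨ ℚₚ.*-assoc δ (+ 1 / 8) (+ 2 / 1) ⟩
    δ ℚ.* (+ 1 / 4)                     ∎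

  -- Since 2ρ ≤ δ/4, at least 3δ/4 remains, and δ ≥ 3/4 gives 9/16. One half is the density that the
  -- sampling of lines asks of a plane.
  ½≤δ-2ρ : ℚ.½ ℚ.≤ δ ℚ.- twice ρ
  ½≤δ-2ρ = begin
    ℚ.½                                 ≤⟨ toWitness {a? = ℚ.½ ℚₚ.≤? + 9 / 16} tt ⟩
    (+ 3 / 4) ℚ.* (+ 3 / 4)             ≤⟨ ℚₚ.*-monoʳ-≤-nonNeg (+ 3 / 4) 3/4≤δ ⟩
    δ ℚ.* (+ 3 / 4)                     ≡⟨ solve 1 (λ a → a :* con (+ 3 / 4) := a :- a :* con (+ 1 / 4)) refl δ ⟩
    δ ℚ.- δ ℚ.* (+ 1 / 4)               ≤⟨ ℚₚ.+-monoʳ-≤ δ (ℚₚ.neg-antimono-≤ twice≤) ⟩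
    δ ℚ.- twice ρ                       ∎

  -- This is why disagreement on a quarter of A rules out `v` as the nearby codeword: closeness
  -- allows less than 2ρ, hence less than a quarter.
  4twice≤1 : (+ 4 / 1) ℚ.* twice ρ ℚ.≤ 1ℚ
  4twice≤1 = begin
    (+ 4 / 1) ℚ.* twice ρ               ≤⟨ ℚₚ.*-monoˡ-≤-nonNeg (+ 4 / 1) twice≤ ⟩
    (+ 4 / 1) ℚ.* (δ ℚ.* (+ 1 / 4))     ≡⟨ solve 1 (λ a → con (+ 4 / 1) :* (a :* con (+ 1 / 4)) := a) refl δ ⟩
    δ                                   ≤⟨ δ≤1 ⟩
    1ℚ                                  ∎

  [δ-2ρ]* : ∀ N → (δ ℚ.- twice ρ) ℚ.* N ≡ N ℚ.- (e ℚ.* N ℚ.+ twice ρ ℚ.* N)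
  [δ-2ρ]* N = trans (cong (λ z → (z ℚ.- twice ρ) ℚ.* N) δ≡1-e)
    (solve 3 (λ e r N → (con 1ℚ :- e :- r) :* N := N :- (e :* N :+ r :* N)) refl e (twice ρ) N)

-- From accepted tests to many disagreements

module Distances (F : FiniteField) (d m : ℕ) (2≤d : 2 ℕ.≤ d) (2≤m : 2 ℕ.≤ m)
                 (2md≤∣F∣ : 2 ℕ.* m ℕ.* d ℕ.≤ FiniteField.order F)
                 (ρ : ℚ) (ρ≤δ/8 : ρ ℚ.≤ δ[ F , d ] ℚ.* (+ 1 / 8)) where
  open FiniteField F
  open Polynomials F
  open ReedMuller F

  private
    q = order
    δ = δ[ F , d ]
    instance
      q-nonZero : ℕ.NonZero q
      q-nonZero = card-nonZero finite

  4d≤q : 4 ℕ.* d ℕ.≤ q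
  4d≤q = ℕₚ.≤-trans (ℕₚ.*-monoˡ-≤ d (ℕₚ.*-monoʳ-≤ 2 2≤m)) 2md≤∣F∣

  d/q≤1/4 : d /ᶠ F ℚ.≤ + 1 / 4
  d/q≤1/4 = ℚₚ.*-cancelʳ-≤-pos (ι q) {{ι-pos q}} (begin
    (d /ᶠ F) ℚ.* ι q                          ≡⟨ /-*-ι d q ⟩
    ι d                                       ≡⟨ ℚₚ.*-identityˡ (ι d) ⟨
    (+ 1 / 4) ℚ.* (+ 4 / 1) ℚ.* ι d           ≡⟨ ℚₚ.*-assoc (+ 1 / 4) (+ 4 / 1) (ι d) ⟩
    (+ 1 / 4) ℚ.* ((+ 4 / 1) ℚ.* ι d)         ≡⟨ cong ((+ 1 / 4) ℚ.*_) (trans (ι-* 4 d) (cong (ℚ._* ι d) (ι≡ 4))) ⟨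
    (+ 1 / 4) ℚ.* ι (4 ℕ.* d)                 ≤⟨ ℚₚ.*-monoˡ-≤-nonNeg (+ 1 / 4) (ι-mono-≤ 4d≤q) ⟩
    (+ 1 / 4) ℚ.* ι q                         ∎)
    where open ℚₚ.≤-Reasoning

  open Thresholds δ (d /ᶠ F) ρ refl (0≤/ d q) d/q≤1/4 ρ≤δ/8 public

  differ? : ∀ {n} (u v : Vec Carrier n → Carrier) → Decidable (λ i → u i ≢ v i)
  differ? {n} = Hamming.differ? (points n) _≟_

  disagreements : ∀ {n} (u v : Vec Carrier n → Carrier) → ℕ
  disagreements {n} u v = count (points n) (differ? u v)

  Heavy : ∀ {n} (u v : Vec Carrier n → Carrier) → Set
  Heavy {n} u v = (δ ℚ.- twice ρ) ℚ.* ι (q ℕ.^ n) ℚ.≤ ι (disagreements u v)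

  Heavy⇒½ : ∀ {n} {u v : Vec Carrier n → Carrier} → Heavy u v → q ℕ.^ n ℕ.≤ 2 ℕ.* disagreements u v
  Heavy⇒½ {n} {u} {v} heavy = ι-cancel-≤ (begin
    ι (q ℕ.^ n)                                      ≡⟨ ℚₚ.*-identityˡ (ι (q ℕ.^ n)) ⟨
    (+ 2 / 1) ℚ.* ℚ.½ ℚ.* ι (q ℕ.^ n)                ≡⟨ ℚₚ.*-assoc (+ 2 / 1) ℚ.½ (ι (q ℕ.^ n)) ⟩
    (+ 2 / 1) ℚ.* (ℚ.½ ℚ.* ι (q ℕ.^ n))              ≤⟨ ℚₚ.*-monoˡ-≤-nonNeg (+ 2 / 1) (ℚₚ.*-monoʳ-≤-nonNeg (ι (q ℕ.^ n)) ½≤δ-2ρ) ⟩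
    (+ 2 / 1) ℚ.* ((δ ℚ.- twice ρ) ℚ.* ι (q ℕ.^ n))  ≤⟨ ℚₚ.*-monoˡ-≤-nonNeg (+ 2 / 1) heavy ⟩
    (+ 2 / 1) ℚ.* ι (disagreements u v)              ≡⟨ trans (ι-* 2 (disagreements u v)) (cong (ℚ._* ι (disagreements u v)) (ι≡ 2)) ⟨
    ι (2 ℕ.* disagreements u v)                      ∎)
    where open ℚₚ.≤-Reasoning

  distOnRM-≰ : ∀ n {A : Pred (Vec Carrier n) 0ℓ} (A? : Decidable A) (A≢∅ : ∃ A) u {ρ} →
    ¬ ρ ℚ.≤ distOnRM n d A? A≢∅ u →
    ∃ λ p → Hamming.distOn (points n) _≟_ A? A≢∅ u (eval n d p) ℚ.< ρ
  distOnRM-≰ n A? A≢∅ u = minimum-≰ (polys n d) (λ p → Hamming.distOn (points n) _≟_ A? A≢∅ u (eval n d p))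

  -- A codeword that is close to u under dist_A cannot be v, since u and v differ on a quarter
  -- of A; being another codeword, it is far from v, and hence so is u.
  heavy-if-close : ∀ n {A : Pred (Vec Carrier n) 0ℓ} (A? : Decidable A) (A≢∅ : ∃ A) u v G → RM n d v → RM n d G →
    count (points n) A? ℕ.≤ 4 ℕ.* count (points n) (λ i → A? i ×-dec differ? u v i) →
    Hamming.distOn (points n) _≟_ A? A≢∅ u G ℚ.< ρ → Heavy u v
  heavy-if-close n A? A≢∅ u v G rmv rmG quarter close =
    conclude (decidable-stable (any-finite? (points n) (differ? G v))
      (λ same → G≢v (λ i → decidable-stable (G i ≟ v i) (λ Gi≢vi → same (i , Gi≢vi)))))
    where
    a x y N : ℕ
    a = count (points n) A?
    x = count (points n) (λ i → A? i ×-dec differ? u G i)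
    y = disagreements u G
    N = card (points n)

    x-small : ι x ℚ.< twice ρ ℚ.* ι a
    x-small = proj₁ (distOn-bounds (points n) _≟_ A? A≢∅ u G close)

    y-small : ι y ℚ.< twice ρ ℚ.* ι N
    y-small = proj₂ (distOn-bounds (points n) _≟_ A? A≢∅ u G close)

    G≢v : ¬ (∀ i → G i ≡ v i)
    G≢v G≗v = ℚₚ.<-irrefl refl (begin-strict
      ι a                                    ≤⟨ ι-mono-≤ (ℕₚ.≤-trans quarter (ℕₚ.*-monoʳ-≤ 4
                                                  (count-mono (points n) (λ i → A? i ×-dec differ? u v i) (λ i → A? i ×-dec differ? u G i)
                                                    (λ i (ai , u≢v) → ai , λ u≡G → u≢v (trans u≡G (G≗v i)))))) ⟩
      ι (4 ℕ.* x)                            ≡⟨ trans (ι-* 4 x) (cong (ℚ._* ι x) (ι≡ 4)) ⟩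
      (+ 4 / 1) ℚ.* ι x                      <⟨ ℚₚ.*-monoʳ-<-pos (+ 4 / 1) x-small ⟩
      (+ 4 / 1) ℚ.* (twice ρ ℚ.* ι a)        ≡⟨ ℚₚ.*-assoc (+ 4 / 1) (twice ρ) (ι a) ⟨
      (+ 4 / 1) ℚ.* twice ρ ℚ.* ι a          ≤⟨ ℚₚ.*-monoʳ-≤-nonNeg (ι a) 4twice≤1 ⟩
      1ℚ ℚ.* ι a                             ≡⟨ ℚₚ.*-identityˡ (ι a) ⟩
      ι a                                    ∎)
      where open ℚₚ.≤-Reasoning

    conclude : (∃ λ i → G i ≢ v i) → Heavy u v
    conclude (w , Gw≢vw) = begin
      (δ ℚ.- twice ρ) ℚ.* ι (q ℕ.^ n)
        ≡⟨ cong (λ z → (δ ℚ.- twice ρ) ℚ.* ι z) (card-Vec finite n) ⟨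
      (δ ℚ.- twice ρ) ℚ.* ι N
        ≡⟨ [δ-2ρ]* (ι N) ⟩
      ι N ℚ.- ((d /ᶠ F) ℚ.* ι N ℚ.+ twice ρ ℚ.* ι N)
        ≤⟨ p≤q+r⇒p-q≤r (ι N) _ _ bound ⟩
      ι (disagreements u v) ∎
      where
      open ℚₚ.≤-Reasoning
      agr = ∑[ i ∈ points n ] 𝟙 (G i ≟ v i)
      agr≤ : ι agr ℚ.≤ (d /ᶠ F) ℚ.* ι N
      agr≤ = ℚₚ.*-cancelˡ-≤-pos (ι q) {{ι-pos q}} (begin
        ι q ℚ.* ι agr                    ≡⟨ ι-* q agr ⟨
        ι (q ℕ.* agr)                    ≤⟨ ι-mono-≤ (agreements {d = d} rmG rmv w Gw≢vw) ⟩
        ι (d ℕ.* q ℕ.^ n)                ≡⟨ cong (λ z → ι (d ℕ.* z)) (card-Vec finite n) ⟨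
        ι (d ℕ.* N)                      ≡⟨ ι-* d N ⟩
        ι d ℚ.* ι N                      ≡⟨ cong (ℚ._* ι N) (trans (sym (/-*-ι d q)) (ℚₚ.*-comm (d /ᶠ F) (ι q))) ⟩
        ι q ℚ.* (d /ᶠ F) ℚ.* ι N         ≡⟨ ℚₚ.*-assoc (ι q) (d /ᶠ F) (ι N) ⟩
        ι q ℚ.* ((d /ᶠ F) ℚ.* ι N)         ∎)
      N≤ : N ℕ.≤ agr ℕ.+ (y ℕ.+ disagreements u v)
      N≤ = ℕₚ.≤-trans (ℕₚ.≤-reflexive (card≡∑1 (points n))) (ℕₚ.≤-trans (∑-mono (points n) (λ i → triangle (G i ≟ v i) (u i ≟ G i) (u i ≟ v i)))
        (ℕₚ.≤-reflexive (trans (∑-+ (points n) _ _) (cong (agr ℕ.+_) (trans (∑-+ (points n) _ _)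
          (sym (cong₂ ℕ._+_ (count≡∑ (points n) (differ? u G)) (count≡∑ (points n) (differ? u v)))))))))
      bound : ι N ℚ.≤ (d /ᶠ F) ℚ.* ι N ℚ.+ twice ρ ℚ.* ι N ℚ.+ ι (disagreements u v)
      bound = begin
        ι N
          ≤⟨ ι-mono-≤ N≤ ⟩
        ι (agr ℕ.+ (y ℕ.+ disagreements u v))
          ≡⟨ trans (ι-+ agr _) (cong (ι agr ℚ.+_) (ι-+ y _)) ⟩
        ι agr ℚ.+ (ι y ℚ.+ ι (disagreements u v))
          ≤⟨ ℚₚ.+-mono-≤ agr≤ (ℚₚ.+-monoˡ-≤ (ι (disagreements u v)) (ℚₚ.<⇒≤ y-small)) ⟩
        (d /ᶠ F) ℚ.* ι N ℚ.+ (twice ρ ℚ.* ι N ℚ.+ ι (disagreements u v))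
          ≡⟨ ℚₚ.+-assoc ((d /ᶠ F) ℚ.* ι N) (twice ρ ℚ.* ι N) (ι (disagreements u v)) ⟨
        (d /ᶠ F) ℚ.* ι N ℚ.+ twice ρ ℚ.* ι N ℚ.+ ι (disagreements u v) ∎

  heavy-if-accepted : ∀ n {A : Pred (Vec Carrier n) 0ℓ} (A? : Decidable A) (A≢∅ : ∃ A) u v → RM n d v →
    count (points n) A? ℕ.≤ 4 ℕ.* count (points n) (λ i → A? i ×-dec differ? u v i) →
    ¬ ρ ℚ.≤ distOnRM n d A? A≢∅ u → Heavy u v
  heavy-if-accepted n A? A≢∅ u v rmv quarter accepted =
    let p , close = distOnRM-≰ n A? A≢∅ u accepted
    in heavy-if-close n A? A≢∅ u v (eval n d p) rmv (p , λ _ → refl) quarter close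

-- Soundness

open import Data.Rational.Base using (_≤_; _*_; _+_; _-_; _÷_)
open FiniteField using (Carrier; order)

Pr-*-ι : {A : Set} (fin : Finite A) {Q : Pred A 0ℓ} (Q? : Decidable Q) →
         Pr fin Q? * ι (card fin) ≡ ι (count fin Q?)
Pr-*-ι fin Q? = /-*-ι (count fin Q?) (card fin) {{card-nonZero fin}}

÷-* : ∀ a p .{{_ : ℚ.NonZero p}} → (a ÷ p) * p ≡ a
÷-* a p = trans (ℚₚ.*-assoc a (ℚ.1/ p) p) (trans (cong (a *_) (ℚₚ.*-inverseˡ p)) (ℚₚ.*-identityʳ a))

^-*-ι : ∀ a q c → a * ι q ≡ ι c → ∀ n → (a ^ℚ n) * ι (q ℕ.^ n) ≡ ι (c ℕ.^ n)
^-*-ι a q c eq zero    = ℚₚ.*-identityˡ (ι 1)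
^-*-ι a q c eq (suc n) = begin
  a * (a ^ℚ n) * ι (q ℕ.* q ℕ.^ n)           ≡⟨ cong (a * (a ^ℚ n) *_) (ι-* q (q ℕ.^ n)) ⟩
  a * (a ^ℚ n) * (ι q * ι (q ℕ.^ n))         ≡⟨ solve 4 (λ a b c d → a :* b :* (c :* d) := a :* c :* (b :* d)) refl a (a ^ℚ n) (ι q) (ι (q ℕ.^ n)) ⟩
  a * ι q * ((a ^ℚ n) * ι (q ℕ.^ n))         ≡⟨ cong₂ _*_ eq (^-*-ι a q c eq n) ⟩
  ι c * ι (c ℕ.^ n)                          ≡⟨ ι-* c (c ℕ.^ n) ⟨
  ι (c ℕ.* c ℕ.^ n)                          ∎
  where
  open ≡-Reasoning
  open +-*-Solver

[1-4/q]*ι : ∀ x q → 4 ℕ.≤ q → x * ι q ≡ ι 4 → (1ℚ - x) * ι q ≡ ι (q ℕ.∸ 4)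
[1-4/q]*ι x q 4≤q eq = begin
  (1ℚ - x) * ι q                   ≡⟨ solve 2 (λ x q → (con 1ℚ :- x) :* q := q :- x :* q) refl x (ι q) ⟩
  ι q - x * ι q                    ≡⟨ cong₂ _-_ (trans (cong ι (sym (ℕₚ.m∸n+n≡m 4≤q))) (ι-+ (q ℕ.∸ 4) 4)) eq ⟩
  ι (q ℕ.∸ 4) + ι 4 - ι 4          ≡⟨ solve 2 (λ x y → x :+ y :- y := x) refl (ι (q ℕ.∸ 4)) (ι 4) ⟩
  ι (q ℕ.∸ 4)                      ∎
  where
  open ≡-Reasoning
  open +-*-Solver

-- T outcomes, of which r are rejected, G have only good steps, and e end in a heavy plane;
-- S is the sum over all outcomes of the number of disagreements on the last plane.
union-bound : ∀ (A y p pr τ η : ℚ) (T r G e S B u a q² h² : ℕ)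
  .{{_ : ℕ.NonZero T}} .{{_ : ℕ.NonZero a}} .{{_ : ℕ.NonZero q²}} .{{_ : ℕ.NonZero h²}} →
  0ℚ ℚ.< p → A * ι a ≡ ι u → u ℕ.* T ℕ.≤ a ℕ.* G → G ℕ.≤ r ℕ.+ e →
  p * ι q² * ι e ≤ ι S → a ℕ.* h² ℕ.* S ℕ.≤ T ℕ.* q² ℕ.* (B ℕ.* h² ℕ.+ a) →
  ι B ≤ τ * ι a → 1ℚ ≤ η * ι h² → y * p ≡ τ + η → pr * ι T ≡ ι r →
  A - y ≤ pr
union-bound A y p pr τ η T r G e S B u a q² h² 0<p Aa uT≤ G≤ markov-e S≤ B≤ 1≤ yp prT =
  ℚₚ.*-cancelʳ-≤-pos (ι T) {{ι-pos T}} (begin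
    (A - y) * ι T                  ≡⟨ solve 3 (λ A y T → (A :- y) :* T := A :* T :- y :* T) refl A y (ι T) ⟩
    A * ι T - y * ι T              ≤⟨ p≤q+r⇒p-q≤r (A * ι T) (y * ι T) (ι r) AT≤ ⟩
    ι r                            ≡⟨ prT ⟨
    pr * ι T                       ∎)
  where
  open ℚₚ.≤-Reasoning
  open +-*-Solver
  good : A * ι T ≤ ι G
  good = ℚₚ.*-cancelˡ-≤-pos (ι a) {{ι-pos a}} (begin
    ι a * (A * ι T)                ≡⟨ solve 3 (λ a A T → a :* (A :* T) := A :* a :* T) refl (ι a) A (ι T) ⟩
    A * ι a * ι T                  ≡⟨ cong (_* ι T) Aa ⟩
    ι u * ι T                      ≡⟨ ι-* u T ⟨
    ι (u ℕ.* T)                    ≤⟨ ι-mono-≤ uT≤ ⟩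
    ι (a ℕ.* G)                    ≡⟨ ι-* a G ⟩
    ι a * ι G                      ∎)
  -- The mean disagreement on the last plane exceeds τ by at most 1/h², which `1≤` relaxes to η.
  S-bound : ι S ≤ (τ + η) * (ι T * ι q²)
  S-bound = ℚₚ.*-cancelˡ-≤-pos (ι (a ℕ.* h²)) {{ι-pos (a ℕ.* h²) {{ℕₚ.m*n≢0 a h²}}}} (begin
    ι (a ℕ.* h²) * ι S                              ≡⟨ ι-* (a ℕ.* h²) S ⟨
    ι (a ℕ.* h² ℕ.* S)                              ≤⟨ ι-mono-≤ S≤ ⟩
    ι (T ℕ.* q² ℕ.* (B ℕ.* h² ℕ.+ a))               ≡⟨ trans (ι-* (T ℕ.* q²) _) (cong₂ _*_ (ι-* T q²) (trans (ι-+ (B ℕ.* h²) a) (cong (_+ ι a) (ι-* B h²)))) ⟩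
    ι T * ι q² * (ι B * ι h² + ι a)                 ≤⟨ ℚₚ.*-monoˡ-≤-nonNeg (ι T * ι q²) {{ℚₚ.nonNeg*nonNeg⇒nonNeg (ι T) (ι q²)}}
                                                         (ℚₚ.+-mono-≤ (ℚₚ.*-monoʳ-≤-nonNeg (ι h²) B≤) a≤) ⟩
    ι T * ι q² * (τ * ι a * ι h² + η * ι h² * ι a)  ≡⟨ solve 6 (λ T q τ a h η → T :* q :* (τ :* a :* h :+ η :* h :* a) := a :* h :* ((τ :+ η) :* (T :* q))) refl
                                                         (ι T) (ι q²) τ (ι a) (ι h²) η ⟩
    ι a * ι h² * ((τ + η) * (ι T * ι q²))           ≡⟨ cong (_* ((τ + η) * (ι T * ι q²))) (ι-* a h²) ⟨
    ι (a ℕ.* h²) * ((τ + η) * (ι T * ι q²))         ∎)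
    where
    a≤ : ι a ≤ η * ι h² * ι a
    a≤ = begin
      ι a                    ≡⟨ ℚₚ.*-identityˡ (ι a) ⟨
      1ℚ * ι a               ≤⟨ ℚₚ.*-monoʳ-≤-nonNeg (ι a) 1≤ ⟩
      η * ι h² * ι a         ∎
  p-pos : ℚ.Positive p
  p-pos = ℚ.positive 0<p
  pq²-pos : ℚ.Positive (p * ι q²)
  pq²-pos = ℚₚ.pos*pos⇒pos p {{p-pos}} (ι q²) {{ι-pos q²}}
  e≤ : ι e ≤ y * ι T
  e≤ = ℚₚ.*-cancelˡ-≤-pos (p * ι q²) {{pq²-pos}} (begin
    p * ι q² * ι e                 ≤⟨ markov-e ⟩
    ι S                            ≤⟨ S-bound ⟩
    (τ + η) * (ι T * ι q²)         ≡⟨ cong (_* (ι T * ι q²)) yp ⟨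
    y * p * (ι T * ι q²)           ≡⟨ solve 4 (λ y p T q → y :* p :* (T :* q) := p :* q :* (y :* T)) refl y p (ι T) (ι q²) ⟩
    p * ι q² * (y * ι T)           ∎)
  AT≤ : A * ι T ≤ y * ι T + ι r
  AT≤ = begin
    A * ι T            ≤⟨ good ⟩
    ι G                ≤⟨ ι-mono-≤ G≤ ⟩
    ι (r ℕ.+ e)        ≡⟨ ι-+ r e ⟩
    ι r + ι e          ≤⟨ ℚₚ.+-monoʳ-≤ (ι r) e≤ ⟩
    ι r + y * ι T      ≡⟨ ℚₚ.+-comm (ι r) (y * ι T) ⟩
    y * ι T + ι r      ∎

module Soundness (d m : ℕ) (2≤d : 2 ℕ.≤ d) (2≤m : 2 ℕ.≤ m) {H F : FiniteField}
  (E : Extension H F) (degree : Extension.HasDegree E m)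
  (2md≤∣F∣ : 2 ℕ.* m ℕ.* d ℕ.≤ order F) (ρ : ℚ) (ρ≤δ/8 : ρ ≤ δ[ F , d ] * (+ 1 / 8))
  (f Q : Vec (Carrier F) m → Carrier F) (rmQ : ReedMuller.RM F m d Q)
  (x : Vec (Carrier F) m) (fx≢Qx : f x ≢ Q x) where

  open FiniteField F using (_≟_; finite; points; 0#)
  open ReedMuller F
  open Walk E m
  open WalkSums E m
  open VectorAlgebra F using (⊕-0⊙)
  open PlaneRestriction E m
  open Distances F d m 2≤d 2≤m 2md≤∣F∣ ρ ρ≤δ/8
  private
    q = order F
    h = order H

  wrong : Vec (Carrier F) m → ℕ
  wrong y = 𝟙 (¬? (f y ≟ Q y))

  wrong-idem : ∀ y → wrong y ℕ.* wrong y ≡ wrong y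
  wrong-idem y = go (¬? (f y ≟ Q y))
    where
    go : {P : Set} (p : Dec P) → 𝟙 p ℕ.* 𝟙 p ≡ 𝟙 p
    go (yes _) = refl
    go (no _)  = refl

  open LineSampling wrong wrong-idem

  HeavyPlane : Plane → Set
  HeavyPlane P = Heavy (f ∣ₚ P) (Q ∣ₚ P)

  HeavyPlane? : Decidable HeavyPlane
  HeavyPlane? P = _ ℚₚ.≤? _

  disagreements≡planeSum : ∀ P → disagreements (f ∣ₚ P) (Q ∣ₚ P) ≡ planeSum wrong P
  disagreements≡planeSum P = count≡∑ (points 2) (differ? (f ∣ₚ P) (Q ∣ₚ P))

  count-L : count (points 2) L? ≡ q
  count-L = begin
    count (points 2) L?                               ≡⟨ trans (count≡∑ (points 2) L?) (∑-pairs finite _) ⟩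
    (∑[ y ∈ finite ] ∑[ z ∈ finite ] 𝟙 (z ≟ 0#))      ≡⟨ ∑-cong finite (λ y → trans (∑-cong finite (λ z → sym (ℕₚ.*-identityʳ _)))
                                                           (∑-𝟙≡ finite _≟_ 0# (λ _ → 1))) ⟩
    (∑[ y ∈ finite ] 1)                               ≡⟨ card≡∑1 finite ⟨
    q                                                 ∎
    where open ≡-Reasoning

  count-L-wrong : ∀ P → count (points 2) (λ v → L? v ×-dec differ? (f ∣ₚ P) (Q ∣ₚ P) v) ≡ lineSum wrong P
  count-L-wrong P = begin
    count (points 2) (λ v → L? v ×-dec differ? (f ∣ₚ P) (Q ∣ₚ P) v)
      ≡⟨ trans (count≡∑ (points 2) (λ v → L? v ×-dec differ? (f ∣ₚ P) (Q ∣ₚ P) v)) (∑-pairs finite _) ⟩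
    (∑[ y ∈ finite ] ∑[ z ∈ finite ] 𝟙 ((z ≟ 0#) ×-dec differ? (f ∣ₚ P) (Q ∣ₚ P) (y ∷ z ∷ [])))
      ≡⟨ ∑-cong finite (λ y → trans
           (∑-cong finite (λ z → 𝟙-×-dec (z ≟ 0#) (differ? (f ∣ₚ P) (Q ∣ₚ P) (y ∷ z ∷ []))))
           (∑-𝟙≡ finite _≟_ 0# (λ z → wrong (point P (y ∷ z ∷ []))))) ⟩
    lineSum wrong P ∎
    where open ≡-Reasoning

  heavy-line : ∀ P → q ℕ.≤ 4 ℕ.* lineSum wrong P → ¬ ρ ≤ distLineRM d (f ∣ₚ P) → HeavyPlane P
  heavy-line P line = heavy-if-accepted 2 L? (origin , refl) (f ∣ₚ P) (Q ∣ₚ P) (RM-restrict {d} rmQ P)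
    (subst₂ (λ a b → a ℕ.≤ 4 ℕ.* b) (sym count-L) (sym (count-L-wrong P)) line)

  origin? : Decidable (_≡ origin)
  origin? v = ≡-dec _≟_ v origin

  -- For A = {origin} the quarter condition reads 1 ≤ 4 · 1: the origin of the first plane is x,
  -- where f and Q differ.
  heavy-start : ∀ h₀ → ¬ ρ ≤ distOriginRM d (f ∣ₚ startPlane x h₀) → HeavyPlane (startPlane x h₀)
  heavy-start h₀ = heavy-if-accepted 2 origin? (origin , refl) (f ∣ₚ P) (Q ∣ₚ P) (RM-restrict {d} rmQ P)
    (subst₂ (λ a b → a ℕ.≤ 4 ℕ.* b) (sym one) (sym one′) (s≤s z≤n))
    where
    P = startPlane x h₀
    one : count (points 2) origin? ≡ 1
    one = trans (count≡∑ (points 2) origin?) (trans (∑-cong (points 2) (λ v → sym (ℕₚ.*-identityʳ _)))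
      (∑-𝟙≡ (points 2) (≡-dec _≟_) origin (λ _ → 1)))
    point-origin : point P origin ≡ x
    point-origin = trans (⊕-0⊙ _ _) (⊕-0⊙ x _)
    one′ : count (points 2) (λ v → origin? v ×-dec differ? (f ∣ₚ P) (Q ∣ₚ P) v) ≡ 1
    one′ = trans (count≡∑ (points 2) (λ v → origin? v ×-dec differ? (f ∣ₚ P) (Q ∣ₚ P) v))
      (trans (∑-cong (points 2) (λ v → 𝟙-×-dec (origin? v) (differ? (f ∣ₚ P) (Q ∣ₚ P) v)))
      (trans (∑-𝟙≡ (points 2) (≡-dec _≟_) origin (λ v → wrong (point P v)))
      (trans (cong wrong point-origin) (𝟙-true fx≢Qx (¬? (f x ≟ Q x))))))

  lookup-planesFrom-zero : ∀ {n} P (rs : Vec Round n) → lookup (planesFrom P rs) zero ≡ P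
  lookup-planesFrom-zero P []       = refl
  lookup-planesFrom-zero P (r ∷ rs) = refl

  -- Heaviness is the invariant. It puts disagreements on half of the current plane, the good step
  -- passes a quarter on to the line, and the accepted line test restores heaviness on the next
  -- plane.
  heavy-walk : ∀ {n} P (rs : Vec Round n) → WalkOk P rs → HeavyPlane P →
    (∀ (i : Fin n) → ¬ ρ ≤ distLineRM d (f ∣ₚ lookup (planesFrom P rs) (suc i))) → HeavyPlane (lastPlane P rs)
  heavy-walk P []       ok         heavy accepted = heavy
  heavy-walk P (r ∷ rs) (ok , oks) heavy accepted = heavy-walk (step P r) rs oks
    (heavy-line (step P r) (ok half)
      (subst (λ P′ → ¬ ρ ≤ distLineRM d (f ∣ₚ P′)) (lookup-planesFrom-zero (step P r) rs) (accepted zero)))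
    (λ i → accepted (suc i))
    where
    half : q ℕ.* q ℕ.≤ 2 ℕ.* planeSum wrong P
    half = subst₂ (λ a b → a ℕ.≤ 2 ℕ.* b) (cong (q ℕ.*_) (ℕₚ.*-identityʳ q)) (disagreements≡planeSum P)
      (Heavy⇒½ {2} {f ∣ₚ P} {Q ∣ₚ P} heavy)

  finalPlane : Outcome → Plane
  finalPlane (h₀ , rs) = lastPlane (startPlane x h₀) rs

  heavy-outcome : ∀ ω → WalkOk (startPlane x (proj₁ ω)) (proj₂ ω) → ¬ Rejects d ρ f x ω → HeavyPlane (finalPlane ω)
  heavy-outcome (h₀ , rs) ok ¬rejects = heavy-walk (startPlane x h₀) rs ok
    (heavy-start h₀ (subst (λ P → ¬ ρ ≤ distOriginRM d (f ∣ₚ P)) (lookup-planesFrom-zero (startPlane x h₀) rs)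
      (λ le → ¬rejects (inj₁ le))))
    (λ i le → ¬rejects (inj₂ (i , le)))

  good≤rejected+heavy :
    (∑[ (h₀ , rs) ∈ outcomes ] 𝟙 (WalkOk? (startPlane x h₀) rs)) ℕ.≤
    count outcomes (Rejects? d ρ f x) ℕ.+ (∑[ ω ∈ outcomes ] 𝟙 (HeavyPlane? (finalPlane ω)))
  good≤rejected+heavy = ℕₚ.≤-trans
    (∑-mono outcomes (λ ω → split (WalkOk? _ _) (Rejects? d ρ f x ω) (HeavyPlane? (finalPlane ω)) (heavy-outcome ω)))
    (ℕₚ.≤-reflexive (trans (∑-+ outcomes _ _)
      (cong (ℕ._+ (∑[ ω ∈ outcomes ] 𝟙 (HeavyPlane? (finalPlane ω)))) (sym (count≡∑ outcomes (Rejects? d ρ f x))))))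
    where
    split : {A B C : Set} (a : Dec A) (b : Dec B) (c : Dec C) → (A → ¬ B → C) → 𝟙 a ℕ.≤ 𝟙 b ℕ.+ 𝟙 c
    split (no _)  _       _      _ = z≤n
    split (yes _) (yes _) _      _ = s≤s z≤n
    split (yes a) (no ¬b) c      φ = ℕₚ.≤-reflexive (sym (𝟙-true (φ a ¬b) c))

  soundness : ∀ τ → ReedMuller.dist F m f Q ≤ τ →
    (1ℚ - 4 /ᶠ F) ^ℚ m
      - ((τ + 2 /ᶠ H) ÷ (δ[ F , d ] - twice ρ)) {{δ-2ρ-nonZero F d m 2≤d 2≤m 2md≤∣F∣ ρ ρ≤δ/8}}
    ≤ Pr outcomes (Rejects? d ρ f x)
  soundness τ dist≤τ = union-bound
    ((1ℚ - 4 /ᶠ F) ^ℚ m)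
    (((τ + 2 /ᶠ H) ÷ p) {{p-nonZero}})
    p
    (Pr outcomes (Rejects? d ρ f x)) τ (2 /ᶠ H)
    (card outcomes) (count outcomes (Rejects? d ρ f x))
    (∑[ (h₀ , rs) ∈ outcomes ] 𝟙 (WalkOk? (startPlane x h₀) rs))
    (∑[ ω ∈ outcomes ] 𝟙 (HeavyPlane? (finalPlane ω)))
    (∑[ ω ∈ outcomes ] planeSum wrong (finalPlane ω))
    (∑ (points m) wrong) ((q ℕ.∸ 4) ℕ.^ m) (q ℕ.^ m) (q ℕ.* q) (h ℕ.* h)
    {{card-nonZero outcomes}} {{ℕₚ.m^n≢0 q m}} {{ℕₚ.m*n≢0 q q}} {{ℕₚ.m*n≢0 h h}}
    (ℚₚ.<-≤-trans (ℚₚ.positive⁻¹ ½) ½≤δ-2ρ)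
    (^-*-ι (1ℚ - 4 /ᶠ F) q (q ℕ.∸ 4) ([1-4/q]*ι (4 /ᶠ F) q 4≤q (/-*-ι 4 q)) m)
    (good-outcomes x)
    good≤rejected+heavy
    -- The threshold (δ - 2ρ) q² is heaviness as a number of points, so Markov's inequality counts
    -- the outcomes with a heavy last plane.
    (markov outcomes (λ ω → HeavyPlane? (finalPlane ω)) (p * ι (q ℕ.* q)) (λ ω → planeSum wrong (finalPlane ω))
      (λ ω → subst₂ (λ a b → p * ι a ≤ ι b) (cong (q ℕ.*_) (ℕₚ.*-identityʳ q)) (disagreements≡planeSum (finalPlane ω))))
    (last-plane-nearly-uniform degree wrong (λ y → 𝟙≤1 (¬? (f y ≟ Q y))) x)
    wrong≤
    1≤2/h*h²
    (÷-* (τ + 2 /ᶠ H) p {{p-nonZero}})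
    (Pr-*-ι outcomes (Rejects? d ρ f x))
    where
    p = δ[ F , d ] - twice ρ
    p-nonZero = δ-2ρ-nonZero F d m 2≤d 2≤m 2md≤∣F∣ ρ ρ≤δ/8
    instance
      q-nonZero : ℕ.NonZero q
      q-nonZero = card-nonZero (FiniteField.finite F)
      h-nonZero : ℕ.NonZero h
      h-nonZero = card-nonZero (FiniteField.finite H)
    4≤q : 4 ℕ.≤ q
    4≤q = ℕₚ.≤-trans (ℕₚ.*-monoʳ-≤ 4 (ℕₚ.≤-trans (s≤s z≤n) 2≤d)) 4d≤q
    wrong≤ : ι (∑ (points m) wrong) ≤ τ * ι (q ℕ.^ m)
    wrong≤ = begin
      ι (∑ (points m) wrong)                   ≡⟨ cong ι (count≡∑ (points m) (differ? f Q)) ⟨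
      ι (disagreements f Q)                    ≡⟨ /-*-ι (disagreements f Q) (card (points m)) {{card-nonZero (points m)}} ⟨
      dist m f Q * ι (card (points m))         ≤⟨ ℚₚ.*-monoʳ-≤-nonNeg (ι (card (points m))) dist≤τ ⟩
      τ * ι (card (points m))                  ≡⟨ cong (λ n → τ * ι n) (card-Vec finite m) ⟩
      τ * ι (q ℕ.^ m)                          ∎
      where open ℚₚ.≤-Reasoning
    -- The bound asked for has 2/|H| where the averaging gives 1/|H|²; the comparison amounts to 1 ≤
    -- 2 |H|.
    1≤2/h*h² : 1ℚ ≤ (2 /ᶠ H) * ι (h ℕ.* h)
    1≤2/h*h² = begin
      1ℚ                             ≡⟨ ι≡ 1 ⟨
      ι 1                            ≤⟨ ι-mono-≤ (ℕₚ.≤-trans (ℕ.>-nonZero⁻¹ h) (ℕₚ.m≤m+n h (h ℕ.+ 0))) ⟩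
      ι (2 ℕ.* h)                    ≡⟨ ι-* 2 h ⟩
      ι 2 * ι h                      ≡⟨ cong (_* ι h) (/-*-ι 2 h) ⟨
      (2 /ᶠ H) * ι h * ι h           ≡⟨ ℚₚ.*-assoc (2 /ᶠ H) (ι h) (ι h) ⟩
      (2 /ᶠ H) * (ι h * ι h)         ≡⟨ cong ((2 /ᶠ H) *_) (ι-* h h) ⟨
      (2 /ᶠ H) * ι (h ℕ.* h)         ∎
      where open ℚₚ.≤-Reasoning

mainTheorem4 :
    (d m : ℕ) (2≤d : 2 ℕ.≤ d) (2≤m : 2 ℕ.≤ m)
    (H F : FiniteField) → IsPrimeField H →
    (E : Extension H F) → Extension.HasDegree E m →
    (2md≤∣F∣ : 2 ℕ.* m ℕ.* d ℕ.≤ order F) →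
    (τ ρ : ℚ) → τ ≤ δ[ F , d ] * ½ → (ρ≤δ/8 : ρ ≤ δ[ F , d ] * (+ 1 / 8)) →
    (f : Vec (Carrier F) m → Carrier F) (x : Vec (Carrier F) m) →
    let open ReedMuller F
        open Walk E m
    in
    (RM m d f → (ω : Outcome) (i : Fin (suc m)) → RM 2 d (f ∣ₚ plane x ω i))
    ×
    ((Q : Vec (Carrier F) m → Carrier F) → RM m d Q → dist m f Q ≤ τ → f x ≢ Q x →
      (1ℚ - 4 /ᶠ F) ^ℚ m
        - ((τ + 2 /ᶠ H) ÷ (δ[ F , d ] - twice ρ)) {{δ-2ρ-nonZero F d m 2≤d 2≤m 2md≤∣F∣ ρ ρ≤δ/8}}
      ≤ Pr outcomes (Rejects? d ρ f x))
mainTheorem4 d m 2≤d 2≤m H F _ E degree 2md≤∣F∣ τ ρ _ ρ≤δ/8 f x =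
  (λ rmf ω i → PlaneRestriction.RM-restrict E m {d} rmf (Walk.plane E m x ω i)) ,
  (λ Q rmQ dist≤τ fx≢Qx → Soundness.soundness d m 2≤d 2≤m E degree 2md≤∣F∣ ρ ρ≤δ/8 f Q rmQ x fx≢Qx τ dist≤τ)
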